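{- Let $\rho_d$ denote the smallest efficiency of all triangulations of the cube $I^d=[0,1]^d$. Then $$\lim_{i\to\infty}\rho_i\;\le\;\sqrt[3]{\frac{44/3}{27}}\approx 0.8159 .$$
   Context: A triangulation of a $d$-dimensional polytope $P$ is a decomposition of $P$ into $d$-simplices that use as vertices only vertices of $P$ and that intersect face to face (i.e., they form a geometric simplicial complex). The size $|T|$ of a triangulation $T$ is its number of $d$-simplices. The efficiency of a triangulation $T$ of the $d$-cube $I^d=[0,1]^d$ is $(|T|/d!)^{1/d}$. For $d\ge 1$, $\phi_d$ denotes the smallest size of a triangulation of $I^d$, and $\rho_d=(\phi_d/d!)^{1/d}$ the smallest efficiency. The sequence $(\rho_i)_{i\ge 1}$ converges. -}

module Defs where

open import Algebra.Bundles using (CommutativeRing; Semiring)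
import Algebra.Definitions.RawSemiring as RawSemiringDefinitions
open import Data.Bool.Base using (Bool; if_then_else_)
open import Data.Fin.Base using (Fin)
open import Data.Fin.Subset using (Subset) renaming (_∉_ to _∉ˢ_)
open import Data.List.Base using (List; length)
open import Data.List.Membership.Propositional using () renaming (_∈_ to _∈ˡ_)
open import Data.List.Relation.Unary.AllPairs using (AllPairs)
open import Data.List.Relation.Unary.Any using (Any)
open import Data.Nat.Base as ℕ using (ℕ; suc; _!)
open import Data.Product.Base using (_×_; ∃; ∃-syntax)
open import Data.Vec.Base using (Vec; lookup)
open import Data.Vec.Functional using (Vector)
open import Level using (Level) renaming (suc to lsuc)
import Relation.Binary.Construct.StrictToNonStrict as StrictToNonStrict
open import Relation.Binary.Core using (Rel)
open import Relation.Binary.Structures using (IsStrictTotalOrder)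
open import Relation.Binary.PropositionalEquality.Core using (_≡_)
open import Relation.Nullary.Negation.Core using (¬_)
open import Relation.Unary using (Pred; Satisfiable; _∈_; _∩_; _≐_)

-- The real numbers are not constructed but characterised: classically, a
-- Dedekind-complete ordered field is unique up to unique isomorphism.
record CompleteOrderedField (ℓ : Level) : Set (lsuc ℓ) where
  field
    commutativeRing : CommutativeRing ℓ ℓ

  open CommutativeRing commutativeRing public
  open RawSemiringDefinitions (Semiring.rawSemiring semiring) public
    using (_^_; sum) renaming (_×_ to _·_)

  infix  4 _<_
  infix  9 _⁻¹
  infixl 7 _/_

  field
    0≉1                : ¬ (0# ≈ 1#)
    -- Total for convenience; the value of 0# ⁻¹ is unspecified.
    _⁻¹                : Carrier → Carrier
    *-inverseʳ         : ∀ x → ¬ (x ≈ 0#) → x * x ⁻¹ ≈ 1#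
    _<_                : Rel Carrier ℓ
    isStrictTotalOrder : IsStrictTotalOrder _≈_ _<_
    +-monoʳ-<          : ∀ x {y z} → y < z → x + y < x + z
    *-positive         : ∀ {x y} → 0# < x → 0# < y → 0# < x * y

  open StrictToNonStrict _≈_ _<_ public using (_≤_)

  IsUpperBound : Pred Carrier ℓ → Carrier → Set ℓ
  IsUpperBound P u = ∀ x → x ∈ P → x ≤ u

  IsSupremum : Pred Carrier ℓ → Carrier → Set ℓ
  IsSupremum P s = IsUpperBound P s × (∀ u → IsUpperBound P u → s ≤ u)

  field
    supremum : (P : Pred Carrier ℓ) → Satisfiable P → ∃ (IsUpperBound P) →
               ∃ (IsSupremum P)

  _/_ : Carrier → Carrier → Carrier
  x / y = x * y ⁻¹

  fromℕ : ℕ → Carrier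
  fromℕ n = n · 1#

  -- r is the n-th root of y (meant for n ≥ 1 and y ≥ 0).
  IsRoot : ℕ → Carrier → Carrier → Set ℓ
  IsRoot n y r = 0# ≤ r × r ^ n ≈ y

  IsLimit : (ℕ → Carrier) → Carrier → Set ℓ
  IsLimit a l = ∀ ε → 0# < ε →
    ∃[ N ] (∀ n → N ℕ.≤ n → l - ε < a n × a n < l + ε)

module CubeTriangulations {ℓ : Level} (ℝ : CompleteOrderedField ℓ) where
  open CompleteOrderedField ℝ

  Point : ℕ → Set ℓ
  Point d = Vector Carrier d

  Cube : (d : ℕ) → Pred (Point d) ℓ
  Cube d x = ∀ j → 0# ≤ x j × x j ≤ 1#

  -- The vertices of [0,1]^d are the points of {0,1}^d.
  Vertex : ℕ → Set
  Vertex d = Vec Bool d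

  coordinates : ∀ {d} → Vertex d → Point d
  coordinates v j = if lookup v j then 1# else 0#

  combination : ∀ {d n} → Vector Carrier n → Vector (Vertex d) n → Point d
  combination w v j = sum (λ i → w i * coordinates (v i) j)

  AffinelyIndependent : ∀ {d n} → Vector (Vertex d) n → Set ℓ
  AffinelyIndependent v = ∀ w → sum w ≈ 0# → (∀ j → combination w v j ≈ 0#) →
                          ∀ i → w i ≈ 0#

  -- A d-simplex whose vertices are vertices of the d-cube.
  record Simplex (d : ℕ) : Set ℓ where
    field
      vertices            : Vector (Vertex d) (suc d)
      affinelyIndependent : AffinelyIndependent vertices

  open Simplex public

  hull : ∀ {d} → Simplex d → Pred (Point d) ℓ
  hull σ x = ∃[ w ] (∀ i → 0# ≤ w i) × sum w ≈ 1# ×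
                    (∀ j → combination w (vertices σ) j ≈ x j)

  -- The face spanned by the vertices with index in S; it is empty for S = ∅.
  face : ∀ {d} → (σ : Simplex d) → Subset (suc d) → Pred (Point d) ℓ
  face σ S x = ∃[ w ] (∀ i → 0# ≤ w i) × (∀ i → i ∉ˢ S → w i ≈ 0#) × sum w ≈ 1# ×
                      (∀ j → combination w (vertices σ) j ≈ x j)

  IsFaceOf : ∀ {d} → Pred (Point d) ℓ → Simplex d → Set ℓ
  IsFaceOf P σ = ∃[ S ] P ≐ face σ S

  FaceToFace : ∀ {d} → Simplex d → Simplex d → Set ℓ
  FaceToFace σ τ = IsFaceOf (hull σ ∩ hull τ) σ × IsFaceOf (hull σ ∩ hull τ) τ

  record Triangulation (d : ℕ) : Set ℓ where
    field
      simplices  : List (Simplex d)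
      -- No simplex is listed twice, so that the length of the list is the size.
      distinct   : AllPairs (λ σ τ → ¬ (hull σ ≐ hull τ)) simplices
      faceToFace : ∀ {σ τ} → σ ∈ˡ simplices → τ ∈ˡ simplices → FaceToFace σ τ
      covers     : Cube d ≐ (λ x → Any (λ σ → x ∈ hull σ) simplices)

    size : ℕ
    size = length simplices

  open Triangulation public

  -- φ_d = n
  IsSmallestSize : ℕ → ℕ → Set ℓ
  IsSmallestSize d n = (∃[ T ] size {d} T ≡ n) × (∀ (T : Triangulation d) → n ℕ.≤ size T)

  -- r is the efficiency (n / d!)^{1/d} of a triangulation of size n.
  IsEfficiency : ℕ → ℕ → Carrier → Set ℓ
  IsEfficiency d n r = IsRoot d (fromℕ n / fromℕ (d !)) r

  -- ρ_d = r
  IsSmallestEfficiency : ℕ → Carrier → Set ℓ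
  IsSmallestEfficiency d r = ∃[ n ] IsSmallestSize d n × IsEfficiency d n r

{-# OPTIONS --safe #-}

-- Let T triangulate Iⁿ and colour the vertices of Iⁿ with three colours.  Over a
-- simplex of T, a triangulation of I³ × Δ² pulls back along the map to Δ² that adds
-- up the barycentric coordinates of each colour; a simplex with rᵢ vertices over
-- the i-th vertex of Δ² becomes a join of three products of simplices, which are
-- triangulated by staircases.  This triangulates I³ × Iⁿ.  For a random colouring,
-- the expected number of simplices is about |T| n³ / 27 times the sum of
-- ∏ 1 / (rᵢ - 1)! over the triangulation of I³ × Δ²; for the one below that sum is
-- 44 / 3.  Iterating from n to n + 3 gives the bound.
module Submission where

open import Defs
import Algebra.Properties.CommutativeSemigroup as CommutativeSemigroupProperties
import Algebra.Properties.CommutativeSemiring.Exp as CommutativeSemiringExp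
import Algebra.Properties.Ring as RingProperties
import Algebra.Properties.Semiring.Exp as SemiringExp
import Algebra.Properties.Semiring.Mult as SemiringMult
open import Data.Bool.Base using (Bool; true; false; if_then_else_)
import Data.Bool.Properties as Bool
open import Data.Fin.Base as Fin using (Fin; zero; suc)
open import Data.Fin.Patterns using (0F; 1F; 2F)
import Data.Fin.Properties as Fin
open import Data.Fin.Subset using (Subset) renaming (_∈_ to _∈ˢ_; _∉_ to _∉ˢ_)
import Data.Fin.Subset.Properties as Subset
open import Data.Integer.Base as ℤ using (ℤ; +_; -[1+_]; _⊖_)
import Data.Integer.Properties as ℤ
open import Data.List.Base as List using (List; []; _∷_; _++_; length; filterᵇ)
open import Data.List.Membership.Propositional using (_∈_; _∉_; find; lose)
open import Data.List.Membership.Propositional.Properties 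
  using (∈-filter⁺; ∈-filter⁻; ∈-map⁺; ∈-map⁻; ∈-++⁺ˡ; ∈-++⁺ʳ; ∈-++⁻;
         ∈-tabulate⁺; ∈-tabulate⁻; ∈-allFin; ∈-concatMap⁺; ∈-concatMap⁻;
         ∈-cartesianProduct⁺; ∈-cartesianProductWith⁺; ∈-cartesianProductWith⁻)
open import Data.List.Membership.Propositional.Properties.WithK using (unique∧set⇒bag)
import Data.List.Properties as List
open import Data.List.Relation.Binary.BagAndSetEquality using (∼bag⇒↭)
open import Data.List.Relation.Binary.Permutation.Propositional as Perm using (_↭_)
open import Data.List.Relation.Binary.Permutation.Propositional.Properties using (↭-length)
open import Data.List.Relation.Binary.Subset.Propositional using (_⊆_)
open import Data.List.Relation.Unary.All as All using (All; []; _∷_)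
import Data.List.Relation.Unary.All.Properties as All
open import Data.List.Relation.Unary.AllPairs as AllPairs using (AllPairs; []; _∷_; allPairs?)
import Data.List.Relation.Unary.AllPairs.Properties as AllPairs
open import Data.List.Relation.Unary.Any as Any using (Any; here; there)
open import Data.List.Relation.Unary.Unique.Propositional using (Unique)
import Data.List.Relation.Unary.Unique.Propositional.Properties as Unique
open import Data.Nat.Base as ℕ using (ℕ; zero; suc; _!)
open import Data.Nat.ListAction using () renaming (sum to sumℕ)
import Data.Nat.Properties as ℕ
open import Data.Nat.Tactic.RingSolver using (solve-∀)
open import Data.Product.Base using (_×_; _,_; proj₁; proj₂; ∃-syntax; swap)
open import Data.Product.Properties using (≡-dec)
open import Data.Sum.Base using (_⊎_; inj₁; inj₂; [_,_]′)
open import Data.Vec.Base as Vec using (Vec; []; _∷_; lookup)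
open import Data.Vec.Functional using (Vector)
import Data.Vec.Properties as Vec
open import Function.Base using (_∘_; _on_; id)
open import Function.Bundles using (mk⇔)
open import Relation.Binary.Bundles using (StrictPartialOrder)
import Relation.Binary.Construct.StrictToNonStrict as StrictToNonStrict
open import Relation.Binary.Definitions using (DecidableEquality; tri<; tri≈; tri>)
open import Relation.Binary.PropositionalEquality as ≡ using (_≡_; _≢_)
import Relation.Binary.Reasoning.Setoid as SetoidReasoning
import Relation.Binary.Reasoning.StrictPartialOrder as StrictReasoning
open import Relation.Binary.Structures using (IsStrictTotalOrder)
open import Relation.Nullary using (¬_; Dec; yes; no; does; contradiction)
open import Relation.Nullary.Decidable using (_×-dec_; _⊎-dec_; ¬?; from-yes; map′; dec-true; dec-false)
open import Relation.Unary using (Pred; Decidable; _∩_)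

-- A cell of shape (r₀, r₁, r₂) yields about ∏ kᵢ^(rᵢ - 1) / (rᵢ - 1)! simplices over kᵢ vertices of
-- colour i; the exponents add up to 3 and kᵢ is about n / 3, whence the sum in question. The
-- obstacle is to prove that the result is a triangulation without any theory of polytopes.
-- Simplices are therefore handled through weights on the vertices of the cube (`IsComplex`): every
-- point has weights on some facet, and weights on two facets with equal total and moments coincide.
-- Both properties are proved factor by factor. For I³ × Δ² they follow from regularity: weights on
-- a cell minimise the average height, and a point lies in the cell whose interpolant is largest
-- there, so a table of integers can be checked by evaluation. For a product of two simplices, the
-- north-west corner rule finds weights on a staircase, and a noncrossing matrix is determined by
-- its row and column sums. The colouring is not drawn at random but chosen vertex by vertex, with
-- potentials in place of expectations. The bound for each step contains (n + 6)³ in place of n³;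
-- the accumulated loss is polynomial in n and disappears in the n-th root.

-- The vertices of the cube and their common order

rank : ∀ {d} → Vec Bool d → ℕ
rank []              = 0
rank (_∷_ {d} b v)   = (if b then 2 ℕ.^ d else 0) ℕ.+ rank v

_≟ᵛ_ : ∀ {d} → DecidableEquality (Vec Bool d)
_≟ᵛ_ = Vec.≡-dec Bool._≟_

cubeVertices : ∀ d → List (Vec Bool d)
cubeVertices zero    = [] ∷ []
cubeVertices (suc d) = List.map (false ∷_) (cubeVertices d) ++ List.map (true ∷_) (cubeVertices d)

∈-cubeVertices : ∀ {d} (v : Vec Bool d) → v ∈ cubeVertices d
∈-cubeVertices []          = here ≡.refl
∈-cubeVertices (false ∷ v) = ∈-++⁺ˡ (∈-map⁺ (false ∷_) (∈-cubeVertices v))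
∈-cubeVertices (true  ∷ v) = ∈-++⁺ʳ _ (∈-map⁺ (true ∷_) (∈-cubeVertices v))

rank<2^d : ∀ {d} (v : Vec Bool d) → rank v ℕ.< 2 ℕ.^ d
rank<2^d []                  = ℕ.s≤s ℕ.z≤n
rank<2^d (_∷_ {d} false v)   = ℕ.<-≤-trans (rank<2^d v) (ℕ.m≤m+n _ _)
rank<2^d (_∷_ {d} true v)    = ℕ.+-monoʳ-< (2 ℕ.^ d) (ℕ.<-≤-trans (rank<2^d v) (ℕ.m≤m+n _ 0))

rank-injective : ∀ {d} (u v : Vec Bool d) → rank u ≡ rank v → u ≡ v
rank-injective []          []          _  = ≡.refl
rank-injective (false ∷ u) (false ∷ v) eq = ≡.cong (false ∷_) (rank-injective u v eq)
rank-injective (true  ∷ u) (true  ∷ v) eq = ≡.cong (true ∷_)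
    (rank-injective u v (ℕ.+-cancelˡ-≡ _ _ _ eq))
rank-injective (false ∷ u) (true  ∷ v) eq = contradiction
    (ℕ.≤-trans (ℕ.m≤m+n _ _) (ℕ.≤-reflexive (≡.sym eq))) (ℕ.<⇒≱ (rank<2^d u))
rank-injective (true  ∷ u) (false ∷ v) eq = contradiction
    (ℕ.≤-trans (ℕ.m≤m+n _ _) (ℕ.≤-reflexive eq)) (ℕ.<⇒≱ (rank<2^d v))

cubeVertices-sorted : ∀ d → AllPairs (ℕ._<_ on rank) (cubeVertices d)
cubeVertices-sorted zero    = [] ∷ []
cubeVertices-sorted (suc d) = AllPairs.++⁺
  (AllPairs.map⁺ (cubeVertices-sorted d))
  (AllPairs.map⁺ (AllPairs.map (ℕ.+-monoʳ-< (2 ℕ.^ d)) (cubeVertices-sorted d)))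
  (All.map⁺ (All.tabulate λ {u} _ → All.map⁺ (All.tabulate λ {v} _ →
      ℕ.<-≤-trans (rank<2^d u) (ℕ.m≤m+n _ _))))

sorted⇒Unique : ∀ {d} {vs : List (Vec Bool d)} → AllPairs (ℕ._<_ on rank) vs → Unique vs
sorted⇒Unique = AllPairs.map λ { u<v ≡.refl → ℕ.<-irrefl ≡.refl u<v }

cubeVertices-unique : ∀ d → Unique (cubeVertices d)
cubeVertices-unique d = sorted⇒Unique (cubeVertices-sorted d)

module Membership {d : ℕ} where
  open import Data.List.Membership.DecPropositional (_≟ᵛ_ {d}) public using (_∈?_)
open Membership public

-- Filtering the full list sorts a facet by `rank`. One order of the vertices for all facets is what
-- lets the staircases over neighbouring facets fit together.
arrange : ∀ {d} → List (Vec Bool d) → List (Vec Bool d)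
arrange {d} F = List.filter (_∈? F) (cubeVertices d)

arrange-sorted : ∀ {d} (F : List (Vec Bool d)) → AllPairs (ℕ._<_ on rank) (arrange F)
arrange-sorted F = AllPairs.filter⁺ (_∈? F) (cubeVertices-sorted _)

arrange-↭ : ∀ {d} {F : List (Vec Bool d)} → Unique F → arrange F ↭ F
arrange-↭ {d} {F} unique = ∼bag⇒↭ (unique∧set⇒bag (sorted⇒Unique (arrange-sorted F)) unique
  (mk⇔ (λ v∈ → proj₂ (∈-filter⁻ (_∈? F) {xs = cubeVertices d} v∈))
      (∈-filter⁺ (_∈? F) (∈-cubeVertices _))))

asVector : ∀ {a} {A : Set a} {n} (xs : List A) → length xs ≡ n → ∃[ v ] List.tabulate {n = n} v ≡ xs
asVector xs ≡.refl = List.lookup xs , List.tabulate-lookup xs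

-- Staircases and balanced colourings

module Staircases where
  open import Data.List.Properties using (length-map; length-++; map-cong; map-∘)
  open import Data.Nat.Base using (_+_; _*_; _≤_; _<_; z≤n; s≤s)
  open import Data.Nat.ListAction using (sum)
  open ≡

  -- For r ≥ 1 this is the binomial coefficient C(r + k - 2, r - 1), the number of monotone lattice
  -- paths through an r × k grid. The conventions at k = 0 matter: a single vertex over a missing
  -- colour has one (empty) staircase, several vertices have none, so that cells which collapse are
  -- not counted.
  multichoose : ℕ → ℕ → ℕ
  multichoose 0             k       = 0
  multichoose 1             k       = 1
  multichoose (suc (suc r)) 0       = 0
  multichoose (suc (suc r)) (suc k) = multichoose (suc r) (suc k) + multichoose (suc (suc r)) k

  2*multichoose₃ : ∀ k → 2 * multichoose 3 k ≡ k * suc k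
  multichoose₂ : ∀ k → multichoose 2 k ≡ k
  multichoose₂ zero    = refl
  multichoose₂ (suc k) = cong suc (multichoose₂ k)
  2*multichoose₃ zero    = refl
  2*multichoose₃ (suc k) = begin
    2 * (multichoose 2 (suc k) + multichoose 3 k)     ≡⟨ ℕ.*-distribˡ-+ 2
        (multichoose 2 (suc k)) _ ⟩
    2 * multichoose 2 (suc k) + 2 * multichoose 3 k   ≡⟨ cong₂ (λ x y → 2 * x + y)
        (multichoose₂ (suc k)) (2*multichoose₃ k) ⟩
    2 * suc k + k * suc k                             ≡⟨ identity k ⟩
    suc k * suc (suc k)                               ∎
    where
    open ≡-Reasoning
    identity : ∀ k → 2 * suc k + k * suc k ≡ suc k * suc (suc k)
    identity = solve-∀

  6*multichoose₄ : ∀ k → 6 * multichoose 4 k ≡ k * suc k * suc (suc k)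
  6*multichoose₄ zero    = refl
  6*multichoose₄ (suc k) = begin
    6 * (multichoose 3 (suc k) + multichoose 4 k)        ≡⟨ regroup (multichoose 3 (suc k))
        (multichoose 4 k) ⟩
    3 * (2 * multichoose 3 (suc k)) + 6 * multichoose 4 k ≡⟨ cong₂ (λ x y → 3 * x + y)
        (2*multichoose₃ (suc k)) (6*multichoose₄ k) ⟩
    3 * (suc k * suc (suc k)) + k * suc k * suc (suc k)  ≡⟨ identity k ⟩
    suc k * suc (suc k) * suc (suc (suc k))              ∎
    where
    open ≡-Reasoning
    regroup : ∀ x y → 6 * (x + y) ≡ 3 * (2 * x) + 6 * y
    regroup = solve-∀
    identity : ∀ k → 3 * (suc k * suc (suc k)) + k * suc k * suc (suc k) ≡ suc k * suc (suc k)
        * suc (suc (suc k))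
    identity = solve-∀

  module _ {A B : Set} where

    -- The simplices of the staircase triangulation of a product of two simplices;
    -- the product of a point with the empty simplex has the empty staircase.
    staircases : List A → List B → List (List (A × B))
    staircases []            bs       = []
    staircases (a ∷ [])      bs       = List.map (a ,_) bs ∷ []
    staircases (a ∷ a′ ∷ as) []       = []
    staircases (a ∷ a′ ∷ as) (b ∷ bs) =
      List.map ((a , b) ∷_) (staircases (a′ ∷ as) (b ∷ bs) ++ staircases (a ∷ a′ ∷ as) bs)

    length-staircases : ∀ as bs → length (staircases as bs) ≡ multichoose (length as) (length bs)
    length-staircases []            bs       = refl
    length-staircases (a ∷ [])      bs       = refl
    length-staircases (a ∷ a′ ∷ as) []       = refl
    length-staircases (a ∷ a′ ∷ as) (b ∷ bs) =
      trans (length-map _ (staircases (a′ ∷ as) (b ∷ bs) ++ staircases (a ∷ a′ ∷ as) bs))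
     (trans (length-++ (staircases (a′ ∷ as) (b ∷ bs)))
            (cong₂ _+_ (length-staircases (a′ ∷ as) (b ∷ bs)) (length-staircases (a ∷ a′ ∷ as) bs)))

    staircase-length : ∀ as bs {P} → P ∈ staircases as bs → suc (length P) ≡ length as + length bs
    staircase-length (a ∷ [])      bs       (here refl) = cong suc (length-map (a ,_) bs)
    staircase-length (a ∷ a′ ∷ as) (b ∷ bs) P∈
      with Q , Q∈ , refl ← ∈-map⁻ ((a , b) ∷_) P∈
      with ∈-++⁻ (staircases (a′ ∷ as) (b ∷ bs)) Q∈
    ... | inj₁ Q∈₁ = cong suc (staircase-length (a′ ∷ as) (b ∷ bs) Q∈₁)
    ... | inj₂ Q∈₂ = trans (cong suc (staircase-length (a ∷ a′ ∷ as) bs Q∈₂))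
                           (sym (ℕ.+-suc (length (a ∷ a′ ∷ as)) (length bs)))

    staircase-⊆ : ∀ as bs {P} → P ∈ staircases as bs → All (λ p → proj₁ p ∈ as × proj₂ p ∈ bs) P
    staircase-⊆ (a ∷ [])      bs       (here refl) = All.map⁺ (All.tabulate (here refl ,_))
    staircase-⊆ (a ∷ a′ ∷ as) (b ∷ bs) P∈
      with Q , Q∈ , refl ← ∈-map⁻ ((a , b) ∷_) P∈
      with ∈-++⁻ (staircases (a′ ∷ as) (b ∷ bs)) Q∈
    ... | inj₁ Q∈₁ = (here refl , here refl) ∷
                     All.map (λ (x , y) → there x , y) (staircase-⊆ (a′ ∷ as) (b ∷ bs) Q∈₁)
    ... | inj₂ Q∈₂ = (here refl , here refl) ∷
                     All.map (λ (x , y) → x , there y) (staircase-⊆ (a ∷ a′ ∷ as) bs Q∈₂)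

    module _ (f : A → ℕ) (g : B → ℕ) where

      -- The strict product order of the ranks: given the first two components, the third one
      -- excludes equality, and does so without a case distinction.
      Below : A × B → A × B → Set
      Below (a , b) (a′ , b′) = f a ≤ f a′ × g b ≤ g b′ × f a + g b < f a′ + g b′

      staircase-Below : ∀ as bs {P} → P ∈ staircases as bs →
                        AllPairs (_<_ on f) as → AllPairs (_<_ on g) bs → AllPairs Below P
      staircase-Below (a ∷ [])      bs       (here refl) _ bs↗ =
        AllPairs.map⁺ (AllPairs.map (λ b<b′ → ℕ.≤-refl , ℕ.<⇒≤ b<b′ , ℕ.+-monoʳ-< (f a) b<b′) bs↗)
      staircase-Below (a ∷ a′ ∷ as) (b ∷ bs) P∈ (a< ∷ as↗) (b< ∷ bs↗)
        with Q , Q∈ , refl ← ∈-map⁻ ((a , b) ∷_) P∈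
        with ∈-++⁻ (staircases (a′ ∷ as) (b ∷ bs)) Q∈
      ... | inj₁ Q∈₁ =
        All.map (λ { (x∈ , y∈) → let a<x = All.lookup a< x∈
                                     b≤y = All.lookup (ℕ.≤-refl ∷ All.map ℕ.<⇒≤ b<) y∈
                                 in ℕ.<⇒≤ a<x , b≤y , ℕ.+-mono-<-≤ a<x b≤y })
                (staircase-⊆ (a′ ∷ as) (b ∷ bs) Q∈₁)
        ∷ staircase-Below (a′ ∷ as) (b ∷ bs) Q∈₁ as↗ (b< ∷ bs↗)
      ... | inj₂ Q∈₂ =
        All.map (λ { (x∈ , y∈) → let a≤x = All.lookup (ℕ.≤-refl ∷ All.map ℕ.<⇒≤ a<) x∈
                                     b<y = All.lookup b< y∈
                                 in a≤x , ℕ.<⇒≤ b<y , ℕ.+-mono-≤-< a≤x b<y })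
                (staircase-⊆ (a ∷ a′ ∷ as) bs Q∈₂)
        ∷ staircase-Below (a ∷ a′ ∷ as) bs Q∈₂ (a< ∷ as↗) bs↗

      Below⇒Unique : ∀ {P} → AllPairs Below P → Unique P
      Below⇒Unique = AllPairs.map λ { (_ , _ , p<q) refl → ℕ.<-irrefl refl p<q }

      -- Of two entries of a chain, the earlier one is below the later one in both coordinates, so
      -- the coordinates cannot be ordered oppositely. From this property the uniqueness of weights
      -- on a staircase is derived.
      Below⇒noncrossing : ∀ {P a b a′ b′} → AllPairs Below P → (a , b) ∈ P → (a′ , b′) ∈ P →
                          f a < f a′ → ¬ g b′ < g b
      Below⇒noncrossing (_ ∷ _)  (here refl) (here refl) a<a′ _    = ℕ.<-irrefl refl a<a′
      Below⇒noncrossing (p ∷ _)  (here refl) (there q∈)  _    b′<b =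
          ℕ.<⇒≱ b′<b (proj₁ (proj₂ (All.lookup p q∈)))
      Below⇒noncrossing (q ∷ _)  (there p∈)  (here refl) a<a′ _    =
          ℕ.<⇒≱ a<a′ (proj₁ (All.lookup q p∈))
      Below⇒noncrossing (_ ∷ ps) (there p∈)  (there q∈)            = Below⇒noncrossing ps p∈ q∈

  -- Potentials for the expected number of simplices

  Σ₃ : (Fin 3 → ℕ) → ℕ
  Σ₃ f = f 0F + (f 1F + f 2F)

  Counts : Set
  Counts = ℕ × ℕ × ℕ

  bump : Fin 3 → Counts → Counts
  bump 0F (k₀ , k₁ , k₂) = suc k₀ , k₁ , k₂
  bump 1F (k₀ , k₁ , k₂) = k₀ , suc k₁ , k₂
  bump 2F (k₀ , k₁ , k₂) = k₀ , k₁ , suc k₂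

  -- An upper bound for the expectation of 162 f at the final counts when m
  -- vertices are still to be coloured uniformly at random and k counts the
  -- coloured ones; the factor 162 = 6 · 3³ clears the denominators.
  record Potential (f : Counts → ℕ) (w : ℕ) : Set where
    field
      ψ     : ℕ → Counts → ℕ
      step  : ∀ m k → Σ₃ (λ i → ψ m (bump i k)) ≤ 3 * ψ (suc m) k
      final   : ∀ k → 162 * f k ≤ ψ 0 k
      initial : ∀ m → ψ m (0 , 0 , 0) ≤ w * (m + 5) ℕ.^ 3

  open Potential

  Σ₃-+ : ∀ f g → Σ₃ (λ i → f i + g i) ≡ Σ₃ f + Σ₃ g
  Σ₃-+ f g = identity (f 0F) (f 1F) (f 2F) (g 0F) (g 1F) (g 2F)
    where
    identity : ∀ a b c x y z → (a + x) + ((b + y) + (c + z)) ≡ (a + (b + c)) + (x + (y + z))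
    identity = solve-∀

  -- Linearity of expectation: the potentials of single cells add up to one for the whole
  -- triangulation of I³ × Δ².
  _+ᵖ_ : ∀ {f g v w} → Potential f v → Potential g w → Potential (λ k → f k + g k) (v + w)
  _+ᵖ_ {f} {g} {v} {w} p q = record
    { ψ     = λ m k → ψ p m k + ψ q m k
    ; step  = λ m k → ℕ.≤-trans
        (ℕ.≤-reflexive (Σ₃-+ (λ i → ψ p m (bump i k)) (λ i → ψ q m (bump i k))))
        (ℕ.≤-trans (ℕ.+-mono-≤ (step p m k) (step q m k))
                   (ℕ.≤-reflexive (sym (ℕ.*-distribˡ-+ 3 (ψ p (suc m) k) (ψ q (suc m) k)))))
    ; final = λ k → ℕ.≤-trans (ℕ.≤-reflexive (ℕ.*-distribˡ-+ 162 (f k) (g k)))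
                              (ℕ.+-mono-≤ (final p k) (final q k))
    ; initial = λ m → ℕ.≤-trans (ℕ.+-mono-≤ (initial p m) (initial q m))
                              (ℕ.≤-reflexive (sym (ℕ.*-distribʳ-+ ((m + 5) ℕ.^ 3) v w)))
    }

  0ᵖ : Potential (λ _ → 0) 0
  0ᵖ = record { ψ = λ _ _ → 0 ; step = λ _ _ → z≤n ; final = λ _ → z≤n ; initial = λ _ → z≤n }

  swapᵖ : ∀ {f w} → Potential f w → Potential (λ (k₀ , k₁ , k₂) → f (k₁ , k₀ , k₂)) w
  swapᵖ p = record
    { ψ     = λ m (k₀ , k₁ , k₂) → ψ p m (k₁ , k₀ , k₂)
    ; step  = λ m (k₀ , k₁ , k₂) → ℕ.≤-trans
        (ℕ.≤-reflexive (identity (ψ p m (k₁ , suc k₀ , k₂)) (ψ p m (suc k₁ , k₀ , k₂)) _))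
        (step p m (k₁ , k₀ , k₂))
    ; final = λ (k₀ , k₁ , k₂) → final p (k₁ , k₀ , k₂)
    ; initial = initial p
    }
    where
    identity : ∀ a b c → a + (b + c) ≡ b + (a + c)
    identity = solve-∀

  rotateᵖ : ∀ {f w} → Potential f w → Potential (λ (k₀ , k₁ , k₂) → f (k₁ , k₂ , k₀)) w
  rotateᵖ p = record
    { ψ     = λ m (k₀ , k₁ , k₂) → ψ p m (k₁ , k₂ , k₀)
    ; step  = λ m (k₀ , k₁ , k₂) → ℕ.≤-trans
        (ℕ.≤-reflexive (identity (ψ p m (k₁ , k₂ , suc k₀)) (ψ p m (suc k₁ , k₂ , k₀)) _))
        (step p m (k₁ , k₂ , k₀))
    ; final = λ (k₀ , k₁ , k₂) → final p (k₁ , k₂ , k₀)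
    ; initial = initial p
    }
    where
    identity : ∀ a b c → a + (b + c) ≡ b + (c + a)
    identity = solve-∀

  congᵖ : ∀ {f g w} → (∀ k → f k ≡ g k) → Potential f w → Potential g w
  congᵖ f≗g p = record
    { ψ = ψ p ; step = step p ; initial = initial p
    ; final = λ k → subst (λ n → 162 * n ≤ ψ p 0 k) (f≗g k) (final p k) }

  Shape : Set
  Shape = ℕ × ℕ × ℕ

  -- The number of simplices that a mixed cell of shape r contributes over a
  -- simplex with kᵢ vertices of colour i.
  shapeCount : Shape → Counts → ℕ
  shapeCount (r₀ , r₁ , r₂) (k₀ , k₁ , k₂) =
    multichoose r₀ k₀ * (multichoose r₁ k₁ * multichoose r₂ k₂)

  -- If x = 3k + m, then x and the other two such numbers are the (scaled) expected
  -- numbers of vertices of the three colours; the lower order terms account for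
  -- the variance.
  parallelepipedᵖ : Potential (shapeCount (2 , 2 , 2)) 6
  parallelepipedᵖ = record
    { ψ     = λ m (k₀ , k₁ , k₂) → 6 * ((3 * k₀ + m) * ((3 * k₁ + m) * (3 * k₂ + m)))
    ; step  = λ m (k₀ , k₁ , k₂) → ℕ.≤-trans (ℕ.m≤m+n _ _)
        (ℕ.≤-reflexive (step-identity m k₀ k₁ k₂))
    ; final = λ (k₀ , k₁ , k₂) → ℕ.≤-reflexive (trans
        (cong (162 *_) (cong₂ _*_ (multichoose₂ k₀)
            (cong₂ _*_ (multichoose₂ k₁) (multichoose₂ k₂))))
        (final-identity k₀ k₁ k₂))
    ; initial = λ m → ℕ.≤-trans (ℕ.m≤m+n _ _) (ℕ.≤-reflexive (start-identity m))
    }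
    where
    step-identity : ∀ m a b c →
      (6 * ((3 * suc a + m) * ((3 * b + m) * (3 * c + m)))
       + (6 * ((3 * a + m) * ((3 * suc b + m) * (3 * c + m)))
       + 6 * ((3 * a + m) * ((3 * b + m) * (3 * suc c + m)))))
      + 18 * (3 * a + 3 * b + 3 * c + 3 * m + 1)
      ≡ 3 * (6 * ((3 * a + suc m) * ((3 * b + suc m) * (3 * c + suc m))))
    step-identity = solve-∀
    final-identity : ∀ a b c → 162 * (a * (b * c)) ≡ 6 * ((3 * a + 0) * ((3 * b + 0) * (3 * c + 0)))
    final-identity = solve-∀
    start-identity : ∀ m → 6 * (m * (m * m)) + 6 * (15 * m * m + 75 * m + 125) ≡ 6
        * ((m + 5) * ((m + 5) * ((m + 5) * 1)))
    start-identity = solve-∀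

  -- Let x = 3 k₀ + m and y = 3 k₁ + m. Each of the m uncoloured vertices adds 2 to the variance of
  -- three times the final count of colour 0; this is the term 2 m y. Counts of different colours
  -- are negatively correlated, so the covariances may be dropped; they are the slack in
  -- `step-identity`.
  prismᵖ : Potential (shapeCount (3 , 2 , 1)) 3
  prismᵖ = record
    { ψ     = λ m (k₀ , k₁ , k₂) → 3 * ((3 * k₀ + m) * (3 * k₀ + m + 3) * (3 * k₁ + m) + 2 * m
        * (3 * k₁ + m))
    ; step  = λ m (k₀ , k₁ , k₂) → ℕ.≤-trans (ℕ.m≤m+n _ _) (ℕ.≤-reflexive (step-identity m k₀ k₁))
    ; final = λ (k₀ , k₁ , k₂) → ℕ.≤-reflexive (trans
        (regroup (multichoose 3 k₀) (multichoose 2 k₁))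
        (trans (cong₂ (λ x y → 81 * (x * y)) (2*multichoose₃ k₀) (multichoose₂ k₁))
               (final-identity k₀ k₁)))
    ; initial = λ m → ℕ.≤-trans (ℕ.m≤m+n _ _) (ℕ.≤-reflexive (start-identity m))
    }
    where
    step-identity : ∀ m a b →
      (3 * ((3 * suc a + m) * (3 * suc a + m + 3) * (3 * b + m) + 2 * m * (3 * b + m))
       + (3 * ((3 * a + m) * (3 * a + m + 3) * (3 * suc b + m) + 2 * m * (3 * suc b + m))
       + 3 * ((3 * a + m) * (3 * a + m + 3) * (3 * b + m) + 2 * m * (3 * b + m))))
      + 9 * (2 * (3 * a + m) + 6)
      ≡ 3 * (3 * ((3 * a + suc m) * (3 * a + suc m + 3) * (3 * b + suc m) + 2 * suc m
          * (3 * b + suc m)))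
    step-identity = solve-∀
    regroup : ∀ x y → 162 * (x * (y * 1)) ≡ 81 * (2 * x * y)
    regroup = solve-∀
    final-identity : ∀ a b → 81 * (a * suc a * b) ≡ 3
        * ((3 * a + 0) * (3 * a + 0 + 3) * (3 * b + 0) + 2 * 0 * (3 * b + 0))
    final-identity = solve-∀
    start-identity : ∀ m → 3 * (m * (m + 3) * m + 2 * m * m) + 3 * (10 * m * m + 75 * m + 125) ≡ 3
        * ((m + 5) * ((m + 5) * ((m + 5) * 1)))
    start-identity = solve-∀

  -- This is the exact expectation, so `step` is an equality. Let x = 3 k₀ + m and let X be three
  -- times the final count. The second and third central moments of X are both 2 m, and expanding X
  -- (X + 3) (X + 6) around x gives the correction 3 · 2 m · x + 2 m + 9 · 2 m.
  tetrahedronᵖ : Potential (shapeCount (4 , 1 , 1)) 1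
  tetrahedronᵖ = record
    { ψ     = λ m (k₀ , k₁ , k₂) → (3 * k₀ + m) * (3 * k₀ + m + 3) * (3 * k₀ + m + 6) + 6 * m
        * (3 * k₀ + m) + 20 * m
    ; step  = λ m (k₀ , k₁ , k₂) → ℕ.≤-reflexive (step-identity m k₀)
    ; final = λ (k₀ , k₁ , k₂) → ℕ.≤-reflexive (trans
        (regroup (multichoose 4 k₀))
        (trans (cong (27 *_) (6*multichoose₄ k₀)) (final-identity k₀)))
    -- The origin of the 5 in `Potential`: the left side is m³ + 15 m² + 38 m, and 5 is the least
    -- shift for which the coefficient of m² in (m + 5)³ reaches 15.
    ; initial = λ m → ℕ.≤-trans (ℕ.m≤m+n _ _) (ℕ.≤-reflexive (start-identity m))
    }
    where
    step-identity : ∀ m a →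
      ((3 * suc a + m) * (3 * suc a + m + 3) * (3 * suc a + m + 6) + 6 * m
          * (3 * suc a + m) + 20 * m)
       + (((3 * a + m) * (3 * a + m + 3) * (3 * a + m + 6) + 6 * m * (3 * a + m) + 20 * m)
       + ((3 * a + m) * (3 * a + m + 3) * (3 * a + m + 6) + 6 * m * (3 * a + m) + 20 * m))
      ≡ 3 * ((3 * a + suc m) * (3 * a + suc m + 3) * (3 * a + suc m + 6) + 6 * suc m
          * (3 * a + suc m) + 20 * suc m)
    step-identity = solve-∀
    regroup : ∀ x → 162 * (x * 1) ≡ 27 * (6 * x)
    regroup = solve-∀
    final-identity : ∀ a → 27 * (a * suc a * suc (suc a)) ≡ (3 * a + 0) * (3 * a + 0 + 3)
        * (3 * a + 0 + 6) + 6 * 0 * (3 * a + 0) + 20 * 0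
    final-identity = solve-∀
    start-identity : ∀ m → m * (m + 3) * (m + 6) + 6 * m * m + 20 * m + (37 * m + 125) ≡ 1
        * ((m + 5) * ((m + 5) * ((m + 5) * 1)))
    start-identity = solve-∀

  swapShape : ∀ r₀ r₁ r₂ {w} → Potential (shapeCount (r₀ , r₁ , r₂)) w →
      Potential (shapeCount (r₁ , r₀ , r₂)) w
  swapShape r₀ r₁ r₂ p = congᵖ
    (λ (k₀ , k₁ , k₂) → identity (multichoose r₀ k₁) (multichoose r₁ k₀)
        (multichoose r₂ k₂)) (swapᵖ p)
    where
    identity : ∀ a b c → a * (b * c) ≡ b * (a * c)
    identity = solve-∀

  rotateShape : ∀ r₀ r₁ r₂ {w} → Potential (shapeCount (r₀ , r₁ , r₂)) w →
      Potential (shapeCount (r₂ , r₀ , r₁)) w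
  rotateShape r₀ r₁ r₂ p = congᵖ
    (λ (k₀ , k₁ , k₂) → identity (multichoose r₀ k₁) (multichoose r₁ k₂)
        (multichoose r₂ k₀)) (rotateᵖ p)
    where
    identity : ∀ a b c → a * (b * c) ≡ c * (a * b)
    identity = solve-∀

  -- All triples of positive numbers with sum 6, each with the weight 6 / ∏ (rᵢ - 1)!; the factor 6
  -- makes the weights integers.
  admissibleShapes : List (Shape × ℕ)
  admissibleShapes =
    ((2 , 2 , 2) , 6) ∷
    ((3 , 2 , 1) , 3) ∷ ((1 , 3 , 2) , 3) ∷ ((2 , 1 , 3) , 3) ∷
    ((2 , 3 , 1) , 3) ∷ ((1 , 2 , 3) , 3) ∷ ((3 , 1 , 2) , 3) ∷
    ((4 , 1 , 1) , 1) ∷ ((1 , 4 , 1) , 1) ∷ ((1 , 1 , 4) , 1) ∷ []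

  shapePotentials : All (λ (r , w) → Potential (shapeCount r) w) admissibleShapes
  shapePotentials =
    parallelepipedᵖ ∷
    prismᵖ ∷ rotateShape 3 2 1 prismᵖ ∷ rotateShape 1 3 2 (rotateShape 3 2 1 prismᵖ) ∷
    prismᵖ′ ∷ rotateShape 2 3 1 prismᵖ′ ∷ rotateShape 1 2 3 (rotateShape 2 3 1 prismᵖ′) ∷
    tetrahedronᵖ ∷ rotateShape 4 1 1 tetrahedronᵖ
        ∷ rotateShape 1 4 1 (rotateShape 4 1 1 tetrahedronᵖ) ∷ []
    where
    prismᵖ′ = swapShape 3 2 1 prismᵖ

  totalCount : List (Shape × ℕ) → Counts → ℕ
  totalCount rs k = sum (List.map (λ r → shapeCount (proj₁ r) k) rs)

  totalPotential : ∀ rs → All (_∈ admissibleShapes) rs →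
      Potential (totalCount rs) (sum (List.map proj₂ rs))
  totalPotential []       []       = 0ᵖ
  totalPotential (r ∷ rs) (p ∷ ps) = All.lookup shapePotentials p +ᵖ totalPotential rs ps

  sum-map-≤ : ∀ {I : Set} (f g : I → ℕ) xs → (∀ x → f x ≤ g x) →
      sum (List.map f xs) ≤ sum (List.map g xs)
  sum-map-≤ f g []       f≤g = z≤n
  sum-map-≤ f g (x ∷ xs) f≤g = ℕ.+-mono-≤ (f≤g x) (sum-map-≤ f g xs f≤g)

  sum-map-* : ∀ {I : Set} n (f : I → ℕ) xs → sum (List.map (λ x → n * f x) xs) ≡ n
      * sum (List.map f xs)
  sum-map-* n f []       = sym (ℕ.*-zeroʳ n)
  sum-map-* n f (x ∷ xs) = trans (cong (λ y → n * f x + y) (sum-map-* n f xs))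
      (sym (ℕ.*-distribˡ-+ n (f x) _))

  sum-map-Σ₃ : ∀ {I : Set} (f : I → Fin 3 → ℕ) xs →
               Σ₃ (λ i → sum (List.map (λ x → f x i) xs)) ≡ sum (List.map (λ x → Σ₃ (f x)) xs)
  sum-map-Σ₃ f []       = refl
  sum-map-Σ₃ f (x ∷ xs) = trans (Σ₃-+ (f x) (λ i → sum (List.map (λ y → f y i) xs)))
      (cong (λ y → Σ₃ (f x) + y) (sum-map-Σ₃ f xs))

  minimum≤average : ∀ (f : Fin 3 → ℕ) n → Σ₃ f ≤ 3 * n → ∃[ i ] f i ≤ n
  minimum≤average f n Σf≤3n with f 0F ℕ.≤? n | f 1F ℕ.≤? n | f 2F ℕ.≤? n
  ... | yes f₀≤n | _        | _        = 0F , f₀≤n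
  ... | no _     | yes f₁≤n | _        = 1F , f₁≤n
  ... | no _     | no _     | yes f₂≤n = 2F , f₂≤n
  ... | no f₀≰n  | no f₁≰n  | no f₂≰n  = contradiction Σf≤3n (ℕ.<⇒≱ (begin-strict
    n + (n + (n + 0)) ≡⟨ cong (λ x → n + (n + x)) (ℕ.+-identityʳ n) ⟩
    n + (n + n)       <⟨ ℕ.+-mono-< (ℕ.≰⇒> f₀≰n) (ℕ.+-mono-< (ℕ.≰⇒> f₁≰n) (ℕ.≰⇒> f₂≰n)) ⟩
    Σ₃ f              ∎))
    where open ℕ.≤-Reasoning

  _⊕_ : Counts → Counts → Counts
  (k₀ , k₁ , k₂) ⊕ (l₀ , l₁ , l₂) = k₀ + l₀ , k₁ + l₁ , k₂ + l₂

  bump-⊕ : ∀ i k l → bump i k ⊕ l ≡ k ⊕ bump i l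
  bump-⊕ 0F (k₀ , _) (l₀ , _)         = cong₂ _,_ (sym (ℕ.+-suc k₀ l₀)) refl
  bump-⊕ 1F (_ , k₁ , _) (_ , l₁ , _) = cong₂ _,_ refl (cong₂ _,_ (sym (ℕ.+-suc k₁ l₁)) refl)
  bump-⊕ 2F (_ , _ , k₂) (_ , _ , l₂) = cong₂ _,_ refl (cong₂ _,_ refl (sym (ℕ.+-suc k₂ l₂)))

  -- A colouring that is at least as good as the average

  module Colouring {V : Set} (_≟_ : DecidableEquality V) where

    recolour : V → Fin 3 → (V → Fin 3) → V → Fin 3
    recolour v i c u = if does (u ≟ v) then i else c u

    -- Here S is the indicator of a simplex, and k holds the counts of its vertices that already
    -- have a colour; the accumulator lets `greedy` fix the colours one vertex at a time.
    colourCounts : (V → Fin 3) → (V → Bool) → List V → Counts → Counts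
    colourCounts c S []       k = k
    colourCounts c S (v ∷ vs) k = colourCounts c S vs (if S v then bump (c v) k else k)

    colourCounts-cong : ∀ {c c′} S vs k → All (λ v → c v ≡ c′ v) vs →
        colourCounts c S vs k ≡ colourCounts c′ S vs k
    colourCounts-cong S []       k []         = refl
    colourCounts-cong S (v ∷ vs) k (eq ∷ eqs) rewrite eq = colourCounts-cong S vs _ eqs


    colourCounts-fresh : ∀ {v vs} i c S k → All (v ≢_) vs →
                         colourCounts c S vs k ≡ colourCounts (recolour v i c) S vs k
    colourCounts-fresh {v} {vs} i c S k v∉ = colourCounts-cong S vs k
      (All.map (λ {u} v≢u → sym (cong (if_then i else c u) (dec-false (u ≟ v) (v≢u ∘ sym)))) v∉)

    colourClass : (V → Fin 3) → Fin 3 → List V → List V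
    colourClass c i = List.filter (λ v → c v Fin.≟ i)

    classCounts : (V → Fin 3) → List V → Counts
    classCounts c xs = length (colourClass c 0F xs) , length (colourClass c 1F xs) ,
        length (colourClass c 2F xs)

    classCounts-∷ : ∀ c v xs → classCounts c (v ∷ xs) ≡ bump (c v) (classCounts c xs)
    classCounts-∷ c v xs with c v
    ... | 0F = refl
    ... | 1F = refl
    ... | 2F = refl

    colourCounts-filter : ∀ c S vs k → colourCounts c S vs k ≡ k ⊕ classCounts c (filterᵇ S vs)
    colourCounts-filter c S [] (k₀ , k₁ , k₂) =
      sym (cong₂ _,_ (ℕ.+-identityʳ k₀) (cong₂ _,_ (ℕ.+-identityʳ k₁) (ℕ.+-identityʳ k₂)))
    colourCounts-filter c S (v ∷ vs) k with S v
    ... | false = colourCounts-filter c S vs k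
    ... | true  = trans (colourCounts-filter c S vs (bump (c v) k))
                 (trans (bump-⊕ (c v) k (classCounts c (filterᵇ S vs)))
                        (cong (k ⊕_) (sym (classCounts-∷ c v (filterᵇ S vs)))))

    -- The method of conditional expectations.
    greedy : ∀ {f w} (p : Potential f w) vs → Unique vs → (items : List ((V → Bool) × Counts)) →
      ∃[ c ] sum (List.map (λ (S , k) → ψ p 0 (colourCounts c S vs k)) items)
           ≤ sum (List.map (λ (S , k) → ψ p (length (filterᵇ S vs)) k) items)
    greedy p []       []            items = (λ _ → 0F) , ℕ.≤-refl
    greedy p (v ∷ vs) (v∉vs ∷ uniq) items = recolour v i c , (begin
      sum (List.map (λ (S , k) → ψ p 0 (colourCounts (recolour v i c) S (v ∷ vs) k)) items)
        ≡⟨ cong sum (map-cong (λ (S , k) → cong (ψ p 0) (sym (start-counts S k))) items) ⟩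
      sum (List.map (λ (S , k) → ψ p 0 (colourCounts c S vs (add i S k))) items)
        ≡⟨ cong sum (map-∘ items) ⟩
      sum (List.map (λ (S , k) → ψ p 0 (colourCounts c S vs k))
          (List.map (λ (S , k) → S , add i S k) items))
        ≤⟨ proj₂ recursive ⟩
      sum (List.map (λ (S , k) → ψ p (length (filterᵇ S vs)) k)
          (List.map (λ (S , k) → S , add i S k) items))
        ≡⟨ cong sum (sym (map-∘ items)) ⟩
      value i
        ≤⟨ proj₂ best ⟩
      target ∎)
      where
      open ℕ.≤-Reasoning
      add : Fin 3 → (V → Bool) → Counts → Counts
      add i S k = if S v then bump i k else k
      value : Fin 3 → ℕ
      value i = sum (List.map (λ (S , k) → ψ p (length (filterᵇ S vs)) (add i S k)) items)
      target : ℕ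
      target = sum (List.map (λ (S , k) → ψ p (length (filterᵇ S (v ∷ vs))) k) items)
      average : ∀ S k → Σ₃ (λ i → ψ p (length (filterᵇ S vs)) (add i S k)) ≤ 3
          * ψ p (length (filterᵇ S (v ∷ vs))) k
      average S k with S v
      ... | true  = step p (length (filterᵇ S vs)) k
      ... | false = ℕ.≤-reflexive (cong (λ x → y + (y + x)) (sym (ℕ.+-identityʳ y)))
        where y = ψ p (length (filterᵇ S vs)) k
      best : ∃[ i ] value i ≤ target
      best = minimum≤average value target (begin
        Σ₃ value
          ≡⟨ sum-map-Σ₃ (λ (S , k) i → ψ p (length (filterᵇ S vs)) (add i S k)) items ⟩
        sum (List.map (λ (S , k) → Σ₃ (λ i → ψ p (length (filterᵇ S vs)) (add i S k))) items)
          ≤⟨ sum-map-≤ _ _ items (λ (S , k) → average S k) ⟩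
        sum (List.map (λ (S , k) → 3 * ψ p (length (filterᵇ S (v ∷ vs))) k) items)
          ≡⟨ sum-map-* 3 _ items ⟩
        3 * target ∎)
      i = proj₁ best
      recursive = greedy p vs uniq (List.map (λ (S , k) → S , add i S k) items)
      c = proj₁ recursive
      start-counts : ∀ S k → colourCounts c S vs (add i S k)
          ≡ colourCounts (recolour v i c) S (v ∷ vs) k
      start-counts S k = trans (colourCounts-fresh i c S (add i S k) v∉vs)
        (cong (λ j → colourCounts (recolour v i c) S vs (if S v then bump j k else k))
              (sym (cong (if_then i else c v) (dec-true (v ≟ v) refl))))

    -- One colouring has to serve all simplices at once, so their potentials are summed before the
    -- greedy choice. As every simplex has m vertices, all of them start from the same value.
    balancedColouring : ∀ {f w} → Potential f w → ∀ vs → Unique vs → ∀ m (Ss : List (V → Bool)) →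
      All (λ S → length (filterᵇ S vs) ≡ m) Ss →
      ∃[ c ] 162 * sum (List.map (λ S → f (classCounts c (filterᵇ S vs))) Ss) ≤ length Ss
          * (w * (m + 5) ℕ.^ 3)
    balancedColouring {f} {w} p vs uniq m Ss sizes = c , (begin
      162 * sum (List.map (λ S → f (classCounts c (filterᵇ S vs))) Ss)
        ≡⟨ sym (sum-map-* 162 _ Ss) ⟩
      sum (List.map (λ S → 162 * f (classCounts c (filterᵇ S vs))) Ss)
        ≤⟨ sum-map-≤ _ _ Ss (λ S → ℕ.≤-trans (final p _)
             (ℕ.≤-reflexive (cong (ψ p 0) (sym (colourCounts-filter c S vs (0 , 0 , 0)))))) ⟩
      sum (List.map (λ S → ψ p 0 (colourCounts c S vs (0 , 0 , 0))) Ss)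
        ≡⟨ cong sum (map-∘ Ss) ⟩
      sum (List.map (λ (S , k) → ψ p 0 (colourCounts c S vs k)) (List.map (_, (0 , 0 , 0)) Ss))
        ≤⟨ proj₂ coloured ⟩
      sum (List.map (λ (S , k) → ψ p (length (filterᵇ S vs)) k) (List.map (_, (0 , 0 , 0)) Ss))
        ≡⟨ cong sum (sym (map-∘ Ss)) ⟩
      sum (List.map (λ S → ψ p (length (filterᵇ S vs)) (0 , 0 , 0)) Ss)
        ≤⟨ bound Ss sizes ⟩
      length Ss * (w * (m + 5) ℕ.^ 3) ∎)
      where
      open ℕ.≤-Reasoning
      coloured = greedy p vs uniq (List.map (_, (0 , 0 , 0)) Ss)
      c = proj₁ coloured
      bound : ∀ Ss → All (λ S → length (filterᵇ S vs) ≡ m) Ss →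
              sum (List.map (λ S → ψ p (length (filterᵇ S vs)) (0 , 0 , 0)) Ss) ≤ length Ss
                  * (w * (m + 5) ℕ.^ 3)
      bound []       []          = z≤n
      bound (S ∷ Ss) (eq ∷ eqs) rewrite eq = ℕ.+-mono-≤ (initial p m) (bound Ss eqs)

open Staircases

-- A triangulation of I³ × Δ²

module MixedTriangulation where
  open ≡

  -- A vertex a of the cube in the fibre over the i-th vertex of the triangle.
  Label : Set
  Label = Fin 3 × Vec Bool 3

  _≟ˡ_ : DecidableEquality Label
  _≟ˡ_ = ≡-dec Fin._≟_ _≟ᵛ_

  -- The first three coordinates are those of the cube, the others are the
  -- barycentric coordinates of the triangle.
  Form : Set
  Form = Vec ℤ 6

  -- The vertices of a simplex, each with six times its barycentric coordinate.
  Cell : Set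
  Cell = List (Label × Form)

  private
    o p2 p3 p4 p6 p8 p9 p12 m2 m3 m4 m6 m9 m12 m18 : ℤ
    o   = + 0
    p2  = + 2
    p3  = + 3
    p4  = + 4
    p6  = + 6
    p8  = + 8
    p9  = + 9
    p12 = + 12
    m2  = -[1+ 1 ]
    m3  = -[1+ 2 ]
    m4  = -[1+ 3 ]
    m6  = -[1+ 5 ]
    m9  = -[1+ 8 ]
    m12 = -[1+ 11 ]
    m18 = -[1+ 17 ]

    row : Fin 3 → Vec Bool 3 → ℤ → ℤ → ℤ → ℤ → ℤ → ℤ → Label × Form
    row i a x₀ x₁ x₂ μ₀ μ₁ μ₂ = (i , a) , x₀ ∷ x₁ ∷ x₂ ∷ μ₀ ∷ μ₁ ∷ μ₂ ∷ []

  a000 a001 a010 a011 a100 a101 a110 a111 : Vec Bool 3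
  a000 = false ∷ false ∷ false ∷ []
  a001 = false ∷ false ∷ true  ∷ []
  a010 = false ∷ true  ∷ false ∷ []
  a011 = false ∷ true  ∷ true  ∷ []
  a100 = true  ∷ false ∷ false ∷ []
  a101 = true  ∷ false ∷ true  ∷ []
  a110 = true  ∷ true  ∷ false ∷ []
  a111 = true  ∷ true  ∷ true  ∷ []

  table : ∀ {A : Set} → A → A → A → A → A → A → A → A → Vec Bool 3 → A
  table x₀ x₁ x₂ x₃ x₄ x₅ x₆ x₇ (b₂ ∷ b₁ ∷ b₀ ∷ []) =
    if b₂ then (if b₁ then (if b₀ then x₇ else x₆) else (if b₀ then x₅ else x₄))
          else (if b₁ then (if b₀ then x₃ else x₂) else (if b₀ then x₁ else x₀))

  -- The triangulation of I³ × Δ² consists of the lower faces for these heights.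
  height : Label → ℤ
  height (0F , a) = table (+ 3) (+ 0) (+ 1) (+ 3) (+ 0) (+ 3) (+ 2) (+ 1) a
  height (1F , a) = table (+ 1) (+ 1) (+ 0) (+ 1) (+ 2) (+ 0) (+ 2) (+ 2) a
  height (2F , a) = table (+ 0) (+ 3) (+ 2) (+ 0) (+ 3) (+ 3) (+ 1) (+ 3) a

  opaque
    -- One block per lower cell. The forms of a block are the rows of the inverse of the matrix of
    -- its vertices, times 6 because the denominators 2 and 3 occur. The list is opaque, and is
    -- unfolded only where a decision procedure is evaluated on it.
    mixedCells : List Cell
    mixedCells =
      ( row 0F a000 m6  m6  m6  p6  o   o   ∷
        row 0F a001 o   o   p6  o   o   o   ∷
        row 0F a010 o   p6  o   o   o   o   ∷
        row 0F a100 p6  o   o   o   o   o   ∷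
        row 1F a000 o   o   o   o   p6  o   ∷
        row 2F a000 o   o   o   o   o   p6  ∷ [] ) ∷
      ( row 0F a001 o   m6  o   p6  p6  p6  ∷
        row 0F a010 o   o   m6  p6  p6  p6  ∷
        row 0F a011 m6  p6  p6  m6  m12 m12 ∷
        row 0F a111 p6  o   o   o   o   o   ∷
        row 1F a011 o   o   o   o   p6  o   ∷
        row 2F a011 o   o   o   o   o   p6  ∷ [] ) ∷
      ( row 0F a001 m3  m3  p3  p3  p3  o   ∷
        row 0F a010 m3  p3  m3  p3  m3  o   ∷
        row 0F a100 p3  m3  m3  p3  p3  p6  ∷
        row 0F a111 p3  p3  p3  m3  m3  m6  ∷
        row 1F a010 o   o   o   o   p6  o   ∷
        row 2F a011 o   o   o   o   o   p6  ∷ [] ) ∷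
      ( row 0F a001 o   o   p6  o   o   o   ∷
        row 0F a010 m6  o   m6  p6  o   o   ∷
        row 0F a100 p6  o   o   o   o   o   ∷
        row 1F a000 m6  m6  m6  p6  p6  o   ∷
        row 1F a010 p6  p6  p6  m6  o   o   ∷
        row 2F a000 o   o   o   o   o   p6  ∷ [] ) ∷
      ( row 0F a001 m3  m3  p3  p3  p3  o   ∷
        row 0F a010 m3  p3  m3  p3  m3  o   ∷
        row 0F a100 p6  o   o   o   o   o   ∷
        row 1F a010 o   o   o   o   p6  o   ∷
        row 2F a000 m3  m3  m3  p3  p3  p6  ∷
        row 2F a011 p3  p3  p3  m3  m3  o   ∷ [] ) ∷
      ( row 0F a001 o   m6  o   p6  p6  p6  ∷
        row 0F a010 m6  p6  o   o   m6  m6  ∷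
        row 0F a111 p6  o   o   o   o   o   ∷
        row 1F a010 p6  m6  m6  p6  p12 p12 ∷
        row 1F a011 m6  p6  p6  m6  m6  m12 ∷
        row 2F a011 o   o   o   o   o   p6  ∷ [] ) ∷
      ( row 0F a001 m6  o   o   p6  p6  p6  ∷
        row 0F a100 o   o   m6  p6  p6  p6  ∷
        row 0F a101 p6  m6  p6  m6  m12 m12 ∷
        row 0F a111 o   p6  o   o   o   o   ∷
        row 1F a101 o   o   o   o   p6  o   ∷
        row 2F a101 o   o   o   o   o   p6  ∷ [] ) ∷
      ( row 0F a001 m4  m2  p2  p4  p2  o   ∷
        row 0F a100 p2  m2  m4  p4  p2  p6  ∷
        row 0F a111 p2  p4  p2  m2  m4  m6  ∷
        row 1F a010 m2  p2  m2  p2  p4  o   ∷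
        row 1F a101 p2  m2  p2  m2  p2  o   ∷
        row 2F a011 o   o   o   o   o   p6  ∷ [] ) ∷
      ( row 0F a001 m3  m3  p3  p3  o   o   ∷
        row 0F a100 o   o   m6  p6  p6  p6  ∷
        row 0F a111 p3  p3  p3  m3  m6  m6  ∷
        row 1F a101 o   o   o   o   p6  o   ∷
        row 2F a011 m3  p3  m3  p3  p6  p6  ∷
        row 2F a101 p3  m3  p3  m3  m6  o   ∷ [] ) ∷
      ( row 0F a001 m3  o   p3  p3  o   o   ∷
        row 0F a100 p3  o   m3  p3  o   o   ∷
        row 1F a000 m3  m6  m3  p3  p6  o   ∷
        row 1F a010 o   p6  o   o   o   o   ∷
        row 1F a101 p3  o   p3  m3  o   o   ∷
        row 2F a000 o   o   o   o   o   p6  ∷ [] ) ∷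
      ( row 0F a001 m4  m2  p2  p4  p2  o   ∷
        row 0F a100 p4  p2  m2  p2  m2  o   ∷
        row 1F a010 m2  p2  m2  p2  p4  o   ∷
        row 1F a101 p2  m2  p2  m2  p2  o   ∷
        row 2F a000 m2  m4  m2  p2  p4  p6  ∷
        row 2F a011 p2  p4  p2  m2  m4  o   ∷ [] ) ∷
      ( row 0F a001 m3  m3  p3  p3  o   o   ∷
        row 0F a100 p3  p3  m3  p3  o   o   ∷
        row 1F a101 o   o   o   o   p6  o   ∷
        row 2F a000 m3  m3  m3  p3  p6  p6  ∷
        row 2F a011 o   p6  o   o   o   o   ∷
        row 2F a101 p3  m3  p3  m3  m6  o   ∷ [] ) ∷
      ( row 0F a001 m3  m3  o   p6  p3  p3  ∷
        row 0F a111 p3  p3  o   o   m3  m3  ∷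
        row 1F a010 o   o   m6  p6  p6  p6  ∷
        row 1F a011 m3  p3  p6  m6  m3  m9  ∷
        row 1F a101 p3  m3  o   o   p3  p3  ∷
        row 2F a011 o   o   o   o   o   p6  ∷ [] ) ∷
      ( row 0F a001 o   o   o   p6  o   o   ∷
        row 1F a000 o   m6  m6  p6  p6  o   ∷
        row 1F a001 m6  o   p6  m6  o   o   ∷
        row 1F a010 o   p6  o   o   o   o   ∷
        row 1F a101 p6  o   o   o   o   o   ∷
        row 2F a000 o   o   o   o   o   p6  ∷ [] ) ∷
      ( row 0F a001 o   o   o   p6  o   o   ∷
        row 1F a001 m6  m6  o   o   p6  p6  ∷
        row 1F a010 o   o   m6  p6  p6  p6  ∷
        row 1F a011 o   p6  p6  m6  m6  m12 ∷
        row 1F a101 p6  o   o   o   o   o   ∷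
        row 2F a011 o   o   o   o   o   p6  ∷ [] ) ∷
      ( row 0F a001 o   o   o   p6  o   o   ∷
        row 1F a001 m6  m3  p3  m3  p3  o   ∷
        row 1F a010 o   p3  m3  p3  p3  o   ∷
        row 1F a101 p6  o   o   o   o   o   ∷
        row 2F a000 o   m3  m3  p3  p3  p6  ∷
        row 2F a011 o   p3  p3  m3  m3  o   ∷ [] ) ∷
      ( row 0F a001 o   o   o   p6  o   o   ∷
        row 1F a001 m6  o   o   o   p6  o   ∷
        row 1F a101 p6  o   o   o   o   o   ∷
        row 2F a000 o   o   m6  p6  p6  p6  ∷
        row 2F a001 o   m6  p6  m6  m6  o   ∷
        row 2F a011 o   p6  o   o   o   o   ∷ [] ) ∷
      ( row 0F a001 o   o   o   p6  o   o   ∷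
        row 1F a101 o   o   o   o   p6  o   ∷
        row 2F a000 o   o   m6  p6  p6  p6  ∷
        row 2F a001 m6  m6  p6  m6  o   o   ∷
        row 2F a011 o   p6  o   o   o   o   ∷
        row 2F a101 p6  o   o   o   m6  o   ∷ [] ) ∷
      ( row 0F a010 m6  o   o   p6  o   p6  ∷
        row 0F a100 o   m6  o   p6  p6  p6  ∷
        row 0F a110 p6  p6  m6  m6  m6  m12 ∷
        row 0F a111 o   o   p6  o   o   o   ∷
        row 1F a010 o   o   o   o   p6  o   ∷
        row 2F a110 o   o   o   o   o   p6  ∷ [] ) ∷
      ( row 0F a010 m3  p3  m3  p3  m3  o   ∷
        row 0F a100 o   m6  o   p6  p6  p6  ∷
        row 0F a111 p3  p3  p3  m3  m3  m6  ∷
        row 1F a010 o   o   o   o   p6  o   ∷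
        row 2F a011 m3  m3  p3  p3  p3  p6  ∷
        row 2F a110 p3  p3  m3  m3  m3  o   ∷ [] ) ∷
      ( row 0F a010 m3  p3  m3  p3  m3  o   ∷
        row 0F a100 p3  m3  p3  p3  p3  o   ∷
        row 1F a010 o   o   o   o   p6  o   ∷
        row 2F a000 m3  m3  m3  p3  p3  p6  ∷
        row 2F a011 o   o   p6  o   o   o   ∷
        row 2F a110 p3  p3  m3  m3  m3  o   ∷ [] ) ∷
      ( row 0F a010 o   o   o   p6  o   o   ∷
        row 1F a010 o   o   o   o   p6  o   ∷
        row 2F a000 o   m6  o   p6  p6  p6  ∷
        row 2F a010 m6  p6  m6  m6  m6  o   ∷
        row 2F a011 o   o   p6  o   o   o   ∷
        row 2F a110 p6  o   o   o   o   o   ∷ [] ) ∷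
      ( row 0F a100 o   m6  o   p6  p6  p6  ∷
        row 0F a110 o   p6  m6  o   m6  m6  ∷
        row 0F a111 o   o   p6  o   o   o   ∷
        row 1F a010 m6  o   o   p6  p6  p6  ∷
        row 1F a110 p6  o   o   m6  o   m6  ∷
        row 2F a110 o   o   o   o   o   p6  ∷ [] ) ∷
      ( row 0F a100 o   m3  m3  p6  p3  p3  ∷
        row 0F a111 o   p3  p3  o   m3  m3  ∷
        row 1F a010 m6  o   o   p6  p6  p6  ∷
        row 1F a101 o   m3  p3  o   p3  p3  ∷
        row 1F a110 p6  p3  m3  m6  m3  m9  ∷
        row 2F a110 o   o   o   o   o   p6  ∷ [] ) ∷
      ( row 0F a100 m2  m4  m2  p8  p4  p6  ∷
        row 0F a111 p2  p4  p2  m2  m4  m6  ∷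
        row 1F a010 m2  p2  m2  p2  p4  o   ∷
        row 1F a101 p2  m2  p2  m2  p2  o   ∷
        row 2F a011 m4  m2  p2  p4  p2  p6  ∷
        row 2F a110 p4  p2  m2  m4  m2  o   ∷ [] ) ∷
      ( row 0F a100 m3  m3  m3  p9  p6  p6  ∷
        row 0F a111 p3  p3  p3  m3  m6  m6  ∷
        row 1F a101 o   o   o   o   p6  o   ∷
        row 2F a011 m6  o   o   p6  p6  p6  ∷
        row 2F a101 p3  m3  p3  m3  m6  o   ∷
        row 2F a110 p3  p3  m3  m3  o   o   ∷ [] ) ∷
      ( row 0F a100 o   o   o   p6  o   o   ∷
        row 1F a000 m6  m6  o   p6  p6  o   ∷
        row 1F a010 o   p6  o   o   o   o   ∷
        row 1F a100 p6  o   m6  m6  o   o   ∷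
        row 1F a101 o   o   p6  o   o   o   ∷
        row 2F a000 o   o   o   o   o   p6  ∷ [] ) ∷
      ( row 0F a100 o   o   o   p6  o   o   ∷
        row 1F a010 m6  o   o   p6  p6  p6  ∷
        row 1F a100 o   m6  m6  o   p6  p6  ∷
        row 1F a101 o   o   p6  o   o   o   ∷
        row 1F a110 p6  p6  o   m6  m6  m12 ∷
        row 2F a110 o   o   o   o   o   p6  ∷ [] ) ∷
      ( row 0F a100 o   o   o   p6  o   o   ∷
        row 1F a010 m3  p3  o   p3  p3  o   ∷
        row 1F a100 p3  m3  m6  m3  p3  o   ∷
        row 1F a101 o   o   p6  o   o   o   ∷
        row 2F a000 m3  m3  o   p3  p3  p6  ∷
        row 2F a110 p3  p3  o   m3  m3  o   ∷ [] ) ∷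
      ( row 0F a100 o   o   o   p6  o   o   ∷
        row 1F a010 m2  p2  m2  p2  p4  o   ∷
        row 1F a101 p2  m2  p2  m2  p2  o   ∷
        row 2F a000 m2  m4  m2  p2  p4  p6  ∷
        row 2F a011 m2  p2  p4  p2  m2  o   ∷
        row 2F a110 p4  p2  m2  m4  m2  o   ∷ [] ) ∷
      ( row 0F a100 o   o   o   p6  o   o   ∷
        row 1F a100 o   o   m6  o   p6  o   ∷
        row 1F a101 o   o   p6  o   o   o   ∷
        row 2F a000 m6  o   o   p6  p6  p6  ∷
        row 2F a100 p6  m6  o   m6  m6  o   ∷
        row 2F a110 o   p6  o   o   o   o   ∷ [] ) ∷
      ( row 0F a100 o   o   o   p6  o   o   ∷
        row 1F a101 o   o   o   o   p6  o   ∷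
        row 2F a000 m3  m3  m3  p3  p6  p6  ∷
        row 2F a011 m3  p3  p3  p3  o   o   ∷
        row 2F a101 p3  m3  p3  m3  m6  o   ∷
        row 2F a110 p3  p3  m3  m3  o   o   ∷ [] ) ∷
      ( row 0F a100 o   o   o   p6  o   o   ∷
        row 1F a101 o   o   o   o   p6  o   ∷
        row 2F a000 m6  o   o   p6  p6  p6  ∷
        row 2F a100 p6  m6  m6  m6  o   o   ∷
        row 2F a101 o   o   p6  o   m6  o   ∷
        row 2F a110 o   p6  o   o   o   o   ∷ [] ) ∷
      ( row 0F a111 o   o   o   p6  o   o   ∷
        row 1F a010 o   o   m6  p6  p6  p6  ∷
        row 1F a011 m6  o   p6  o   o   m6  ∷
        row 1F a101 o   m6  o   p6  p6  p6  ∷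
        row 1F a111 p6  p6  o   m12 m6  m6  ∷
        row 2F a011 o   o   o   o   o   p6  ∷ [] ) ∷
      ( row 0F a111 o   o   o   p6  o   o   ∷
        row 1F a010 m6  o   o   p6  p6  p6  ∷
        row 1F a101 o   m6  o   p6  p6  p6  ∷
        row 1F a110 p6  o   m6  o   o   m6  ∷
        row 1F a111 o   p6  p6  m12 m6  m6  ∷
        row 2F a110 o   o   o   o   o   p6  ∷ [] ) ∷
      ( row 0F a111 o   o   o   p6  o   o   ∷
        row 1F a010 m3  o   m3  p6  p6  p3  ∷
        row 1F a101 o   m6  o   p6  p6  p6  ∷
        row 1F a111 p3  p6  p3  m12 m6  m9  ∷
        row 2F a011 m3  o   p3  o   o   p3  ∷
        row 2F a110 p3  o   m3  o   o   p3  ∷ [] ) ∷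
      ( row 0F a111 o   o   o   p6  o   o   ∷
        row 1F a101 o   m6  o   p6  p6  p6  ∷
        row 1F a111 o   p6  o   m6  o   m6  ∷
        row 2F a011 m6  o   o   p6  p6  p6  ∷
        row 2F a110 o   o   m6  p6  p6  p6  ∷
        row 2F a111 p6  o   p6  m12 m12 m6  ∷ [] ) ∷
      ( row 0F a111 o   o   o   p6  o   o   ∷
        row 1F a101 o   o   o   o   p6  o   ∷
        row 2F a011 m6  o   o   p6  p6  p6  ∷
        row 2F a101 o   m6  o   p6  o   p6  ∷
        row 2F a110 o   o   m6  p6  p6  p6  ∷
        row 2F a111 p6  p6  p6  m18 m12 m12 ∷ [] ) ∷
      []

  infixl 6 _⊞_
  infixr 7 _⊡_

  _⊞_ : ∀ {n} → Vec ℤ n → Vec ℤ n → Vec ℤ n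
  _⊞_ = Vec.zipWith ℤ._+_

  _⊡_ : ∀ {n} → ℤ → Vec ℤ n → Vec ℤ n
  c ⊡ φ = Vec.map (c ℤ.*_) φ

  𝟎 : ∀ {n} → Vec ℤ n
  𝟎 = Vec.replicate _ (+ 0)

  basis : ∀ {n} → Fin n → Vec ℤ n
  basis zero    = + 1 ∷ 𝟎
  basis (suc j) = + 0 ∷ basis j

  dot : ∀ {n} → Vec ℤ n → Vec ℤ n → ℤ
  dot []      []      = + 0
  dot (c ∷ φ) (x ∷ v) = c ℤ.* x ℤ.+ dot φ v

  bit : Bool → ℤ
  bit b = if b then + 1 else + 0

  -- Homogeneous coordinates: the last three add up to 1 at every vertex, so each affine function on
  -- I³ × Δ² is a linear form without constant term.
  labelPoint : Label → Form
  labelPoint (i , a) = Vec.map bit a Vec.++ basis i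

  combine : ∀ {n} {I : Set} → (I → ℤ) → (I → Vec ℤ n) → List I → Vec ℤ n
  combine c φ []       = 𝟎
  combine c φ (x ∷ xs) = c x ⊡ φ x ⊞ combine c φ xs

  labels : Cell → List Label
  labels = List.map proj₁

  fibre : Fin 3 → Cell → List (Vec Bool 3)
  fibre i τ = List.map (proj₂ ∘ proj₁) (List.filter (λ e → proj₁ (proj₁ e) Fin.≟ i) τ)

  -- Six times the linear function that interpolates the heights on τ.
  interpolant : Cell → Form
  interpolant = combine (height ∘ proj₁) proj₂

  shape : Cell → Shape
  shape τ = length (fibre 0F τ) , length (fibre 1F τ) , length (fibre 2F τ)

  -- The functions x_j, 1 - x_j and μ_i.
  facetForms : List Form
  facetForms = List.map basis (List.allFin 6) List.++
    List.map (λ j → total ⊞ (ℤ.- (+ 1)) ⊡ basis j) (0F ∷ 1F ∷ 2F ∷ [])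
    where
    total : Form
    total = basis (3 Fin.↑ʳ 0F) ⊞ basis (3 Fin.↑ʳ 1F) ⊞ basis (3 Fin.↑ʳ 2F)

  -- This identity and `Dual` say from the two sides that forms and vertices are inverse matrices,
  -- up to the factor 6. The former produces weights that represent a given point, the latter reads
  -- a weight off the moments; evaluating both replaces linear algebra.
  Reconstructs : Cell → Set
  Reconstructs τ = All (λ j → combine (λ e → lookup (labelPoint (proj₁ e)) j) proj₂ τ
      ≡ (+ 6) ⊡ basis j) (List.allFin 6)

  Dual : Cell → Set
  Dual τ = All (λ e → dot (proj₂ e) (labelPoint (proj₁ e)) ≡ + 6 ×
                      All (λ e′ → proj₁ e ≡ proj₁ e′
                          ⊎ dot (proj₂ e) (labelPoint (proj₁ e′)) ≡ + 0) τ) τ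

  opaque
    allLabels : List Label
    allLabels = List.cartesianProduct (List.allFin 3) (cubeVertices 3)

  open import Data.List.Membership.DecPropositional _≟ˡ_ public using () renaming (_∈?_ to _∈ˡ?_)

  -- The certificate of a lower face: the hyperplane through the lifted vertices of τ passes
  -- strictly below all other lifted vertices. Strictness makes the lower face the simplex τ itself.
  Lower : Cell → Set
  Lower τ = All (λ u →
      (u ∈ labels τ × dot (interpolant τ) (labelPoint u) ≡ + 6 ℤ.* height u)
    ⊎ (u ∉ labels τ × dot (interpolant τ) (labelPoint u) ℤ.< + 6 ℤ.* height u)) allLabels

  reconstructs? : Decidable Reconstructs
  reconstructs? τ = All.all? (λ j → Vec.≡-dec ℤ._≟_
      (combine (λ e → lookup (labelPoint (proj₁ e)) j) proj₂ τ) ((+ 6) ⊡ basis j)) (List.allFin 6)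

  dual? : Decidable Dual
  dual? τ = All.all? (λ e → (dot (proj₂ e) (labelPoint (proj₁ e)) ℤ.≟ + 6) ×-dec
    All.all? (λ e′ → (proj₁ e ≟ˡ proj₁ e′) ⊎-dec (dot (proj₂ e)
        (labelPoint (proj₁ e′)) ℤ.≟ + 0)) τ) τ

  lower? : Decidable Lower
  lower? τ = All.all? (λ u →
    ((u ∈ˡ? labels τ) ×-dec (dot (interpolant τ) (labelPoint u) ℤ.≟ + 6 ℤ.* height u)) ⊎-dec
    (¬? (u ∈ˡ? labels τ) ×-dec (dot (interpolant τ) (labelPoint u) ℤ.<? + 6
        ℤ.* height u))) allLabels

  opaque
    unfolding mixedCells

    reconstructs : All Reconstructs mixedCells
    reconstructs = from-yes (All.all? reconstructs? mixedCells)

  opaque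
    unfolding mixedCells

    dual : All Dual mixedCells
    dual = from-yes (All.all? dual? mixedCells)

  opaque
    unfolding mixedCells allLabels

    lower : All Lower mixedCells
    lower = from-yes (All.all? lower? mixedCells)

  -- The colours that occur on a given simplex of Iⁿ.
  Palette : Set
  Palette = Vec Bool 3

  Nonempty : Palette → Set
  Nonempty S = ∃[ i ] lookup S i ≡ true

  nonemptyPalettes : List Palette
  nonemptyPalettes = a001 ∷ a010 ∷ a011 ∷ a100 ∷ a101 ∷ a110 ∷ a111 ∷ []

  nonempty⇒∈ : ∀ S → Nonempty S → S ∈ nonemptyPalettes
  nonempty⇒∈ (false ∷ false ∷ false ∷ []) (0F , ())
  nonempty⇒∈ (false ∷ false ∷ false ∷ []) (1F , ())
  nonempty⇒∈ (false ∷ false ∷ false ∷ []) (2F , ())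
  nonempty⇒∈ (false ∷ false ∷ true  ∷ []) _ = here refl
  nonempty⇒∈ (false ∷ true  ∷ false ∷ []) _ = there (here refl)
  nonempty⇒∈ (false ∷ true  ∷ true  ∷ []) _ = there (there (here refl))
  nonempty⇒∈ (true  ∷ false ∷ false ∷ []) _ = there (there (there (here refl)))
  nonempty⇒∈ (true  ∷ false ∷ true  ∷ []) _ = there (there (there (there (here refl))))
  nonempty⇒∈ (true  ∷ true  ∷ false ∷ []) _ = there (there (there (there (there (here refl)))))
  nonempty⇒∈ (true  ∷ true  ∷ true  ∷ []) _ =
      there (there (there (there (there (there (here refl))))))

  -- Only these cells pull back to simplices of full dimension.
  Full : Palette → Cell → Set
  Full S τ = All (λ i → lookup S i ≡ true ⊎ length (fibre i τ) ≡ 1) (List.allFin 3)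

  full? : ∀ S → Decidable (Full S)
  full? S τ = All.all? (λ i → (lookup S i Bool.≟ true) ⊎-dec (length (fibre i τ) ℕ.≟ 1))
      (List.allFin 3)

  cellsOver : Palette → List Cell
  cellsOver S = List.filter (full? S) mixedCells

  -- The restriction of a form to the face of I³ × Δ² over S: there μᵢ = 0 for the absent colours,
  -- so forms that differ only in these coefficients agree on it.
  mask : Palette → Form → Form
  mask S = Vec.zipWith (λ b c → if b then c else + 0) (true ∷ true ∷ true ∷ S)

  -- If τ and τ′ share the facet of τ opposite to u, the difference of their interpolants vanishes
  -- on that facet and is a multiple of the barycentric coordinate of u. Its value at u gives the
  -- factor.
  margin : Cell → Cell → Label → ℤ
  margin τ τ′ u = dot (interpolant τ) (labelPoint u) ℤ.- dot (interpolant τ′) (labelPoint u)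

  -- Over S, the barycentric coordinate is nonnegative on the cube, or it is
  -- nonnegative where the interpolant of τ is not below that of some other cell.
  Walled : Palette → Cell → Label × Form → Set
  Walled S τ (u , β) =
      Any (λ ψ → mask S β ≡ + 6 ⊡ mask S ψ) facetForms
    ⊎ Any (λ τ′ → + 0 ℤ.< margin τ τ′ u ×
                 + 6 ⊡ (mask S (interpolant τ) ⊞ ℤ.- (+ 1) ⊡ mask S (interpolant τ′))
                     ≡ margin τ τ′ u ⊡ mask S β) (cellsOver S)

  walled? : ∀ S τ → Decidable (Walled S τ)
  walled? S τ (u , β) =
    Any.any? (λ ψ → Vec.≡-dec ℤ._≟_ (mask S β) (+ 6 ⊡ mask S ψ)) facetForms
    ⊎-dec Any.any? (λ τ′ → (+ 0 ℤ.<? margin τ τ′ u) ×-dec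
      Vec.≡-dec ℤ._≟_ (+ 6 ⊡ (mask S (interpolant τ) ⊞ ℤ.- (+ 1) ⊡ mask S (interpolant τ′)))
          (margin τ τ′ u ⊡ mask S β)) (cellsOver S)

  opaque
    unfolding mixedCells

    -- Over a simplex of Iⁿ that misses colours, only the full cells may be used. The walls are
    -- therefore certified over each of the seven faces of Δ² separately, against the cells that are
    -- full there. The first component gives `maximiser` a cell to start from.
    walled : All (λ S → 0 ℕ.< length (cellsOver S) × All (λ τ → All (Walled S τ) τ) (cellsOver S))
        nonemptyPalettes
    walled = from-yes (All.all? (λ S → (0 ℕ.<? length (cellsOver S))
        ×-dec All.all? (λ τ → All.all? (walled? S τ) τ) (cellsOver S)) nonemptyPalettes)

  -- What the staircases require: each fibre in the common order, a vertex to start from, and six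
  -- vertices in all, as I³ × Δ² has dimension 5.
  record WellFormed (τ : Cell) : Set where
    constructor wellFormed
    field
      sorted      : All (λ i → AllPairs (ℕ._<_ on rank) (fibre i τ)) (List.allFin 3)
      occupied    : All (λ i → 0 ℕ.< length (fibre i τ)) (List.allFin 3)
      six         : length (fibre 0F τ) ℕ.+ (length (fibre 1F τ) ℕ.+ length (fibre 2F τ)) ≡ 6

  wellFormed? : Decidable WellFormed
  wellFormed? τ = map′ (λ (p , q , r) → wellFormed p q r) (λ (wellFormed p q r) → p , q , r)
    (All.all? (λ i → allPairs? (λ a b → rank a ℕ.<? rank b) (fibre i τ)) (List.allFin 3)
     ×-dec All.all? (λ i → 0 ℕ.<? length (fibre i τ)) (List.allFin 3)
     ×-dec (length (fibre 0F τ) ℕ.+ (length (fibre 1F τ) ℕ.+ length (fibre 2F τ)) ℕ.≟ 6))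

  opaque
    unfolding mixedCells

    cellsWellFormed : All WellFormed mixedCells
    cellsWellFormed = from-yes (All.all? wellFormed? mixedCells)

  shapeWeight : Shape → ℕ
  shapeWeight (2 , 2 , 2) = 6
  shapeWeight (4 , 1 , 1) = 1
  shapeWeight (1 , 4 , 1) = 1
  shapeWeight (1 , 1 , 4) = 1
  -- The default is meant for the six permutations of (3, 2, 1); with any other shape the membership
  -- test in `cellsPotential` would fail.
  shapeWeight _           = 3

  cellShapes : List (Shape × ℕ)
  cellShapes = List.map (λ τ → shape τ , shapeWeight (shape τ)) mixedCells

  opaque
    unfolding mixedCells

    -- The number 88 = 6 · 44 / 3 results from adding up the weights of all cells by evaluation.
    cellsPotential : Potential (totalCount cellShapes) 88
    cellsPotential = totalPotential cellShapes
        (from-yes (All.all? (_∈ˢ? admissibleShapes) cellShapes))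
      where
      open import Data.List.Membership.DecPropositional (≡-dec (≡-dec ℕ._≟_ (≡-dec ℕ._≟_ ℕ._≟_)) ℕ._≟_) using () renaming (_∈?_ to _∈ˢ?_)

  opaque
    unfolding allLabels

    ∈-allLabels : ∀ u → u ∈ allLabels
    ∈-allLabels (i , a) = ∈-cartesianProduct⁺ (∈-allFin i) (∈-cubeVertices a)

  opaque
    unfolding allLabels

    allLabels-unique : Unique allLabels
    allLabels-unique = Unique.cartesianProduct⁺ (Unique.allFin⁺ 3) (cubeVertices-unique 3)

open MixedTriangulation

-- Ordered fields and finite sums

module Reals {ℓ} (ℝ : CompleteOrderedField ℓ) where
  open CompleteOrderedField ℝ hiding (zero)
  open IsStrictTotalOrder isStrictTotalOrder public
    using (compare; isStrictPartialOrder; _<?_; <-resp-≈; <-respʳ-≈; <-respˡ-≈)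
    renaming (irrefl to <-irrefl; trans to <-trans; asym to <-asym; _≟_ to _≈?_)
  open RingProperties ring public
    using (-0#≈0#; -‿involutive; -‿distribˡ-*; -‿distribʳ-*; -‿+-comm; x∙y⁻¹≈ε⇒x≈y)
  open CommutativeSemigroupProperties +-commutativeSemigroup public
    using () renaming (interchange to +-interchange; x∙yz≈y∙xz to x+yz≈y+xz)

  strictPartialOrder : StrictPartialOrder ℓ ℓ ℓ
  strictPartialOrder = record { isStrictPartialOrder = isStrictPartialOrder }

  module ≤-Reasoning = StrictReasoning strictPartialOrder
  module ≈-Reasoning = SetoidReasoning setoid

  ≤-refl : ∀ {x} → x ≤ x
  ≤-refl = inj₂ refl

  ≤-trans : ∀ {x y z} → x ≤ y → y ≤ z → x ≤ z
  ≤-trans = StrictToNonStrict.trans _≈_ _<_ isEquivalence <-resp-≈ <-trans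

  ≤-antisym : ∀ {x y} → x ≤ y → y ≤ x → x ≈ y
  ≤-antisym = StrictToNonStrict.antisym _≈_ _<_ isEquivalence <-trans <-irrefl

  ≤-total : ∀ x y → x ≤ y ⊎ y ≤ x
  ≤-total = StrictToNonStrict.total _≈_ _<_ compare

  ≤-respʳ : ∀ {x y z} → y ≈ z → x ≤ y → x ≤ z
  ≤-respʳ y≈z x≤y = ≤-trans x≤y (inj₂ y≈z)

  ≤-respˡ : ∀ {x y z} → x ≈ y → x ≤ z → y ≤ z
  ≤-respˡ x≈y x≤z = ≤-trans (inj₂ (sym x≈y)) x≤z

  <-≤-trans : ∀ {x y z} → x < y → y ≤ z → x < z
  <-≤-trans = StrictToNonStrict.<-≤-trans _≈_ _<_ <-trans <-respʳ-≈

  ≤-<-trans : ∀ {x y z} → x ≤ y → y < z → x < z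
  ≤-<-trans = StrictToNonStrict.≤-<-trans _≈_ _<_ sym <-trans <-respˡ-≈

  <⇒≱ : ∀ {x y} → x < y → ¬ y ≤ x
  <⇒≱ x<y y≤x = <-irrefl refl (<-≤-trans x<y y≤x)

  ≰⇒> : ∀ {x y} → ¬ x ≤ y → y < x
  ≰⇒> {x} {y} x≰y with compare x y
  ... | tri< x<y _ _ = contradiction (inj₁ x<y) x≰y
  ... | tri≈ _ x≈y _ = contradiction (inj₂ x≈y) x≰y
  ... | tri> _ _ y<x = y<x

  +-monoˡ-< : ∀ z {x y} → x < y → x + z < y + z
  +-monoˡ-< z x<y = <-respʳ-≈ (+-comm z _) (<-respˡ-≈ (+-comm z _) (+-monoʳ-< z x<y))

  +-monoʳ-≤ : ∀ z {x y} → x ≤ y → z + x ≤ z + y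
  +-monoʳ-≤ z (inj₁ x<y) = inj₁ (+-monoʳ-< z x<y)
  +-monoʳ-≤ z (inj₂ x≈y) = inj₂ (+-congˡ x≈y)

  +-monoˡ-≤ : ∀ z {x y} → x ≤ y → x + z ≤ y + z
  +-monoˡ-≤ z x≤y = ≤-respʳ (+-comm z _) (≤-respˡ (+-comm z _) (+-monoʳ-≤ z x≤y))

  +-mono-≤ : ∀ {w x y z} → w ≤ x → y ≤ z → w + y ≤ x + z
  +-mono-≤ w≤x y≤z = ≤-trans (+-monoˡ-≤ _ w≤x) (+-monoʳ-≤ _ y≤z)

  +-mono-<-≤ : ∀ {w x y z} → w < x → y ≤ z → w + y < x + z
  +-mono-<-≤ w<x y≤z = <-≤-trans (+-monoˡ-< _ w<x) (+-monoʳ-≤ _ y≤z)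

  +-nonneg : ∀ {x y} → 0# ≤ x → 0# ≤ y → 0# ≤ x + y
  +-nonneg 0≤x 0≤y = ≤-respˡ (+-identityˡ 0#) (+-mono-≤ 0≤x 0≤y)

  x-x≈0 : ∀ x → x - x ≈ 0#
  x-x≈0 = -‿inverseʳ

  x-y+y≈x : ∀ x y → x - y + y ≈ x
  x-y+y≈x x y = trans (+-assoc x (- y) y) (trans (+-congˡ (-‿inverseˡ y)) (+-identityʳ x))

  x≤y⇒0≤y-x : ∀ {x y} → x ≤ y → 0# ≤ y - x
  x≤y⇒0≤y-x {x} x≤y = ≤-respˡ (x-x≈0 x) (+-monoˡ-≤ (- x) x≤y)

  x<y⇒0<y-x : ∀ {x y} → x < y → 0# < y - x
  x<y⇒0<y-x {x} x<y = <-respˡ-≈ (x-x≈0 x) (+-monoˡ-< (- x) x<y)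

  0≤y-x⇒x≤y : ∀ {x y} → 0# ≤ y - x → x ≤ y
  0≤y-x⇒x≤y {x} {y} 0≤y-x = ≤-respʳ (x-y+y≈x y x) (≤-respˡ (+-identityˡ x) (+-monoˡ-≤ x 0≤y-x))

  x-y≈0⇒x≈y : ∀ {x y} → x - y ≈ 0# → x ≈ y
  x-y≈0⇒x≈y = x∙y⁻¹≈ε⇒x≈y _ _

  x<0⇒0<-x : ∀ {x} → x < 0# → 0# < - x
  x<0⇒0<-x {x} x<0 = <-respʳ-≈ (+-identityˡ (- x)) (x<y⇒0<y-x x<0)

  +-cancelʳ-≈ : ∀ z {x y} → x + z ≈ y + z → x ≈ y
  +-cancelʳ-≈ z {x} {y} eq = trans (sym (cancel x)) (trans (+-congʳ eq) (cancel y))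
    where
    cancel : ∀ x → x + z - z ≈ x
    cancel x = trans (+-assoc x z (- z)) (trans (+-congˡ (x-x≈0 z)) (+-identityʳ x))

  *-nonneg : ∀ {x y} → 0# ≤ x → 0# ≤ y → 0# ≤ x * y
  *-nonneg (inj₁ 0<x) (inj₁ 0<y) = inj₁ (*-positive 0<x 0<y)
  *-nonneg (inj₁ 0<x) (inj₂ 0≈y) = inj₂ (sym (trans (*-congˡ (sym 0≈y)) (zeroʳ _)))
  *-nonneg (inj₂ 0≈x) _          = inj₂ (sym (trans (*-congʳ (sym 0≈x)) (zeroˡ _)))

  *-distribˡ-minus : ∀ x y z → x * (y - z) ≈ x * y - x * z
  *-distribˡ-minus x y z = trans (distribˡ x y (- z)) (+-congˡ (sym (-‿distribʳ-* x z)))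

  *-monoˡ-≤ : ∀ {c x y} → 0# ≤ c → x ≤ y → c * x ≤ c * y
  *-monoˡ-≤ 0≤c x≤y = 0≤y-x⇒x≤y (≤-respʳ (*-distribˡ-minus _ _ _) (*-nonneg 0≤c (x≤y⇒0≤y-x x≤y)))

  *-monoʳ-≤ : ∀ {c x y} → 0# ≤ c → x ≤ y → x * c ≤ y * c
  *-monoʳ-≤ 0≤c x≤y = ≤-respˡ (*-comm _ _) (≤-respʳ (*-comm _ _) (*-monoˡ-≤ 0≤c x≤y))

  *-mono-≤ : ∀ {w x y z} → 0# ≤ w → 0# ≤ y → w ≤ x → y ≤ z → w * y ≤ x * z
  *-mono-≤ 0≤w 0≤y w≤x y≤z = ≤-trans (*-monoʳ-≤ 0≤y w≤x) (*-monoˡ-≤ (≤-trans 0≤w w≤x) y≤z)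

  0<1 : 0# < 1#
  0<1 with compare 0# 1#
  ... | tri< 0<1 _ _ = 0<1
  ... | tri≈ _ 0≈1 _ = contradiction 0≈1 0≉1
  ... | tri> _ _ 1<0 = <-respʳ-≈ (trans (sym (-‿distribʳ-* (- 1#) 1#))
      (trans (-‿cong (*-identityʳ (- 1#))) (-‿involutive 1#)))
                                 (*-positive (x<0⇒0<-x 1<0) (x<0⇒0<-x 1<0))

  0≤1 : 0# ≤ 1#
  0≤1 = inj₁ 0<1

  x>0⇒x≉0 : ∀ {x} → 0# < x → ¬ x ≈ 0#
  x>0⇒x≉0 0<x x≈0 = <-irrefl (sym x≈0) 0<x

  *-inverse : ∀ {x} → 0# < x → x * x ⁻¹ ≈ 1#
  *-inverse 0<x = *-inverseʳ _ (x>0⇒x≉0 0<x)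

  ⁻¹-positive : ∀ {x} → 0# < x → 0# < x ⁻¹
  ⁻¹-positive {x} 0<x with compare 0# (x ⁻¹)
  ... | tri< 0<x⁻¹ _ _ = 0<x⁻¹
  ... | tri≈ _ 0≈x⁻¹ _ = contradiction (trans (sym (zeroʳ x))
      (trans (*-congˡ 0≈x⁻¹) (*-inverse 0<x))) 0≉1
  ... | tri> _ _ x⁻¹<0 = contradiction
    (<-respʳ-≈ (trans (sym (-‿distribʳ-* x (x ⁻¹))) (-‿cong (*-inverse 0<x)))
        (*-positive 0<x (x<0⇒0<-x x⁻¹<0)))
    (λ 0<-1 → <-irrefl refl (<-trans 0<1 (<-respʳ-≈ (-‿inverseˡ 1#)
        (<-respˡ-≈ (+-identityˡ 1#) (+-monoˡ-< 1# 0<-1)))))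

  *-cancelˡ : ∀ {c x y} → 0# < c → c * x ≈ c * y → x ≈ y
  *-cancelˡ {c} {x} {y} 0<c eq = trans (sym (undo x)) (trans (*-congˡ eq) (undo y))
    where
    undo : ∀ x → c ⁻¹ * (c * x) ≈ x
    undo x = trans (sym (*-assoc (c ⁻¹) c x))
        (trans (*-congʳ (trans (*-comm _ _) (*-inverse 0<c))) (*-identityˡ x))

  *-cancelˡ-≤ : ∀ {c x y} → 0# < c → c * x ≤ c * y → x ≤ y
  *-cancelˡ-≤ 0<c cx≤cy with ≤-total _ _
  ... | inj₁ x≤y = x≤y
  ... | inj₂ y≤x = inj₂ (*-cancelˡ 0<c (≤-antisym cx≤cy (*-monoˡ-≤ (inj₁ 0<c) y≤x)))

  *-cancelˡ-nonneg : ∀ {c x} → 0# < c → 0# ≤ c * x → 0# ≤ x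
  *-cancelˡ-nonneg 0<c 0≤cx = *-cancelˡ-≤ 0<c (≤-respˡ (sym (zeroʳ _)) 0≤cx)

  x*y≈0⇒y≈0 : ∀ {c x} → 0# < c → c * x ≈ 0# → x ≈ 0#
  x*y≈0⇒y≈0 0<c eq = *-cancelˡ 0<c (trans eq (sym (zeroʳ _)))

  x+y≈0⇒x≈0 : ∀ {x y} → 0# ≤ x → 0# ≤ y → x + y ≈ 0# → x ≈ 0#
  x+y≈0⇒x≈0 {x} {y} 0≤x 0≤y eq = ≤-antisym (≤-respʳ eq
      (≤-respˡ (+-identityʳ x) (+-monoʳ-≤ x 0≤y))) 0≤x

  ∑ : ∀ {b} {B : Set b} → List B → (B → Carrier) → Carrier
  ∑ []       f = 0#
  ∑ (x ∷ xs) f = f x + ∑ xs f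

  module _ {b} {B : Set b} where

    ∑-cong-∈ : ∀ (xs : List B) {f g} → (∀ {x} → x ∈ xs → f x ≈ g x) → ∑ xs f ≈ ∑ xs g
    ∑-cong-∈ []       eq = refl
    ∑-cong-∈ (x ∷ xs) eq = +-cong (eq (here ≡.refl)) (∑-cong-∈ xs (eq ∘ there))

    ∑-cong : ∀ (xs : List B) {f g} → (∀ x → f x ≈ g x) → ∑ xs f ≈ ∑ xs g
    ∑-cong xs eq = ∑-cong-∈ xs (λ {x} _ → eq x)

    ∑-zero : ∀ (xs : List B) {f} → (∀ {x} → x ∈ xs → f x ≈ 0#) → ∑ xs f ≈ 0#
    ∑-zero []       eq = refl
    ∑-zero (x ∷ xs) eq = trans (+-cong (eq (here ≡.refl)) (∑-zero xs (eq ∘ there))) (+-identityˡ 0#)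

    ∑-+ : ∀ (xs : List B) f g → ∑ xs (λ x → f x + g x) ≈ ∑ xs f + ∑ xs g
    ∑-+ []       f g = sym (+-identityˡ 0#)
    ∑-+ (x ∷ xs) f g = trans (+-congˡ (∑-+ xs f g)) (+-interchange _ _ _ _)

    ∑-neg : ∀ (xs : List B) f → ∑ xs (λ x → - f x) ≈ - ∑ xs f
    ∑-neg []       f = sym -0#≈0#
    ∑-neg (x ∷ xs) f = trans (+-congˡ (∑-neg xs f)) (-‿+-comm _ _)

    ∑-minus : ∀ (xs : List B) f g → ∑ xs (λ x → f x - g x) ≈ ∑ xs f - ∑ xs g
    ∑-minus xs f g = trans (∑-+ xs f (λ x → - g x)) (+-congˡ (∑-neg xs g))

    ∑-*ˡ : ∀ (xs : List B) c f → ∑ xs (λ x → c * f x) ≈ c * ∑ xs f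
    ∑-*ˡ []       c f = sym (zeroʳ c)
    ∑-*ˡ (x ∷ xs) c f = trans (+-congˡ (∑-*ˡ xs c f)) (sym (distribˡ c _ _))

    ∑-*ʳ : ∀ (xs : List B) c f → ∑ xs (λ x → f x * c) ≈ ∑ xs f * c
    ∑-*ʳ xs c f = trans (∑-cong xs (λ x → *-comm (f x) c)) (trans (∑-*ˡ xs c f) (*-comm c _))

    ∑-++ : ∀ (xs ys : List B) f → ∑ (xs ++ ys) f ≈ ∑ xs f + ∑ ys f
    ∑-++ []       ys f = sym (+-identityˡ _)
    ∑-++ (x ∷ xs) ys f = trans (+-congˡ (∑-++ xs ys f)) (sym (+-assoc _ _ _))

    ∑-nonneg : ∀ (xs : List B) {f} → (∀ {x} → x ∈ xs → 0# ≤ f x) → 0# ≤ ∑ xs f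
    ∑-nonneg []       0≤f = ≤-refl
    ∑-nonneg (x ∷ xs) 0≤f = +-nonneg (0≤f (here ≡.refl)) (∑-nonneg xs (0≤f ∘ there))

    ∑-mono-≤ : ∀ (xs : List B) {f g} → (∀ {x} → x ∈ xs → f x ≤ g x) → ∑ xs f ≤ ∑ xs g
    ∑-mono-≤ []       f≤g = ≤-refl
    ∑-mono-≤ (x ∷ xs) f≤g = +-mono-≤ (f≤g (here ≡.refl)) (∑-mono-≤ xs (f≤g ∘ there))

    ∑≈0⇒≈0 : ∀ (xs : List B) {f} → (∀ x → 0# ≤ f x) → ∑ xs f ≈ 0# → ∀ {x} → x ∈ xs → f x ≈ 0#
    ∑≈0⇒≈0 (x ∷ xs) 0≤f eq (here ≡.refl) = x+y≈0⇒x≈0 (0≤f x) (∑-nonneg xs (λ _ → 0≤f _)) eq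
    ∑≈0⇒≈0 (x ∷ xs) 0≤f eq (there x∈)   = ∑≈0⇒≈0 xs 0≤f
      (x+y≈0⇒x≈0 (∑-nonneg xs (λ _ → 0≤f _)) (0≤f x) (trans (+-comm _ _) eq)) x∈

    ∑-mono-< : ∀ (xs : List B) {f g} → (∀ {x} → x ∈ xs → f x ≤ g x) → ∀ {x} → x ∈ xs → f x < g x →
        ∑ xs f < ∑ xs g
    ∑-mono-< (x ∷ xs) f≤g (here ≡.refl) f<g = +-mono-<-≤ f<g (∑-mono-≤ xs (f≤g ∘ there))
    ∑-mono-< (x ∷ xs) f≤g (there x∈)   f<g = ≤-<-trans (+-monoˡ-≤ _ (f≤g (here ≡.refl)))
        (+-monoʳ-< _ (∑-mono-< xs (f≤g ∘ there) x∈ f<g))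

    -- Otherwise g ≤ f throughout, with one strict inequality, and the sums would differ.
    ∑-compensate : ∀ (xs : List B) {f g} → ∑ xs f ≈ ∑ xs g → ∀ {x} → x ∈ xs → g x < f x →
        ∃[ y ] y ∈ xs × f y < g y
    ∑-compensate xs {f} {g} eq x∈ g<f with Any.any? (λ y → f y <? g y) xs
    ... | yes found = let y , y∈ , f<g = find found in y , y∈ , f<g
    ... | no  none  = contradiction eq (λ eq → <-irrefl (sym eq)
      (∑-mono-< xs (λ {y} y∈ → [ (λ g≤f → g≤f) ,
          (λ f≤g → equal y∈ f≤g) ]′ (≤-total (g y) (f y))) x∈ g<f))
      where
      equal : ∀ {y} → y ∈ xs → f y ≤ g y → g y ≤ f y
      equal y∈ (inj₁ f<g) = contradiction (lose y∈ f<g) none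
      equal y∈ (inj₂ f≈g) = inj₂ (sym f≈g)

    ∑-↭ : ∀ {xs ys : List B} f → xs ↭ ys → ∑ xs f ≈ ∑ ys f
    ∑-↭ f Perm.refl         = refl
    ∑-↭ f (Perm.prep x p)   = +-congˡ (∑-↭ f p)
    ∑-↭ f (Perm.swap x y p) = trans (x+yz≈y+xz _ _ _) (+-congˡ (+-congˡ (∑-↭ f p)))
    ∑-↭ f (Perm.trans p q)  = trans (∑-↭ f p) (∑-↭ f q)

    ∑-filter : ∀ {p} {P : Pred B p} (P? : Decidable P) (xs : List B) f →
               ∑ (List.filter P? xs) f ≈ ∑ xs (λ x → if does (P? x) then f x else 0#)
    ∑-filter P? []       f = refl
    ∑-filter P? (x ∷ xs) f with does (P? x)
    ... | true  = +-congˡ (∑-filter P? xs f)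
    ... | false = trans (∑-filter P? xs f) (sym (+-identityˡ _))

  ∑-map : ∀ {b c} {B : Set b} {C : Set c} (g : B → C) xs f → ∑ (List.map g xs) f ≈ ∑ xs (f ∘ g)
  ∑-map g []       f = refl
  ∑-map g (x ∷ xs) f = +-congˡ (∑-map g xs f)

  ∑-swap : ∀ {b c} {B : Set b} {C : Set c} (xs : List B) (ys : List C) (f : B → C → Carrier) →
           ∑ xs (λ x → ∑ ys (f x)) ≈ ∑ ys (λ y → ∑ xs (λ x → f x y))
  ∑-swap []       ys f = sym (∑-zero ys (λ _ → refl))
  ∑-swap (x ∷ xs) ys f = trans (+-congˡ (∑-swap xs ys f)) (sym (∑-+ ys (f x) _))

  sum≈∑ : ∀ {n} (w : Vector Carrier n) → sum w ≈ ∑ (List.allFin n) w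
  sum≈∑ w = go (λ i → i) w
    where
    go : ∀ {m n} (g : Fin n → Fin m) (w : Vector Carrier m) → sum (w ∘ g) ≈ ∑ (List.tabulate g) w
    go {n = zero}  g w = refl
    go {n = suc n} g w = +-congˡ (go (g ∘ suc) w)

-- Triangulations as sets of facets

module Complexes {ℓ} (ℝ : CompleteOrderedField ℓ) where
  open CompleteOrderedField ℝ hiding (zero)
  open Reals ℝ
  open CubeTriangulations ℝ

  ∑-tabulate : ∀ {b} {B : Set b} {n} (g : Fin n → B) f → ∑ (List.tabulate g) f ≈ sum (f ∘ g)
  ∑-tabulate {n = zero}  g f = refl
  ∑-tabulate {n = suc n} g f = +-congˡ (∑-tabulate (g ∘ suc) f)

  -- Weights are functions on all vertices of the cube, which makes weights on different facets
  -- comparable pointwise. Here a sum over the cube is brought back to one facet.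
  ∑-supported : ∀ {d} {F : List (Vertex d)} {f} → Unique F → (∀ v → v ∉ F → f v ≈ 0#) →
                ∑ (cubeVertices d) f ≈ ∑ F f
  ∑-supported {d} {F} {f} unique support = begin
    ∑ (cubeVertices d) f                                              ≈⟨ ∑-cong
        (cubeVertices d) restrict ⟩
    ∑ (cubeVertices d) (λ v → if does (v ∈? F) then f v else 0#)      ≈⟨ sym
        (∑-filter (_∈? F) (cubeVertices d) f) ⟩
    ∑ (arrange F) f                                                   ≈⟨ ∑-↭ f (arrange-↭ unique) ⟩
    ∑ F f                                                             ∎
    where
    open ≈-Reasoning
    restrict : ∀ v → f v ≈ (if does (v ∈? F) then f v else 0#)
    restrict v with v ∈? F
    ... | yes _  = refl
    ... | no v∉F = support v v∉F

  ∑-cubeVertices-++ : ∀ m {n} (f : Vertex (m ℕ.+ n) → Carrier) →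
    ∑ (cubeVertices (m ℕ.+ n)) f ≈ ∑ (cubeVertices m)
        (λ a → ∑ (cubeVertices n) (λ v → f (a Vec.++ v)))
  ∑-cubeVertices-++ zero    f = sym (+-identityʳ _)
  ∑-cubeVertices-++ (suc m) {n} f = begin
    ∑ (List.map (false ∷_) vs ++ List.map (true ∷_) vs) f
      ≈⟨ ∑-++ (List.map (false ∷_) vs) _ f ⟩
    ∑ (List.map (false ∷_) vs) f + ∑ (List.map (true ∷_) vs) f
      ≈⟨ +-cong (∑-map (false ∷_) vs f) (∑-map (true ∷_) vs f) ⟩
    ∑ vs (f ∘ (false ∷_)) + ∑ vs (f ∘ (true ∷_))
      ≈⟨ +-cong (∑-cubeVertices-++ m (f ∘ (false ∷_))) (∑-cubeVertices-++ m (f ∘ (true ∷_))) ⟩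
    ∑ as (λ a → g (false ∷ a)) + ∑ as (λ a → g (true ∷ a))
      ≈⟨ sym (+-cong (∑-map (false ∷_) as g) (∑-map (true ∷_) as g)) ⟩
    ∑ (List.map (false ∷_) as) g + ∑ (List.map (true ∷_) as) g
      ≈⟨ sym (∑-++ (List.map (false ∷_) as) _ g) ⟩
    ∑ (cubeVertices (suc m)) g ∎
    where
    open ≈-Reasoning
    vs = cubeVertices (m ℕ.+ n)
    as = cubeVertices m
    g : Vertex (suc m) → Carrier
    g a = ∑ (cubeVertices n) (λ v → f (a Vec.++ v))

  -- The discrete measure with the listed point masses; masses at a repeated vertex add up.
  mass : ∀ {d} → List (Vertex d × Carrier) → Vertex d → Carrier
  mass ws v = ∑ ws (λ (u , w) → if does (u ≟ᵛ v) then w else 0#)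

  module _ {d} {ws : List (Vertex d × Carrier)} where

    mass-nonneg : (∀ {e} → e ∈ ws → 0# ≤ proj₂ e) → ∀ v → 0# ≤ mass ws v
    mass-nonneg 0≤w v = ∑-nonneg ws (λ { {u , w} e∈ → lemma (does (u ≟ᵛ v)) (0≤w e∈) })
      where
      lemma : ∀ b {w} → 0# ≤ w → 0# ≤ (if b then w else 0#)
      lemma true  0≤w = 0≤w
      lemma false _   = ≤-refl

    mass-support : ∀ {v} → (∀ {w} → (v , w) ∈ ws → w ≈ 0#) → mass ws v ≈ 0#
    mass-support {v} null = ∑-zero ws lemma
      where
      lemma : ∀ {e} → e ∈ ws → (if does (proj₁ e ≟ᵛ v) then proj₂ e else 0#) ≈ 0#
      lemma {u , w} e∈ with u ≟ᵛ v
      ... | yes ≡.refl = null e∈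
      ... | no _       = refl

    ∑-mass : ∀ (h : Vertex d → Carrier) → ∑ (cubeVertices d) (λ v → mass ws v * h v)
        ≈ ∑ ws (λ (u , w) → w * h u)
    ∑-mass h = begin
      ∑ (cubeVertices d) (λ v → mass ws v * h v)
        ≈⟨ ∑-cong (cubeVertices d) (λ v → sym (∑-*ʳ ws (h v) _)) ⟩
      ∑ (cubeVertices d) (λ v → ∑ ws (λ (u , w) → (if does (u ≟ᵛ v) then w else 0#) * h v))
        ≈⟨ ∑-swap (cubeVertices d) ws _ ⟩
      ∑ ws (λ (u , w) → ∑ (cubeVertices d) (λ v → (if does (u ≟ᵛ v) then w else 0#) * h v))
        ≈⟨ ∑-cong ws (λ (u , w) → pointMass u w) ⟩
      ∑ ws (λ (u , w) → w * h u) ∎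
      where
      open ≈-Reasoning
      pointMass : ∀ u w → ∑ (cubeVertices d) (λ v →
          (if does (u ≟ᵛ v) then w else 0#) * h v) ≈ w * h u
      pointMass u w = trans (∑-supported {F = u ∷ []} ([] ∷ []) off)
          (trans (+-identityʳ _) (*-congʳ at))
        where
        off : ∀ v → v ∉ u ∷ [] → (if does (u ≟ᵛ v) then w else 0#) * h v ≈ 0#
        off v v∉ rewrite dec-false (u ≟ᵛ v) (λ u≡v → v∉ (here (≡.sym u≡v))) = zeroˡ (h v)
        at : (if does (u ≟ᵛ u) then w else 0#) ≈ w
        at rewrite dec-true (u ≟ᵛ u) ≡.refl = refl

    ∑-mass-total : ∑ (cubeVertices d) (mass ws) ≈ ∑ ws proj₂
    ∑-mass-total = trans (∑-cong (cubeVertices d) (λ v → sym (*-identityʳ _)))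
                  (trans (∑-mass (λ _ → 1#)) (∑-cong ws (λ _ → *-identityʳ _)))

  mass-unique : ∀ {d} {ws : List (Vertex d × Carrier)} → Unique (List.map proj₁ ws) →
                ∀ {v w} → (v , w) ∈ ws → mass ws v ≈ w
  mass-unique {ws = (v , w) ∷ ws} (v∉ ∷ unique) (here ≡.refl)
    rewrite dec-true (v ≟ᵛ v) ≡.refl =
    trans (+-congˡ (mass-support {ws = ws} (λ e∈ →
        contradiction ≡.refl (All.lookup v∉ (∈-map⁺ proj₁ e∈))))) (+-identityʳ w)
  mass-unique {ws = (u , _) ∷ ws} (u∉ ∷ unique) {v} (there e∈)
    rewrite dec-false (u ≟ᵛ v) (All.lookup u∉ (∈-map⁺ proj₁ e∈)) =
    trans (+-identityˡ _) (mass-unique unique e∈)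

  record Barycentric {d} (F : List (Vertex d)) (W : Vertex d → Carrier) (x : Point d) : Set ℓ where
    field
      nonneg  : ∀ v → 0# ≤ W v
      support : ∀ v → v ∉ F → W v ≈ 0#
      total   : ∑ (cubeVertices d) W ≈ 1#
      moment  : ∀ j → ∑ (cubeVertices d) (λ v → W v * coordinates v j) ≈ x j

  -- A triangulation, encoded by the existence and uniqueness of barycentric
  -- coordinates; the uniqueness is stated for weights of arbitrary total.
  record IsComplex {d} (facets : List (List (Vertex d))) : Set ℓ where
    field
      unique    : ∀ {F} → F ∈ facets → Unique F
      facetSize : ∀ {F} → F ∈ facets → length F ≡ suc d
      cover     : ∀ x → Cube d x → ∃[ F ] F ∈ facets × ∃[ W ] Barycentric F W x
      separated : ∀ {F F′} → F ∈ facets → F′ ∈ facets → ∀ W W′ →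
                  (∀ v → 0# ≤ W v) → (∀ v → 0# ≤ W′ v) →
                  (∀ v → v ∉ F → W v ≈ 0#) → (∀ v → v ∉ F′ → W′ v ≈ 0#) →
                  ∑ (cubeVertices d) W ≈ ∑ (cubeVertices d) W′ →
                  (∀ j → ∑ (cubeVertices d) (λ v → W v * coordinates v j)
                      ≈ ∑ (cubeVertices d) (λ v → W′ v * coordinates v j)) →
                  ∀ v → W v ≈ W′ v

-- Passing between triangulations and complexes

differing : ∀ {d} {u v : Vec Bool d} → u ≢ v → ∃[ j ] lookup u j ≢ lookup v j
differing {u = []}    {[]}    u≢v = contradiction ≡.refl u≢v
differing {u = b ∷ u} {c ∷ v} u≢v with b Bool.≟ c
... | no b≢c     = zero , b≢c
... | yes ≡.refl = let j , neq = differing (λ u≡v → u≢v (≡.cong (b ∷_) u≡v)) in suc j , neq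

module TriangulationsAndComplexes {ℓ} (ℝ : CompleteOrderedField ℓ) where
  open CompleteOrderedField ℝ hiding (zero)
  open Reals ℝ
  open CubeTriangulations ℝ
  open Complexes ℝ

  sum-minus-total : ∀ {n} (a b : Vector Carrier n) → sum (λ i → a i - b i) ≈ sum a - sum b
  sum-minus-total {n} a b = begin
    sum (λ i → a i - b i)                     ≈⟨ sum≈∑ (λ i → a i - b i) ⟩
    ∑ (List.allFin n) (λ i → a i - b i)       ≈⟨ ∑-minus (List.allFin n) a b ⟩
    ∑ (List.allFin n) a - ∑ (List.allFin n) b ≈⟨ sym (+-cong (sum≈∑ a) (-‿cong (sum≈∑ b))) ⟩
    sum a - sum b                             ∎
    where open ≈-Reasoning

  sum-cong : ∀ {n} (a b : Vector Carrier n) → (∀ i → a i ≈ b i) → sum a ≈ sum b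
  sum-cong {zero}  a b eq = refl
  sum-cong {suc n} a b eq = +-cong (eq zero) (sum-cong (a ∘ suc) (b ∘ suc) (eq ∘ suc))

  sum-minus : ∀ {n} (a b h : Vector Carrier n) →
              sum (λ i → (a i - b i) * h i) ≈ sum (λ i → a i * h i) - sum (λ i → b i * h i)
  sum-minus a b h = trans
    (sum-cong (λ i → (a i - b i) * h i) (λ i → a i * h i - b i * h i)
        (λ i → trans (distribʳ (h i) (a i) (- b i)) (+-congˡ (sym (-‿distribˡ-* (b i) (h i))))))
    (sum-minus-total (λ i → a i * h i) (λ i → b i * h i))

  δ : ∀ {n} → Fin n → Fin n → Carrier
  δ zero    zero    = 1#
  δ zero    (suc j) = 0#
  δ (suc i) zero    = 0#
  δ (suc i) (suc j) = δ i j

  δ-nonneg : ∀ {n} (i j : Fin n) → 0# ≤ δ i j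
  δ-nonneg zero    zero    = 0≤1
  δ-nonneg zero    (suc j) = ≤-refl
  δ-nonneg (suc i) zero    = ≤-refl
  δ-nonneg (suc i) (suc j) = δ-nonneg i j

  δ-diagonal : ∀ {n} (i : Fin n) → δ i i ≈ 1#
  δ-diagonal zero    = refl
  δ-diagonal (suc i) = δ-diagonal i

  δ-off : ∀ {n} (i j : Fin n) → i ≢ j → δ i j ≈ 0#
  δ-off zero    zero    i≢j = contradiction ≡.refl i≢j
  δ-off zero    (suc j) i≢j = refl
  δ-off (suc i) zero    i≢j = refl
  δ-off (suc i) (suc j) i≢j = δ-off i j (i≢j ∘ ≡.cong suc)

  sum-zero : ∀ {n} (f : Vector Carrier n) → (∀ i → f i ≈ 0#) → sum f ≈ 0#
  sum-zero {zero}  f eq = refl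
  sum-zero {suc n} f eq = trans (+-cong (eq zero) (sum-zero (f ∘ suc) (eq ∘ suc))) (+-identityˡ 0#)

  sum-δ : ∀ {n} (i : Fin n) (h : Vector Carrier n) → sum (λ j → δ i j * h j) ≈ h i
  sum-δ {suc n} zero    h = trans (+-cong (*-identityˡ (h zero))
      (sum-zero (λ j → 0# * h (suc j)) (λ j → zeroˡ (h (suc j))))) (+-identityʳ _)
  sum-δ {suc n} (suc i) h = trans (+-cong (zeroˡ (h zero)) (sum-δ i (h ∘ suc))) (+-identityˡ _)

  sum-δ-total : ∀ {n} (i : Fin n) → sum (δ i) ≈ 1#
  sum-δ-total {suc n} zero    = trans (+-congˡ (sum-zero {n} (λ j → 0#) (λ j → refl)))
      (+-identityʳ _)
  sum-δ-total {suc n} (suc i) = trans (+-identityˡ _) (sum-δ-total i)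

  weighted : ∀ {d n} → Vector Carrier n → Vector (Vertex d) n → List (Vertex d × Carrier)
  weighted w v = List.tabulate (λ i → v i , w i)

  module _ {d n} (w : Vector Carrier n) (v : Vector (Vertex d) n) where

    weighted-nonneg : (∀ i → 0# ≤ w i) → ∀ {e} → e ∈ weighted w v → 0# ≤ proj₂ e
    weighted-nonneg 0≤w e∈ with i , ≡.refl ← ∈-tabulate⁻ e∈ = 0≤w i

    weighted-support : ∀ {u} → (∀ i → v i ≡ u → w i ≈ 0#) → mass (weighted w v) u ≈ 0#
    weighted-support {u} null = mass-support {ws = weighted w v} lemma
      where
      lemma : ∀ {c} → (u , c) ∈ weighted w v → c ≈ 0#
      lemma e∈ with i , eq ← ∈-tabulate⁻ e∈ =
        trans (reflexive (≡.cong proj₂ eq)) (null i (≡.sym (≡.cong proj₁ eq)))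

    weighted-total : ∑ (cubeVertices d) (mass (weighted w v)) ≈ sum w
    weighted-total = trans (∑-mass-total {ws = weighted w v}) (∑-tabulate (λ i → v i , w i) proj₂)

    weighted-moment : ∀ (h : Vertex d → Carrier) →
      ∑ (cubeVertices d) (λ u → mass (weighted w v) u * h u) ≈ sum (λ i → w i * h (v i))
    weighted-moment h = trans (∑-mass {ws = weighted w v} h)
        (∑-tabulate (λ i → v i , w i) (λ (u , c) → c * h u))

    weighted-unique : Unique (List.tabulate v) → ∀ i → mass (weighted w v) (v i) ≈ w i
    weighted-unique unique i = mass-unique
      (≡.subst Unique (≡.sym (List.map-tabulate _ proj₁)) unique) (∈-tabulate⁺ i)

    toBarycentric : ∀ {x} → (∀ i → 0# ≤ w i) → sum w ≈ 1# → (∀ j → combination w v j ≈ x j) →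
                    Barycentric (List.tabulate v) (mass (weighted w v)) x
    toBarycentric 0≤w total≈1 comb≈x = record
      { nonneg  = mass-nonneg {ws = weighted w v} (weighted-nonneg 0≤w)
      ; support = λ u u∉ → weighted-support (λ i vi≡u →
          contradiction (≡.subst (_∈ _) vi≡u (∈-tabulate⁺ i)) u∉)
      ; total   = trans weighted-total total≈1
      ; moment  = λ j → trans (weighted-moment (λ u → coordinates u j)) (comb≈x j)
      }

  module _ {d n} (v : Vector (Vertex d) n) (unique : Unique (List.tabulate v))
           {W : Vertex d → Carrier} (support : ∀ u → u ∉ List.tabulate v → W u ≈ 0#) where

    restrict-moment : ∀ (h : Vertex d → Carrier) →
        sum (λ i → W (v i) * h (v i)) ≈ ∑ (cubeVertices d) (λ u → W u * h u)
    restrict-moment h = sym (trans (∑-supported unique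
        (λ u u∉ → trans (*-congʳ (support u u∉)) (zeroˡ _))) (∑-tabulate v (λ u → W u * h u)))

    restrict-total : sum (W ∘ v) ≈ ∑ (cubeVertices d) W
    restrict-total = sym (trans (∑-supported unique support) (∑-tabulate v W))

  coordinates-nonneg : ∀ {d} (v : Vertex d) j → 0# ≤ coordinates v j
  coordinates-nonneg v j with lookup v j
  ... | true  = 0≤1
  ... | false = ≤-refl

  coordinates-≤1 : ∀ {d} (v : Vertex d) j → coordinates v j ≤ 1#
  coordinates-≤1 v j with lookup v j
  ... | true  = ≤-refl
  ... | false = 0≤1

  -- A vertex of the cube is an extreme point: in a coordinate j where u and v differ, v attains the
  -- minimum 0 or the maximum 1 over the cube, so no weight can lie on a vertex with the other
  -- value.
  extreme : ∀ {d F W} {v : Vertex d} → Barycentric F W (coordinates v) → ∀ u → u ≢ v → W u ≈ 0#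
  extreme {d} {F} {W} {v} bary u u≢v with differing u≢v
  ... | j , uj≢vj with lookup u j in uj | lookup v j in vj
  ...   | true  | true  = contradiction ≡.refl uj≢vj
  ...   | false | false = contradiction ≡.refl uj≢vj
  ...   | true  | false = trans (trans (sym (*-identityʳ _))
      (*-congˡ (reflexive (≡.cong (if_then 1# else 0#) (≡.sym uj)))))
      (∑≈0⇒≈0 (cubeVertices d) (λ t → *-nonneg (nonneg t) (coordinates-nonneg t j))
        (trans (moment j) (reflexive (≡.cong (if_then 1# else 0#) vj))) (∈-cubeVertices u))
    where open Barycentric bary
  ...   | false | true  = trans (trans (sym (*-identityʳ _)) (*-congˡ (sym 1-uj≈1)))
      (∑≈0⇒≈0 (cubeVertices d) (λ t → *-nonneg (nonneg t) (x≤y⇒0≤y-x (coordinates-≤1 t j)))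
          total-moment≈0 (∈-cubeVertices u))
    where
    open Barycentric bary
    1-uj≈1 : 1# - coordinates u j ≈ 1#
    1-uj≈1 = trans (+-congˡ (trans (-‿cong (reflexive (≡.cong (if_then 1# else 0#) uj))) -0#≈0#))
        (+-identityʳ 1#)
    total-moment≈0 : ∑ (cubeVertices d) (λ t → W t * (1# - coordinates t j)) ≈ 0#
    total-moment≈0 = begin
      ∑ (cubeVertices d) (λ t → W t * (1# - coordinates t j))        ≈⟨ ∑-cong (cubeVertices d)
          (λ t → trans (*-distribˡ-minus _ _ _) (+-congʳ (*-identityʳ _))) ⟩
      ∑ (cubeVertices d) (λ t → W t - W t * coordinates t j)         ≈⟨ ∑-minus
          (cubeVertices d) W _ ⟩
      ∑ (cubeVertices d) W - ∑ (cubeVertices d) (λ t → W t * coordinates t j) ≈⟨ +-cong total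
          (-‿cong (trans (moment j) (reflexive (≡.cong (if_then 1# else 0#) vj)))) ⟩
      1# - 1#                                                        ≈⟨ x-x≈0 1# ⟩
      0#                                                             ∎
      where open ≈-Reasoning

  extreme⇒∈ : ∀ {d F W} {v : Vertex d} → Barycentric F W (coordinates v) → v ∈ F
  extreme⇒∈ {d} {F} {W} {v} bary with v ∈? F
  ... | yes v∈F = v∈F
  ... | no v∉F = contradiction (trans (sym (∑-zero (cubeVertices d) (λ {u} _ → null u)))
      (Barycentric.total bary)) 0≉1
    where
    null : ∀ u → W u ≈ 0#
    null u with u ≟ᵛ v
    ... | yes ≡.refl = Barycentric.support bary v v∉F
    ... | no u≢v     = extreme bary u u≢v

  vertexList : ∀ {d} → Simplex d → List (Vertex d)
  vertexList σ = List.tabulate (vertices σ)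

  hull⇒Barycentric : ∀ {d} (σ : Simplex d) {x} → hull σ x → ∃[ W ] Barycentric (vertexList σ) W x
  hull⇒Barycentric σ (w , 0≤w , total , comb) = _ , toBarycentric w (vertices σ) 0≤w total comb

  Barycentric⇒hull : ∀ {d} (σ : Simplex d) → Unique (vertexList σ) → ∀ {W x} →
      Barycentric (vertexList σ) W x → hull σ x
  Barycentric⇒hull σ unique {W} bary = W ∘ vertices σ , nonneg ∘ vertices σ
    , trans (restrict-total (vertices σ) unique support) total , λ j →
        trans (restrict-moment (vertices σ) unique support (λ u → coordinates u j)) (moment j)
    where open Barycentric bary

  vertex-in-face : ∀ {d} (σ : Simplex d) {S i} → i ∈ˢ S → face σ S (coordinates (vertices σ i))
  vertex-in-face σ {S} {i} i∈S = δ i , (λ j → δ-nonneg i j) ,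
      (λ j j∉S → δ-off i j (λ { ≡.refl → j∉S i∈S })) , sum-δ-total i
    , λ j → sum-δ i (λ k → coordinates (vertices σ k) j)

  vertex-in-hull : ∀ {d} (σ : Simplex d) i → hull σ (coordinates (vertices σ i))
  vertex-in-hull σ i = δ i , (λ j → δ-nonneg i j) , sum-δ-total i , λ j →
      sum-δ i (λ k → coordinates (vertices σ k) j)

  independent⇒equal : ∀ {d n} (v : Vector (Vertex d) n) → AffinelyIndependent v → ∀ a b →
    sum a ≈ sum b → (∀ j → combination a v j ≈ combination b v j) → ∀ i → a i ≈ b i
  independent⇒equal v independent a b total moment i = x-y≈0⇒x≈y (independent (λ i → a i - b i)
    (trans (sum-minus-total a b) (trans (+-congʳ total) (x-x≈0 _)))
    (λ j → trans (sum-minus a b (λ i → coordinates (v i) j))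
        (trans (+-congʳ (moment j)) (x-x≈0 _))) i)

  -- Two equal vertices would give two different weights, `δ i` and `δ k`, for the same point.
  independent⇒Unique : ∀ {d n} (v : Vector (Vertex d) n) → AffinelyIndependent v →
      Unique (List.tabulate v)
  independent⇒Unique v independent = Unique.tabulate⁺ injective
    where
    injective : ∀ {i k} → v i ≡ v k → i ≡ k
    injective {i} {k} vi≡vk with i Fin.≟ k
    ... | yes i≡k = i≡k
    ... | no i≢k  = contradiction (trans (sym (δ-off k i (i≢k ∘ ≡.sym)))
        (trans (sym (independent⇒equal v independent (δ i) (δ k)
      (trans (sum-δ-total i) (sym (sum-δ-total k)))
      (λ j → trans (sum-δ i (λ l → coordinates (v l) j))
          (trans (reflexive (≡.cong (λ u → coordinates u j) vi≡vk))
          (sym (sum-δ k (λ l → coordinates (v l) j))))) i)) (δ-diagonal i))) 0≉1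

module Conversions {ℓ} (ℝ : CompleteOrderedField ℓ) where
  open CompleteOrderedField ℝ hiding (zero)
  open Reals ℝ
  open CubeTriangulations ℝ
  open Complexes ℝ
  open TriangulationsAndComplexes ℝ

  Barycentric-scale : ∀ {d} {F : List (Vertex d)} {W} r → 0# ≤ r → (∀ v → 0# ≤ W v) →
      (∀ v → v ∉ F → W v ≈ 0#) →
    r * ∑ (cubeVertices d) W ≈ 1# →
    Barycentric F (λ v → r * W v) (λ j → r * ∑ (cubeVertices d) (λ v → W v * coordinates v j))
  Barycentric-scale {d} r 0≤r 0≤W support total = record
    { nonneg  = λ v → *-nonneg 0≤r (0≤W v)
    ; support = λ v v∉ → trans (*-congˡ (support v v∉)) (zeroʳ r)
    ; total   = trans (∑-*ˡ (cubeVertices d) r _) total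
    ; moment  = λ j → trans (∑-cong (cubeVertices d) (λ v → *-assoc r _ _))
        (∑-*ˡ (cubeVertices d) r _)
    }

  Barycentric-resp : ∀ {d} {F : List (Vertex d)} {W x y} → (∀ j → x j ≈ y j) → Barycentric F W x →
      Barycentric F W y
  Barycentric-resp x≈y bary = record { Barycentric bary ; moment = λ j →
      trans (Barycentric.moment bary j) (x≈y j) }

  simplex-unique : ∀ {d} (σ : Simplex d) → Unique (vertexList σ)
  simplex-unique σ = independent⇒Unique (vertices σ) (affinelyIndependent σ)

  -- A vertex u of σ on the common face lies in the hull of τ and, being an extreme point of the
  -- cube, is a vertex of τ. At the vertices of σ off that face the weight vanishes, since
  -- barycentric coordinates in σ are unique.
  common-support : ∀ {d} (σ τ : Simplex d) → FaceToFace σ τ → ∀ {W W′ x} →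
    Barycentric (vertexList σ) W x → Barycentric (vertexList τ) W′ x → ∀ u →
        u ∉ vertexList τ → W u ≈ 0#
  common-support {d} σ τ ((S , to , from) , _) {W} {W′} {x} bary bary′ u u∉τ with u ∈? vertexList σ
  ... | no u∉σ  = Barycentric.support bary u u∉σ
  ... | yes u∈σ with i , ≡.refl ← ∈-tabulate⁻ {f = vertices σ} u∈σ with i Subset.∈? S
  ...   | yes i∈S = contradiction (extreme⇒∈ (proj₂
      (hull⇒Barycentric τ (proj₂ (from (vertex-in-face σ i∈S)))))) u∉τ
  ...   | no i∉S = trans (independent⇒equal (vertices σ) (affinelyIndependent σ) (W ∘ vertices σ)
      (proj₁ onFace)
      (trans (restrict-total (vertices σ) (simplex-unique σ) support)
          (trans total (sym (proj₁ (proj₂ (proj₂ (proj₂ onFace)))))))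
      (λ j → trans (restrict-moment (vertices σ) (simplex-unique σ) support (λ v → coordinates v j))
             (trans (moment j) (sym (proj₂ (proj₂ (proj₂ (proj₂ onFace))) j)))) i)
      (proj₁ (proj₂ (proj₂ onFace)) i i∉S)
    where
    open Barycentric bary
    onFace : face σ S x
    onFace = to (Barycentric⇒hull σ (simplex-unique σ) bary ,
        Barycentric⇒hull τ (simplex-unique τ) bary′)

  fromTriangulation : ∀ {d} (T : Triangulation d) → IsComplex (List.map vertexList (simplices T))
  fromTriangulation {d} T = record
    { unique    = λ F∈ → let σ , _ , F≡ = ∈-map⁻ vertexList F∈ in ≡.subst Unique (≡.sym F≡) (simplex-unique σ)
    ; facetSize = λ F∈ → let σ , _ , F≡ = ∈-map⁻ vertexList F∈ in ≡.trans (≡.cong length F≡) (List.length-tabulate (vertices σ))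
    ; cover     = λ x x∈ → let σ , σ∈ , x∈σ = find (proj₁ (covers T) x∈) in
                           vertexList σ , ∈-map⁺ vertexList σ∈ , hull⇒Barycentric σ x∈σ
    ; separated = λ F∈ F′∈ → let σ , σ∈ , F≡  = ∈-map⁻ vertexList F∈
                                 τ , τ∈ , F′≡ = ∈-map⁻ vertexList F′∈
                             in ≡.subst₂ Separated (≡.sym F≡) (≡.sym F′≡) (separated σ∈ τ∈)
    }
    where
    Separated : List (Vertex d) → List (Vertex d) → Set ℓ
    Separated F F′ = ∀ W W′ → (∀ v → 0# ≤ W v) → (∀ v → 0# ≤ W′ v) →
      (∀ v → v ∉ F → W v ≈ 0#) → (∀ v → v ∉ F′ → W′ v ≈ 0#) →
      ∑ (cubeVertices d) W ≈ ∑ (cubeVertices d) W′ →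
      (∀ j → ∑ (cubeVertices d) (λ v → W v * coordinates v j)
          ≈ ∑ (cubeVertices d) (λ v → W′ v * coordinates v j)) →
      ∀ v → W v ≈ W′ v

    -- Rescaled to total 1, W and W′ represent one common point of both simplices. By
    -- `common-support`, W is then carried by τ as well, where affine independence applies. Total 0
    -- is a case of its own: all weights vanish.
    separated : ∀ {σ τ} → σ ∈ simplices T → τ ∈ simplices T →
        Separated (vertexList σ) (vertexList τ)
    separated {σ} {τ} σ∈ τ∈ W W′ 0≤W 0≤W′ support support′ total moment
      with compare 0# (∑ (cubeVertices d) W)
    ... | tri> _ _ s<0 = contradiction (∑-nonneg (cubeVertices d) (λ {v} _ → 0≤W v)) (<⇒≱ s<0)
    ... | tri≈ _ 0≈s _ = λ v → trans (∑≈0⇒≈0 (cubeVertices d) 0≤W (sym 0≈s) (∈-cubeVertices v))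
                               (sym (∑≈0⇒≈0 (cubeVertices d) 0≤W′ (trans (sym total) (sym 0≈s))
                                   (∈-cubeVertices v)))
    ... | tri< 0<s _ _ = equal
      where
      s = ∑ (cubeVertices d) W
      r = s ⁻¹
      0<r = ⁻¹-positive 0<s
      rs≈1 : r * s ≈ 1#
      rs≈1 = trans (*-comm r s) (*-inverse 0<s)
      bary = Barycentric-scale {F = vertexList σ} r (inj₁ 0<r) 0≤W support rs≈1
      bary′ = Barycentric-resp (λ j → *-congˡ (sym (moment j)))
        (Barycentric-scale {F = vertexList τ} r (inj₁ 0<r) 0≤W′ support′
            (trans (*-congˡ (sym total)) rs≈1))
      supportτ : ∀ v → v ∉ vertexList τ → W v ≈ 0#
      supportτ v v∉ = x*y≈0⇒y≈0 0<r (common-support σ τ (faceToFace T σ∈ τ∈) bary bary′ v v∉)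
      equal : ∀ v → W v ≈ W′ v
      equal v with v ∈? vertexList τ
      ... | no v∉  = trans (supportτ v v∉) (sym (support′ v v∉))
      ... | yes v∈ with i , ≡.refl ← ∈-tabulate⁻ {f = vertices τ} v∈ =
        independent⇒equal (vertices τ) (affinelyIndependent τ) (W ∘ vertices τ) (W′ ∘ vertices τ)
          (trans (restrict-total (vertices τ) unique supportτ)
              (trans total (sym (restrict-total (vertices τ) unique support′))))
          (λ j → trans (restrict-moment (vertices τ) unique supportτ (λ v → coordinates v j))
                (trans (moment j) (sym (restrict-moment (vertices τ) unique support′
                    (λ v → coordinates v j))))) i
        where unique = simplex-unique τ

  positivePart : Carrier → Carrier
  positivePart x with ≤-total 0# x
  ... | inj₁ _ = x
  ... | inj₂ _ = 0#

  positivePart-nonneg : ∀ x → 0# ≤ positivePart x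
  positivePart-nonneg x with ≤-total 0# x
  ... | inj₁ 0≤x = 0≤x
  ... | inj₂ _   = ≤-refl

  negativePart : Carrier → Carrier
  negativePart x = positivePart x - x

  negativePart-nonneg : ∀ x → 0# ≤ negativePart x
  negativePart-nonneg x with ≤-total 0# x
  ... | inj₁ _   = inj₂ (sym (x-x≈0 x))
  ... | inj₂ x≤0 = x≤y⇒0≤y-x x≤0

  indices : ∀ {d n} → Vector (Vertex d) n → List (Vertex d) → Subset n
  indices v F = Vec.tabulate (λ i → does (v i ∈? F))

  ∈-indices⁺ : ∀ {d n} (v : Vector (Vertex d) n) F {i} → v i ∈ F → i ∈ˢ indices v F
  ∈-indices⁺ v F {i} vi∈F = Vec.lookup⇒[]= i _
      (≡.trans (Vec.lookup∘tabulate _ i) (dec-true (v i ∈? F) vi∈F))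

  ∈-indices⁻ : ∀ {d n} (v : Vector (Vertex d) n) F {i} → i ∈ˢ indices v F → v i ∈ F
  ∈-indices⁻ v F {i} i∈ with v i ∈? F in eq
  ... | yes vi∈F = vi∈F
  ... | no vi∉F  = contradiction
    (≡.trans (≡.sym (dec-false (v i ∈? F) vi∉F))
        (≡.trans (≡.sym (Vec.lookup∘tabulate _ i)) (Vec.[]=⇒lookup i∈))) λ ()

  module _ {d} {facets : List (List (Vertex d))} (isComplex : IsComplex facets) where
    open IsComplex isComplex

    -- The positive and the negative part of an affine dependence are two weights on one facet with
    -- equal total and moments, so they coincide. Their total is arbitrary, which is why `separated`
    -- does not ask for total 1.
    facet⇒independent : ∀ {n} (v : Vector (Vertex d) n) → List.tabulate v ∈ facets →
        AffinelyIndependent v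
    facet⇒independent v v∈ w total≈0 comb≈0 i = begin
      w i                                     ≈⟨ sym
          (trans (+-congˡ (⁻¹-anti (w⁺ i) (w i))) (cancel (w⁺ i) (w i))) ⟩
      w⁺ i - w⁻ i                             ≈⟨ +-congʳ w⁺≈w⁻ ⟩
      w⁻ i - w⁻ i                             ≈⟨ x-x≈0 (w⁻ i) ⟩
      0#                                      ∎
      where
      open ≈-Reasoning
      w⁺ w⁻ : Vector Carrier _
      w⁺ i = positivePart (w i)
      w⁻ i = negativePart (w i)
      ⁻¹-anti : ∀ x y → - (x - y) ≈ - x + y
      ⁻¹-anti x y = trans (sym (-‿+-comm x (- y))) (+-congˡ (-‿involutive y))
      cancel : ∀ x y → x + (- x + y) ≈ y
      cancel x y = trans (sym (+-assoc x (- x) y)) (trans (+-congʳ (x-x≈0 x)) (+-identityˡ y))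
      minus≈0 : ∀ {x y z} → y ≈ x - z → z ≈ 0# → x ≈ y
      minus≈0 eq z≈0 = sym (trans eq (trans (+-congˡ (trans (-‿cong z≈0) -0#≈0#)) (+-identityʳ _)))
      supported : ∀ (a : Vector Carrier _) u → u ∉ List.tabulate v → mass (weighted a v) u ≈ 0#
      supported a u u∉ = weighted-support a v
          (λ i vi≡u → contradiction (≡.subst (_∈ _) vi≡u (∈-tabulate⁺ i)) u∉)
      w⁺≈w⁻ : w⁺ i ≈ w⁻ i
      w⁺≈w⁻ = trans (sym (weighted-unique w⁺ v (unique v∈) i)) (trans (separated v∈ v∈ _ _
        (mass-nonneg {ws = weighted w⁺ v} (weighted-nonneg w⁺ v (λ i → positivePart-nonneg (w i))))
        (mass-nonneg {ws = weighted w⁻ v} (weighted-nonneg w⁻ v (λ i → negativePart-nonneg (w i))))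
        (supported w⁺) (supported w⁻)
        (trans (weighted-total w⁺ v) (trans (minus≈0 (sum-minus-total w⁺ w) total≈0)
            (sym (weighted-total w⁻ v))))
        (λ j → trans (weighted-moment w⁺ v (λ u → coordinates u j))
          (trans (minus≈0 (sum-minus w⁺ w (λ i → coordinates (v i) j)) (comb≈0 j))
              (sym (weighted-moment w⁻ v (λ u → coordinates u j)))))
        (v i)) (weighted-unique w⁻ v (unique v∈) i))

    barycentric-unique : ∀ {F F′ W W′ x} → F ∈ facets → F′ ∈ facets → Barycentric F W x →
        Barycentric F′ W′ x → ∀ v → W v ≈ W′ v
    barycentric-unique F∈ F′∈ b b′ = separated F∈ F′∈ _ _ (nonneg b) (nonneg b′) (support b)
        (support b′)
      (trans (total b) (sym (total b′))) (λ j → trans (moment b j) (sym (moment b′ j)))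
      where open Barycentric

    -- A common point has the same weights with respect to both facets, so these weights are carried
    -- by the common vertices, which span the face in question.
    facetsMeetInFaces : ∀ (σ τ : Simplex d) → vertexList σ ∈ facets → vertexList τ ∈ facets →
        IsFaceOf (hull σ ∩ hull τ) σ
    facetsMeetInFaces σ τ σ∈ τ∈ = S , to , from
      where
      S = indices (vertices σ) (vertexList τ)
      to : ∀ {x} → (hull σ ∩ hull τ) x → face σ S x
      to ((w , 0≤w , total , comb) , x∈τ) = w , 0≤w , null , total , comb
        where
        b′ = proj₂ (hull⇒Barycentric τ x∈τ)
        null : ∀ i → i ∉ˢ S → w i ≈ 0#
        null i i∉S = trans (sym (weighted-unique w (vertices σ) (unique σ∈) i))
          (trans (barycentric-unique σ∈ τ∈ (toBarycentric w (vertices σ) 0≤w total comb) b′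
              (vertices σ i))
                 (Barycentric.support b′ _ (i∉S ∘ ∈-indices⁺ (vertices σ) (vertexList τ))))
      from : ∀ {x} → face σ S x → (hull σ ∩ hull τ) x
      from (w , 0≤w , null , total , comb) = (w , 0≤w , total , comb) ,
          Barycentric⇒hull τ (unique τ∈) (record
        { Barycentric (toBarycentric w (vertices σ) 0≤w total comb)
        ; support = λ u u∉τ → weighted-support w (vertices σ) (λ i vi≡u →
            null i (λ i∈S → u∉τ (≡.subst (_∈ _) vi≡u
                (∈-indices⁻ (vertices σ) (vertexList τ) i∈S)))) })

    -- `distinct` forbids repetitions. Instead of excluding them from the product construction,
    -- repeated facets are dropped here; this can only shorten the list, and an upper bound for the
    -- size is enough.
    record Listing (Fs : List (List (Vertex d))) : Set ℓ where
      field
        list     : List (Simplex d)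
        short    : length list ℕ.≤ length Fs
        facets∋  : ∀ {σ} → σ ∈ list → vertexList σ ∈ facets
        complete : ∀ {F} → F ∈ Fs → ∃[ σ ] σ ∈ list × F ⊆ vertexList σ
        irredundant : AllPairs (λ σ τ → ¬ vertexList σ ⊆ vertexList τ) list

    listing : ∀ Fs → Fs ⊆ facets → Listing Fs
    listing []       _   = record { list = [] ; short = ℕ.z≤n ; facets∋ = λ () ; complete =
        λ () ; irredundant = [] }
    listing (F ∷ Fs) F∷Fs⊆ with asVector F (facetSize (F∷Fs⊆ (here ≡.refl)))
    ... | v , ≡.refl with Any.any? (λ τ → All.all? (_∈? vertexList τ) F) (Listing.list rest)
      where rest = listing Fs (F∷Fs⊆ ∘ there)
    ...   | yes repeated = record
      { list = list ; short = ℕ.m≤n⇒m≤1+n short ; facets∋ = facets∋ ; irredundant = irredundant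
      ; complete = λ { (here ≡.refl) → let τ , τ∈ , F⊆ = find repeated in τ , τ∈ , All.lookup F⊆
                     ; (there F∈)    → complete F∈ } }
      where open Listing (listing Fs (F∷Fs⊆ ∘ there))
    ...   | no new = record
      { list     = σ ∷ list
      ; short    = ℕ.s≤s short
      ; facets∋  = λ { (here ≡.refl) → F∷Fs⊆ (here ≡.refl) ; (there σ∈) → facets∋ σ∈ }
      ; complete = λ { (here ≡.refl) → σ , here ≡.refl , λ u∈ → u∈
                     ; (there F∈)    → let τ , τ∈ , F⊆ = complete F∈ in τ , there τ∈ , F⊆ }
      ; irredundant = All.tabulate (λ τ∈ σ⊆τ → new (lose τ∈ (All.tabulate σ⊆τ))) ∷ irredundant
      }
      where
      open Listing (listing Fs (F∷Fs⊆ ∘ there))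
      σ : Simplex d
      σ = record { vertices = v ; affinelyIndependent = facet⇒independent v (F∷Fs⊆ (here ≡.refl)) }

    hull⊆cube : ∀ (σ : Simplex d) {x} → hull σ x → Cube d x
    hull⊆cube σ {x} x∈σ j =
        ≤-respʳ (moment j) (∑-nonneg (cubeVertices d)
            (λ {v} _ → *-nonneg (nonneg v) (coordinates-nonneg v j)))
      , ≤-respˡ (moment j) (≤-respʳ total (∑-mono-≤ (cubeVertices d) (λ {v} _ →
          ≤-respʳ (*-identityʳ _) (*-monoˡ-≤ (nonneg v) (coordinates-≤1 v j)))))
      where open Barycentric (proj₂ (hull⇒Barycentric σ x∈σ))

    toTriangulation : ∃[ T ] size {d} T ℕ.≤ length facets
    toTriangulation = record
      { simplices  = list
      -- Vertices are extreme points of the cube, so an inclusion of hulls forces an inclusion of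
      -- vertex sets.
      ; distinct   = AllPairs.map (λ {σ} {τ} σ⊈τ (hσ⊆hτ , _) →
          σ⊈τ (λ u∈ → vertex⊆ σ τ hσ⊆hτ u∈)) irredundant
      ; faceToFace = λ {σ} {τ} σ∈ τ∈ →
          facetsMeetInFaces σ τ (facets∋ σ∈) (facets∋ τ∈) ,
          (let S , to , from = facetsMeetInFaces τ σ (facets∋ τ∈) (facets∋ σ∈)
           in S , (to ∘ swap) , (swap ∘ from))
      ; covers     = covered , λ x∈ → let σ , _ , x∈σ = find x∈ in hull⊆cube σ x∈σ
      } , short
      where
      open Listing (listing facets (λ F∈ → F∈))
      vertex⊆ : ∀ σ τ → (∀ {x} → hull σ x → hull τ x) → vertexList σ ⊆ vertexList τ
      vertex⊆ σ τ hσ⊆hτ u∈ with i , ≡.refl ← ∈-tabulate⁻ {f = vertices σ} u∈ =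
        extreme⇒∈ (proj₂ (hull⇒Barycentric τ (hσ⊆hτ (vertex-in-hull σ i))))
      covered : ∀ {x} → Cube d x → Any (λ σ → hull σ x) list
      covered {x} x∈ with cover x x∈
      ... | F , F∈ , W , bary with complete F∈
      ...   | σ , σ∈ , F⊆σ = lose σ∈ (Barycentric⇒hull σ (unique (facets∋ σ∈)) (record
        { Barycentric bary ; support = λ v v∉ → Barycentric.support bary v (v∉ ∘ F⊆σ) }))

-- The triangulation of I³ × Δ² over the reals

module Forms {ℓ} (ℝ : CompleteOrderedField ℓ) where
  open CompleteOrderedField ℝ hiding (zero)
  open Reals ℝ
  open SemiringMult semiring using (×-homo-+; ×1-homo-*)

  fromℕ-+ : ∀ m n → fromℕ (m ℕ.+ n) ≈ fromℕ m + fromℕ n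
  fromℕ-+ = ×-homo-+ 1#

  fromℕ-* : ∀ m n → fromℕ (m ℕ.* n) ≈ fromℕ m * fromℕ n
  fromℕ-* = ×1-homo-*

  fromℕ-nonneg : ∀ n → 0# ≤ fromℕ n
  fromℕ-nonneg zero    = ≤-refl
  fromℕ-nonneg (suc n) = +-nonneg 0≤1 (fromℕ-nonneg n)

  fromℕ-positive : ∀ n → 0# < fromℕ (suc n)
  fromℕ-positive n = <-respˡ-≈ (+-identityˡ 0#) (+-mono-<-≤ 0<1 (fromℕ-nonneg n))

  fromℤ : ℤ → Carrier
  fromℤ (+ n)    = fromℕ n
  fromℤ -[1+ n ] = - fromℕ (suc n)

  fromℤ-⊖ : ∀ m n → fromℤ (m ⊖ n) ≈ fromℕ m - fromℕ n
  fromℤ-⊖ zero    zero    = sym (x-x≈0 0#)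
  fromℤ-⊖ zero    (suc n) = sym (+-identityˡ _)
  fromℤ-⊖ (suc m) zero    = sym (trans (+-congˡ -0#≈0#) (+-identityʳ _))
  fromℤ-⊖ (suc m) (suc n) = begin
    fromℤ (suc m ⊖ suc n)             ≈⟨ reflexive (≡.cong fromℤ (ℤ.[1+m]⊖[1+n]≡m⊖n m n)) ⟩
    fromℤ (m ⊖ n)                     ≈⟨ fromℤ-⊖ m n ⟩
    fromℕ m - fromℕ n                 ≈⟨ sym (trans (+-congʳ (x-x≈0 1#)) (+-identityˡ _)) ⟩
    (1# - 1#) + (fromℕ m - fromℕ n)   ≈⟨ +-interchange 1# (- 1#) (fromℕ m) (- fromℕ n) ⟩
    (1# + fromℕ m) + (- 1# - fromℕ n) ≈⟨ +-congˡ (-‿+-comm 1# (fromℕ n)) ⟩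
    fromℕ (suc m) - fromℕ (suc n)     ∎
    where open ≈-Reasoning

  fromℤ-+ : ∀ x y → fromℤ (x ℤ.+ y) ≈ fromℤ x + fromℤ y
  fromℤ-+ (+ m)    (+ n)    = fromℕ-+ m n
  fromℤ-+ (+ m)    -[1+ n ] = fromℤ-⊖ m (suc n)
  fromℤ-+ -[1+ m ] (+ n)    = trans (fromℤ-⊖ n (suc m)) (+-comm _ _)
  fromℤ-+ -[1+ m ] -[1+ n ] = begin
    - fromℕ (suc (suc (m ℕ.+ n)))       ≈⟨ -‿cong
        (reflexive (≡.cong fromℕ (≡.cong suc (≡.sym (ℕ.+-suc m n))))) ⟩
    - fromℕ (suc m ℕ.+ suc n)           ≈⟨ -‿cong (fromℕ-+ (suc m) (suc n)) ⟩
    - (fromℕ (suc m) + fromℕ (suc n))   ≈⟨ sym (-‿+-comm _ _) ⟩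
    - fromℕ (suc m) - fromℕ (suc n)     ∎
    where open ≈-Reasoning

  fromℤ-neg : ∀ x → fromℤ (ℤ.- x) ≈ - fromℤ x
  fromℤ-neg (+ zero)  = sym -0#≈0#
  fromℤ-neg (+ suc n) = refl
  fromℤ-neg -[1+ n ]  = sym (-‿involutive _)

  fromℕ-*-fromℤ : ∀ m y → fromℤ ((+ m) ℤ.* y) ≈ fromℕ m * fromℤ y
  fromℕ-*-fromℤ m (+ n) = trans (reflexive (≡.cong fromℤ (≡.sym (ℤ.pos-* m n)))) (fromℕ-* m n)
  fromℕ-*-fromℤ m -[1+ n ] = begin
    fromℤ ((+ m) ℤ.* -[1+ n ])                ≈⟨ reflexive
        (≡.cong fromℤ (≡.sym (ℤ.neg-distribʳ-* (+ m) (+ suc n)))) ⟩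
    fromℤ (ℤ.- ((+ m) ℤ.* (+ suc n)))         ≈⟨ fromℤ-neg ((+ m) ℤ.* (+ suc n)) ⟩
    - fromℤ ((+ m) ℤ.* (+ suc n))             ≈⟨ -‿cong (fromℕ-*-fromℤ m (+ suc n)) ⟩
    - (fromℕ m * fromℕ (suc n))               ≈⟨ -‿distribʳ-* _ _ ⟩
    fromℕ m * - fromℕ (suc n)                 ∎
    where open ≈-Reasoning
  fromℤ-* : ∀ x y → fromℤ (x ℤ.* y) ≈ fromℤ x * fromℤ y
  fromℤ-* (+ m)    y = fromℕ-*-fromℤ m y
  fromℤ-* -[1+ m ] y = begin
    fromℤ (-[1+ m ] ℤ.* y)                    ≈⟨ reflexive
        (≡.cong fromℤ (≡.sym (ℤ.neg-distribˡ-* (+ suc m) y))) ⟩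
    fromℤ (ℤ.- ((+ suc m) ℤ.* y))             ≈⟨ fromℤ-neg ((+ suc m) ℤ.* y) ⟩
    - fromℤ ((+ suc m) ℤ.* y)                 ≈⟨ -‿cong (fromℕ-*-fromℤ (suc m) y) ⟩
    - (fromℕ (suc m) * fromℤ y)               ≈⟨ -‿distribˡ-* _ _ ⟩
    - fromℕ (suc m) * fromℤ y                 ∎
    where open ≈-Reasoning

  fromℤ-positive : ∀ {x} → + 0 ℤ.< x → 0# < fromℤ x
  fromℤ-positive {+ suc n} _ = fromℕ-positive n
  fromℤ-positive {+ zero}  (ℤ.+<+ ())

  fromℤ-<-minus : ∀ {x y} → x ℤ.< y → 0# < fromℤ y - fromℤ x
  fromℤ-<-minus {x} {y} x<y = <-respʳ-≈ (trans (fromℤ-+ y (ℤ.- x)) (+-congˡ (fromℤ-neg x)))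
    (fromℤ-positive (≡.subst (ℤ._< y ℤ.- x) (ℤ.+-inverseʳ x) (ℤ.+-monoˡ-< (ℤ.- x) x<y)))

  ⟪_,_⟫ : ∀ {n} → Vec ℤ n → Vec Carrier n → Carrier
  ⟪ []    , []     ⟫ = 0#
  ⟪ c ∷ φ , x ∷ xs ⟫ = fromℤ c * x + ⟪ φ , xs ⟫

  ⟪⟫-𝟎 : ∀ {n} (x : Vec Carrier n) → ⟪ 𝟎 , x ⟫ ≈ 0#
  ⟪⟫-𝟎 []       = refl
  ⟪⟫-𝟎 (x ∷ xs) = trans (+-cong (zeroˡ x) (⟪⟫-𝟎 xs)) (+-identityˡ 0#)

  ⟪⟫-⊞ : ∀ {n} (φ ψ : Vec ℤ n) x → ⟪ φ ⊞ ψ , x ⟫ ≈ ⟪ φ , x ⟫ + ⟪ ψ , x ⟫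
  ⟪⟫-⊞ []      []      []       = sym (+-identityˡ 0#)
  ⟪⟫-⊞ (b ∷ φ) (c ∷ ψ) (x ∷ xs) = trans
    (+-cong (trans (*-congʳ (fromℤ-+ b c)) (distribʳ x _ _)) (⟪⟫-⊞ φ ψ xs)) (+-interchange _ _ _ _)

  ⟪⟫-⊡ : ∀ {n} c (φ : Vec ℤ n) x → ⟪ c ⊡ φ , x ⟫ ≈ fromℤ c * ⟪ φ , x ⟫
  ⟪⟫-⊡ c []      []       = sym (zeroʳ _)
  ⟪⟫-⊡ c (b ∷ φ) (x ∷ xs) = trans
    (+-cong (trans (*-congʳ (fromℤ-* c b)) (*-assoc _ _ _)) (⟪⟫-⊡ c φ xs)) (sym (distribˡ _ _ _))

  ⟪⟫-basis : ∀ {n} (j : Fin n) x → ⟪ basis j , x ⟫ ≈ lookup x j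
  ⟪⟫-basis zero    (x ∷ xs) = trans (+-cong (trans (*-congʳ (+-identityʳ 1#)) (*-identityˡ x))
      (⟪⟫-𝟎 xs)) (+-identityʳ x)
  ⟪⟫-basis (suc j) (x ∷ xs) = trans (+-cong (zeroˡ x) (⟪⟫-basis j xs)) (+-identityˡ _)

  ⟪⟫-combine : ∀ {n} {I : Set} (c : I → ℤ) (φ : I → Vec ℤ n) is x →
               ⟪ combine c φ is , x ⟫ ≈ ∑ is (λ i → fromℤ (c i) * ⟪ φ i , x ⟫)
  ⟪⟫-combine c φ []       x = ⟪⟫-𝟎 x
  ⟪⟫-combine c φ (i ∷ is) x = trans (⟪⟫-⊞ (c i ⊡ φ i) _ x)
      (+-cong (⟪⟫-⊡ (c i) (φ i) x) (⟪⟫-combine c φ is x))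

  -- Linear forms commute with weighted sums of points, whatever the total of the weights.
  ⟪⟫-barycentre : ∀ {n} {I : Set} (is : List I) (w : I → Carrier) (φ : Vec ℤ n)
      (p : I → Vec ℤ n) x →
    (∀ j → lookup x j ≈ ∑ is (λ i → w i * fromℤ (lookup (p i) j))) →
    ⟪ φ , x ⟫ ≈ ∑ is (λ i → w i * fromℤ (dot φ (p i)))
  ⟪⟫-barycentre is w [] p [] eq = sym (∑-zero is
      (λ {i} _ → trans (*-congˡ (reflexive (≡.cong fromℤ (empty (p i))))) (zeroʳ _)))
    where
    empty : ∀ (v : Vec ℤ 0) → dot [] v ≡ + 0
    empty [] = ≡.refl
  ⟪⟫-barycentre is w (c ∷ φ) p (x ∷ xs) eq = begin
    fromℤ c * x + ⟪ φ , xs ⟫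
      ≈⟨ +-cong (trans (*-congˡ (eq zero)) (sym (∑-*ˡ is (fromℤ c) _)))
          (⟪⟫-barycentre is w φ (Vec.tail ∘ p) xs
          (λ j → trans (eq (suc j)) (∑-cong is
          (λ i → *-congˡ (reflexive (≡.cong fromℤ (lookup-tail (p i) j))))))) ⟩
    ∑ is (λ i → fromℤ c * (w i * fromℤ (lookup (p i) zero)))
        + ∑ is (λ i → w i * fromℤ (dot φ (Vec.tail (p i))))
      ≈⟨ sym (∑-+ is _ _) ⟩
    ∑ is (λ i → fromℤ c * (w i * fromℤ (lookup (p i) zero)) + w i * fromℤ (dot φ (Vec.tail (p i))))
      ≈⟨ ∑-cong is (λ i → term (w i) (p i)) ⟩
    ∑ is (λ i → w i * fromℤ (dot (c ∷ φ) (p i))) ∎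
    where
    open ≈-Reasoning
    lookup-tail : ∀ {m} (v : Vec ℤ (suc m)) j → lookup v (suc j) ≡ lookup (Vec.tail v) j
    lookup-tail (_ ∷ v) j = ≡.refl
    swap-* : ∀ x y z → x * (y * z) ≈ y * (x * z)
    swap-* x y z = trans (sym (*-assoc x y z)) (trans (*-congʳ (*-comm x y)) (*-assoc y x z))
    term : ∀ w (v : Vec ℤ (suc _)) → fromℤ c * (w * fromℤ (lookup v zero)) + w
        * fromℤ (dot φ (Vec.tail v)) ≈ w * fromℤ (dot (c ∷ φ) v)
    term w (a ∷ v) = trans (+-congʳ (swap-* (fromℤ c) w (fromℤ a))) (trans (sym (distribˡ w _ _))
      (*-congˡ (sym (trans (fromℤ-+ (c ℤ.* a) (dot φ v)) (+-congʳ (fromℤ-* c a))))))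

module MixedCells {ℓ} (ℝ : CompleteOrderedField ℓ) where
  open CompleteOrderedField ℝ hiding (zero)
  open Reals ℝ
  open Forms ℝ
  open CubeTriangulations ℝ

  ∑-single : ∀ {b} {B : Set b} {xs : List B} {f v} → Unique xs → v ∈ xs →
      (∀ u → u ≢ v → f u ≈ 0#) → ∑ xs f ≈ f v
  ∑-single {xs = x ∷ xs} (x∉ ∷ _) (here ≡.refl) off =
    trans (+-congˡ (∑-zero xs (λ u∈ → off _ (λ { ≡.refl → All.lookup x∉ u∈ ≡.refl }))))
        (+-identityʳ _)
  ∑-single {xs = x ∷ xs} (x∉ ∷ unique) (there v∈) off =
    trans (+-cong (off x (λ { ≡.refl → All.lookup x∉ v∈ ≡.refl })) (∑-single unique v∈ off))
        (+-identityˡ _)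

  fromℤ-bit : ∀ b → fromℤ (bit b) ≈ (if b then 1# else 0#)
  fromℤ-bit true  = +-identityʳ 1#
  fromℤ-bit false = refl

  labelPoint-coordinate : ∀ j k a → fromℤ (lookup (labelPoint (k , a)) (j Fin.↑ˡ 3))
      ≈ coordinates a j
  labelPoint-coordinate 0F k (b ∷ _ ∷ _ ∷ []) = fromℤ-bit b
  labelPoint-coordinate 1F k (_ ∷ b ∷ _ ∷ []) = fromℤ-bit b
  labelPoint-coordinate 2F k (_ ∷ _ ∷ b ∷ []) = fromℤ-bit b

  Moment : (Label → Carrier) → Form → Carrier
  Moment W φ = ∑ allLabels (λ u → W u * fromℤ (dot φ (labelPoint u)))

  SameMoments : (W W′ : Label → Carrier) → Set ℓ
  SameMoments W W′ = ∀ j → ∑ allLabels (λ u → W u * fromℤ (lookup (labelPoint u) j))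
                         ≈ ∑ allLabels (λ u → W′ u * fromℤ (lookup (labelPoint u) j))

  Moment-cong : ∀ {W W′} → SameMoments W W′ → ∀ φ → Moment W φ ≈ Moment W′ φ
  Moment-cong {W} {W′} same φ = trans (sym (⟪⟫-barycentre allLabels W φ labelPoint x
      (λ j → reflexive (Vec.lookup∘tabulate moment j))))
    (⟪⟫-barycentre allLabels W′ φ labelPoint x
        (λ j → trans (reflexive (Vec.lookup∘tabulate moment j)) (same j)))
    where
    moment : Fin 6 → Carrier
    moment j = ∑ allLabels (λ u → W u * fromℤ (lookup (labelPoint u) j))
    x : Vec Carrier 6
    x = Vec.tabulate moment

  -- Six times the height of the lifted vertex u above the hyperplane of τ.
  gap : Cell → Label → Carrier
  gap τ u = fromℤ (+ 6 ℤ.* height u) - fromℤ (dot (interpolant τ) (labelPoint u))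

  liftedMoment : (Label → Carrier) → Carrier
  liftedMoment W = ∑ allLabels (λ u → W u * fromℤ (+ 6 ℤ.* height u))

  ∑-gap : ∀ W τ → ∑ allLabels (λ u → W u * gap τ u) ≈ liftedMoment W - Moment W (interpolant τ)
  ∑-gap W τ = trans (∑-cong allLabels (λ u → *-distribˡ-minus (W u) _ _)) (∑-minus allLabels _ _)

  module _ {τ} (τ∈ : τ ∈ mixedCells) where

    gap-cases : ∀ u → (u ∈ labels τ × gap τ u ≈ 0#) ⊎ (u ∉ labels τ × 0# < gap τ u)
    gap-cases u with All.lookup (All.lookup lower τ∈) (∈-allLabels u)
    ... | inj₁ (u∈ , eq)    = inj₁ (u∈ , trans
        (+-congˡ (-‿cong (reflexive (≡.cong fromℤ eq)))) (x-x≈0 _))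
    ... | inj₂ (u∉ , below) = inj₂ (u∉ , fromℤ-<-minus below)

    gap-nonneg : ∀ u → 0# ≤ gap τ u
    gap-nonneg u with gap-cases u
    ... | inj₁ (_ , eq) = inj₂ (sym eq)
    ... | inj₂ (_ , 0<) = inj₁ 0<

    liftedMoment-on : ∀ {W} → (∀ u → u ∉ labels τ → W u ≈ 0#) →
        liftedMoment W ≈ Moment W (interpolant τ)
    liftedMoment-on {W} support = x-y≈0⇒x≈y (trans (sym (∑-gap W τ))
        (∑-zero allLabels (λ {u} _ → lemma u)))
      where
      lemma : ∀ u → W u * gap τ u ≈ 0#
      lemma u with gap-cases u
      ... | inj₁ (_ , eq) = trans (*-congˡ eq) (zeroʳ _)
      ... | inj₂ (u∉ , _) = trans (*-congʳ (support u u∉)) (zeroˡ _)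

    Moment≤liftedMoment : ∀ {W} → (∀ u → 0# ≤ W u) → Moment W (interpolant τ) ≤ liftedMoment W
    Moment≤liftedMoment {W} 0≤W = 0≤y-x⇒x≤y (≤-respʳ (∑-gap W τ)
      (∑-nonneg allLabels (λ {u} _ → *-nonneg (0≤W u) (gap-nonneg u))))

    -- Complementary slackness: weights and gaps are nonnegative and the sum of their products is 0,
    -- so there is no weight where the gap is positive.
    support-on : ∀ {W} → (∀ u → 0# ≤ W u) → liftedMoment W ≈ Moment W (interpolant τ) → ∀ u →
        u ∉ labels τ → W u ≈ 0#
    support-on {W} 0≤W eq u u∉ with gap-cases u
    ... | inj₁ (u∈ , _)      = contradiction u∈ u∉
    ... | inj₂ (_ , 0<gap) = x*y≈0⇒y≈0 0<gap (trans (*-comm _ _)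
      (∑≈0⇒≈0 allLabels (λ v → *-nonneg (0≤W v) (gap-nonneg v))
        (trans (∑-gap W τ) (trans (+-congʳ eq) (x-x≈0 _))) (∈-allLabels u)))

    Moment-dual : ∀ {W} → (∀ u → u ∉ labels τ → W u ≈ 0#) → ∀ {u β} → (u , β) ∈ τ →
        Moment W β ≈ W u * fromℤ (+ 6)
    Moment-dual {W} support {u} {β} e∈ with at , off ← All.lookup (All.lookup dual τ∈) e∈ =
      trans (∑-single allLabels-unique (∈-allLabels u) vanish)
          (*-congˡ (reflexive (≡.cong fromℤ at)))
      where
      vanish : ∀ v → v ≢ u → W v * fromℤ (dot β (labelPoint v)) ≈ 0#
      vanish v v≢u with v ∈ˡ? labels τ
      ... | no v∉  = trans (*-congʳ (support v v∉)) (zeroˡ _)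
      ... | yes v∈ with (_ , γ) , f∈ , ≡.refl ← ∈-map⁻ proj₁ v∈ with All.lookup off f∈
      ...   | inj₁ u≡v = contradiction (≡.sym u≡v) v≢u
      ...   | inj₂ eq  = trans (*-congˡ (reflexive (≡.cong fromℤ eq))) (zeroʳ _)

  -- Among all weights with given moments, those on a lower cell minimise the
  -- average height.
  mixed-unique : ∀ {τ τ′} → τ ∈ mixedCells → τ′ ∈ mixedCells → ∀ {W W′} →
    (∀ u → 0# ≤ W u) → (∀ u → 0# ≤ W′ u) →
    (∀ u → u ∉ labels τ → W u ≈ 0#) → (∀ u → u ∉ labels τ′ → W′ u ≈ 0#) →
    SameMoments W W′ → ∀ u → W u ≈ W′ u
  mixed-unique {τ} {τ′} τ∈ τ′∈ {W} {W′} 0≤W 0≤W′ support support′ same = equal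
    where
    lifted≈ : liftedMoment W′ ≈ liftedMoment W
    lifted≈ = ≤-antisym
      (≤-respˡ (trans (Moment-cong same (interpolant τ′)) (sym (liftedMoment-on τ′∈ support′)))
          (Moment≤liftedMoment τ′∈ 0≤W))
      (≤-respˡ (trans (sym (Moment-cong same (interpolant τ))) (sym (liftedMoment-on τ∈ support)))
          (Moment≤liftedMoment τ∈ 0≤W′))
    W′-support : ∀ u → u ∉ labels τ → W′ u ≈ 0#
    W′-support = support-on τ∈ 0≤W′ (trans lifted≈
        (trans (liftedMoment-on τ∈ support) (Moment-cong same (interpolant τ))))
    equal : ∀ u → W u ≈ W′ u
    equal u with u ∈ˡ? labels τ
    ... | no u∉  = trans (support u u∉) (sym (W′-support u u∉))
    ... | yes u∈ with (_ , β) , e∈ , ≡.refl ← ∈-map⁻ proj₁ u∈ =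
      *-cancelˡ (fromℕ-positive 5) (trans (*-comm _ _) (trans (sym (Moment-dual τ∈ support e∈))
        (trans (Moment-cong same β) (trans (Moment-dual τ∈ W′-support e∈) (*-comm _ _)))))

  maximiser : ∀ {b} {B : Set b} (f : B → Carrier) xs → 0 ℕ.< length xs →
      ∃[ x ] x ∈ xs × (∀ {y} → y ∈ xs → f y ≤ f x)
  maximiser f (x ∷ [])     _ = x , here ≡.refl , λ { (here ≡.refl) → ≤-refl }
  maximiser f (x ∷ y ∷ xs) _ with maximiser f (y ∷ xs) (ℕ.s≤s ℕ.z≤n)
  ... | z , z∈ , max with ≤-total (f x) (f z)
  ...   | inj₁ fx≤fz = z , there z∈ , λ { (here ≡.refl) → fx≤fz ; (there t∈) → max t∈ }
  ...   | inj₂ fz≤fx = x , here ≡.refl , λ { (here ≡.refl) → ≤-refl ; (there t∈) →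
      ≤-trans (max t∈) fz≤fx }

  ofColour : ∀ i → Cell → Cell
  ofColour i = List.filter (λ e → proj₁ (proj₁ e) Fin.≟ i)

  ∑-colours : ∀ τ f → ∑ τ f ≈ ∑ (ofColour 0F τ) f + (∑ (ofColour 1F τ) f + ∑ (ofColour 2F τ) f)
  ∑-colours []                    f = sym (trans (+-identityˡ _) (+-identityˡ _))
  ∑-colours (e@((0F , _) , _) ∷ τ) f = trans (+-congˡ (∑-colours τ f)) (sym (+-assoc _ _ _))
  ∑-colours (e@((1F , _) , _) ∷ τ) f = trans (+-congˡ (∑-colours τ f))
      (trans (x+yz≈y+xz _ _ _) (+-congˡ (sym (+-assoc _ _ _))))
  ∑-colours (e@((2F , _) , _) ∷ τ) f = trans (+-congˡ (∑-colours τ f))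
      (trans (x+yz≈y+xz _ _ _) (+-congˡ (x+yz≈y+xz _ _ _)))

  module _ (p μ : Fin 3 → Carrier)
           (0≤p : ∀ j → 0# ≤ p j) (p≤ : ∀ j → p j ≤ μ 0F + (μ 1F + μ 2F))
               (0≤μ : ∀ i → 0# ≤ μ i) where

    position : Vec Carrier 6
    position = p 0F ∷ p 1F ∷ p 2F ∷ μ 0F ∷ μ 1F ∷ μ 2F ∷ []

    facetForms-nonneg : All (λ ψ → 0# ≤ ⟪ ψ , position ⟫) facetForms
    facetForms-nonneg =
      coordinate 0F (0≤p 0F) ∷ coordinate 1F (0≤p 1F) ∷ coordinate 2F (0≤p 2F) ∷
      coordinate (suc (suc (suc 0F))) (0≤μ 0F) ∷ coordinate (suc (suc (suc 1F))) (0≤μ 1F)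
          ∷ coordinate (suc (suc (suc 2F))) (0≤μ 2F) ∷
      complement 0F (p≤ 0F) ∷ complement 1F (p≤ 1F) ∷ complement 2F (p≤ 2F) ∷ []
      where
      coordinate : ∀ j → 0# ≤ lookup position j → 0# ≤ ⟪ basis j , position ⟫
      coordinate j = ≤-respʳ (sym (⟪⟫-basis j position))
      complement : ∀ j → lookup position j ≤ μ 0F + (μ 1F + μ 2F) →
        0# ≤ ⟪ (basis (suc (suc (suc 0F))) ⊞ basis (suc (suc (suc 1F))) ⊞ basis
            (suc (suc (suc 2F)))) ⊞ (ℤ.- (+ 1)) ⊡ basis j , position ⟫
      complement j le = ≤-respʳ (sym eq) (x≤y⇒0≤y-x le)
        where
        b : Fin 3 → Form
        b i = basis (suc (suc (suc i)))
        eq : ⟪ (b 0F ⊞ b 1F ⊞ b 2F) ⊞ (ℤ.- (+ 1)) ⊡ basis j ,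
            position ⟫ ≈ μ 0F + (μ 1F + μ 2F) - lookup position j
        eq = begin
          ⟪ (b 0F ⊞ b 1F ⊞ b 2F) ⊞ (ℤ.- (+ 1)) ⊡ basis j , position ⟫
            ≈⟨ ⟪⟫-⊞ (b 0F ⊞ b 1F ⊞ b 2F) ((ℤ.- (+ 1)) ⊡ basis j) position ⟩
          ⟪ b 0F ⊞ b 1F ⊞ b 2F , position ⟫ + ⟪ (ℤ.- (+ 1)) ⊡ basis j , position ⟫
            ≈⟨ +-cong (trans (⟪⟫-⊞ (b 0F ⊞ b 1F) (b 2F) position)
                (+-cong (trans (⟪⟫-⊞ (b 0F) (b 1F) position)
                 (+-cong (⟪⟫-basis (suc (suc (suc 0F))) position)
                     (⟪⟫-basis (suc (suc (suc 1F))) position)))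
                     (⟪⟫-basis (suc (suc (suc 2F))) position)))
                 (trans (⟪⟫-⊡ (ℤ.- (+ 1)) (basis j) position) (*-congˡ (⟪⟫-basis j position))) ⟩
          (μ 0F + μ 1F + μ 2F) + - (1# + 0#) * lookup position j
            ≈⟨ +-cong (+-assoc _ _ _) (trans (sym (-‿distribˡ-* _ _))
                (-‿cong (trans (*-congʳ (+-identityʳ 1#)) (*-identityˡ _)))) ⟩
          μ 0F + (μ 1F + μ 2F) - lookup position j ∎
          where open ≈-Reasoning

    module _ (S : Palette) (vanish : ∀ i → lookup S i ≡ false → μ i ≈ 0#) where

      ⟪⟫-mask : ∀ φ → ⟪ mask S φ , position ⟫ ≈ ⟪ φ , position ⟫
      ⟪⟫-mask (a ∷ b ∷ c ∷ d ∷ e ∷ f ∷ []) = go S vanish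
        where
        masked : ∀ s z {x} → (s ≡ false → x ≈ 0#) → fromℤ (if s then z else + 0) * x ≈ fromℤ z * x
        masked true  z _   = refl
        masked false z x≈0 = trans (*-congˡ (x≈0 ≡.refl))
            (trans (zeroʳ _) (sym (trans (*-congˡ (x≈0 ≡.refl)) (zeroʳ _))))
        go : ∀ S → (∀ i → lookup S i ≡ false → μ i ≈ 0#) → ⟪ mask S (a ∷ b ∷ c ∷ d ∷ e ∷ f ∷ []) ,
            position ⟫ ≈ ⟪ a ∷ b ∷ c ∷ d ∷ e ∷ f ∷ [] , position ⟫
        go (s₀ ∷ s₁ ∷ s₂ ∷ []) vanish = +-congˡ
            (+-congˡ (+-congˡ (+-cong (masked s₀ d (vanish 0F))
            (+-cong (masked s₁ e (vanish 1F)) (+-congʳ (masked s₂ f (vanish 2F)))))))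

      -- On the facets of I³ × Δ² the form is nonnegative anyway. At an interior wall, c β = 6 (F -
      -- F′) over S with c > 0, and F is the largest interpolant at the point.
      walled-nonneg : ∀ {τ e} → (∀ {τ′} → τ′ ∈ cellsOver S → ⟪ interpolant τ′ ,
          position ⟫ ≤ ⟪ interpolant τ , position ⟫) →
                      Walled S τ e → 0# ≤ ⟪ proj₂ e , position ⟫
      walled-nonneg {τ} {u , β} max (inj₁ boundary) with find boundary
      ... | ψ , ψ∈ , eq = ≤-respʳ (begin
        fromℤ (+ 6) * ⟪ ψ , position ⟫          ≈⟨ sym (*-congˡ (⟪⟫-mask ψ)) ⟩
        fromℤ (+ 6) * ⟪ mask S ψ , position ⟫   ≈⟨ sym (⟪⟫-⊡ (+ 6) (mask S ψ) position) ⟩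
        ⟪ + 6 ⊡ mask S ψ , position ⟫           ≈⟨ reflexive (≡.cong ⟪_, position ⟫ (≡.sym eq)) ⟩
        ⟪ mask S β , position ⟫                 ≈⟨ ⟪⟫-mask β ⟩
        ⟪ β , position ⟫                        ∎)
        (*-nonneg (fromℕ-nonneg 6) (All.lookup facetForms-nonneg ψ∈))
        where open ≈-Reasoning
      walled-nonneg {τ} {u , β} max (inj₂ wall) with find wall
      ... | τ′ , τ′∈ , 0<c , eq = *-cancelˡ-nonneg (fromℤ-positive 0<c) (≤-respʳ (begin
        fromℤ (+ 6) * (⟪ F , x ⟫ - ⟪ F′ , x ⟫)
          ≈⟨ *-congˡ (+-cong (sym (⟪⟫-mask F)) (trans (-‿cong (sym (⟪⟫-mask F′))) (negate _))) ⟩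
        fromℤ (+ 6) * (⟪ mask S F , x ⟫ + fromℤ (ℤ.- (+ 1)) * ⟪ mask S F′ , x ⟫)
          ≈⟨ *-congˡ (sym (trans (⟪⟫-⊞ (mask S F) _ x)
              (+-congˡ (⟪⟫-⊡ (ℤ.- (+ 1)) (mask S F′) x)))) ⟩
        fromℤ (+ 6) * ⟪ mask S F ⊞ ℤ.- (+ 1) ⊡ mask S F′ , x ⟫
          ≈⟨ sym (⟪⟫-⊡ (+ 6) (mask S F ⊞ ℤ.- (+ 1) ⊡ mask S F′) x) ⟩
        ⟪ + 6 ⊡ (mask S F ⊞ ℤ.- (+ 1) ⊡ mask S F′) , x ⟫
          ≈⟨ reflexive (≡.cong ⟪_, x ⟫ eq) ⟩
        ⟪ margin τ τ′ u ⊡ mask S β , x ⟫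
          ≈⟨ ⟪⟫-⊡ (margin τ τ′ u) (mask S β) x ⟩
        fromℤ (margin τ τ′ u) * ⟪ mask S β , x ⟫
          ≈⟨ *-congˡ (⟪⟫-mask β) ⟩
        fromℤ (margin τ τ′ u) * ⟪ β , x ⟫ ∎)
        (*-nonneg (fromℕ-nonneg 6) (x≤y⇒0≤y-x (max τ′∈))))
        where
        open ≈-Reasoning
        x = position
        F = interpolant τ
        F′ = interpolant τ′
        negate : ∀ y → - y ≈ - (1# + 0#) * y
        negate y = trans (-‿cong (sym (trans (*-congʳ (+-identityʳ 1#)) (*-identityˡ y))))
            (-‿distribˡ-* _ _)

      module _ {τ} (τ∈ : τ ∈ mixedCells) where

        weightOf : Label × Form → Carrier
        weightOf (_ , β) = fromℕ 6 ⁻¹ * ⟪ β , position ⟫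

        reconstruct : ∀ j → ∑ τ (λ e → weightOf e * fromℤ (lookup (labelPoint (proj₁ e)) j))
            ≈ lookup position j
        reconstruct j = begin
          ∑ τ (λ e → weightOf e * fromℤ (lookup (labelPoint (proj₁ e)) j))
            ≈⟨ ∑-cong τ (λ e → trans (*-assoc _ _ _) (*-congˡ (*-comm _ _))) ⟩
          ∑ τ (λ e → fromℕ 6 ⁻¹ * (fromℤ (lookup (labelPoint (proj₁ e)) j) * ⟪ proj₂ e ,
              position ⟫))
            ≈⟨ ∑-*ˡ τ _ _ ⟩
          fromℕ 6 ⁻¹ * ∑ τ (λ e → fromℤ (lookup (labelPoint (proj₁ e)) j) * ⟪ proj₂ e , position ⟫)
            ≈⟨ *-congˡ (sym (⟪⟫-combine (λ e → lookup (labelPoint (proj₁ e)) j) proj₂ τ position)) ⟩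
          fromℕ 6 ⁻¹ * ⟪ combine (λ e → lookup (labelPoint (proj₁ e)) j) proj₂ τ , position ⟫
            ≈⟨ *-congˡ (reflexive (≡.cong ⟪_, position ⟫
                (All.lookup (All.lookup reconstructs τ∈) (∈-allFin j)))) ⟩
          fromℕ 6 ⁻¹ * ⟪ + 6 ⊡ basis j , position ⟫
            ≈⟨ *-congˡ (trans (⟪⟫-⊡ (+ 6) (basis j) position) (*-congˡ (⟪⟫-basis j position))) ⟩
          fromℕ 6 ⁻¹ * (fromℕ 6 * lookup position j)
            ≈⟨ trans (sym (*-assoc _ _ _)) (trans
                (*-congʳ (trans (*-comm _ _) (*-inverse (fromℕ-positive 5)))) (*-identityˡ _)) ⟩
          lookup position j ∎
          where open ≈-Reasoning

        fibreWeights : Fin 3 → List (Vertex 3 × Carrier)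
        fibreWeights i = List.map (λ e → proj₂ (proj₁ e) , weightOf e) (ofColour i τ)

        fibreWeights-fibre : ∀ i → List.map proj₁ (fibreWeights i) ≡ fibre i τ
        fibreWeights-fibre i = ≡.sym (List.map-∘ (ofColour i τ))

        fibreWeights-nonneg : (∀ {e} → e ∈ τ → 0# ≤ ⟪ proj₂ e , position ⟫) → ∀ i {e} →
            e ∈ fibreWeights i → 0# ≤ proj₂ e
        fibreWeights-nonneg 0≤β i e∈ with f , f∈ ,
            ≡.refl ← ∈-map⁻ (λ e → proj₂ (proj₁ e) , weightOf e) e∈ =
          *-nonneg (inj₁ (⁻¹-positive (fromℕ-positive 5)))
              (0≤β (proj₁ (∈-filter⁻ (λ e → proj₁ (proj₁ e) Fin.≟ i) {xs = τ} f∈)))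

        fibreWeights-total : ∀ i → ∑ (fibreWeights i) proj₂ ≈ μ i
        fibreWeights-total i = begin
          ∑ (fibreWeights i) proj₂
            ≈⟨ ∑-map _ (ofColour i τ) proj₂ ⟩
          ∑ (ofColour i τ) weightOf
            ≈⟨ ∑-filter (λ e → proj₁ (proj₁ e) Fin.≟ i) τ weightOf ⟩
          ∑ τ (λ e → if does (proj₁ (proj₁ e) Fin.≟ i) then weightOf e else 0#)
            ≈⟨ ∑-cong τ (λ (u , β) → indicator i u (weightOf (u , β))) ⟩
          ∑ τ (λ e → weightOf e * fromℤ (lookup (labelPoint (proj₁ e)) (suc (suc (suc i)))))
            ≈⟨ reconstruct (suc (suc (suc i))) ⟩
          lookup position (suc (suc (suc i)))
            ≈⟨ at i ⟩
          μ i ∎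
          where
          open ≈-Reasoning
          one : ∀ c → c ≈ c * (1# + 0#)
          one c = sym (trans (*-congˡ (+-identityʳ 1#)) (*-identityʳ c))
          indicator : ∀ i (u : Label) c → (if does (proj₁ u Fin.≟ i) then c else 0#) ≈ c
              * fromℤ (lookup (labelPoint u) (suc (suc (suc i))))
          indicator 0F (0F , _ ∷ _ ∷ _ ∷ []) c = one c
          indicator 0F (1F , _ ∷ _ ∷ _ ∷ []) c = sym (zeroʳ c)
          indicator 0F (2F , _ ∷ _ ∷ _ ∷ []) c = sym (zeroʳ c)
          indicator 1F (0F , _ ∷ _ ∷ _ ∷ []) c = sym (zeroʳ c)
          indicator 1F (1F , _ ∷ _ ∷ _ ∷ []) c = one c
          indicator 1F (2F , _ ∷ _ ∷ _ ∷ []) c = sym (zeroʳ c)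
          indicator 2F (0F , _ ∷ _ ∷ _ ∷ []) c = sym (zeroʳ c)
          indicator 2F (1F , _ ∷ _ ∷ _ ∷ []) c = sym (zeroʳ c)
          indicator 2F (2F , _ ∷ _ ∷ _ ∷ []) c = one c
          at : ∀ i → lookup position (suc (suc (suc i))) ≈ μ i
          at 0F = refl
          at 1F = refl
          at 2F = refl

        fibreMoment : Fin 3 → Fin 3 → Carrier
        fibreMoment i j = ∑ (fibreWeights i) (λ (a , w) → w * coordinates a j)

        fibreWeights-moment : ∀ j → fibreMoment 0F j + (fibreMoment 1F j + fibreMoment 2F j) ≈ p j
        fibreWeights-moment j = begin
          fibreMoment 0F j + (fibreMoment 1F j + fibreMoment 2F j)
            ≈⟨ +-cong (∑-map _ (ofColour 0F τ) _)
                (+-cong (∑-map _ (ofColour 1F τ) _) (∑-map _ (ofColour 2F τ) _)) ⟩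
          ∑ (ofColour 0F τ) term + (∑ (ofColour 1F τ) term + ∑ (ofColour 2F τ) term)
            ≈⟨ sym (∑-colours τ term) ⟩
          ∑ τ term
            ≈⟨ ∑-cong τ (λ ((k , a) , β) → *-congˡ (sym (labelPoint-coordinate j k a))) ⟩
          ∑ τ (λ e → weightOf e * fromℤ (lookup (labelPoint (proj₁ e)) (j Fin.↑ˡ 3)))
            ≈⟨ reconstruct (j Fin.↑ˡ 3) ⟩
          lookup position (j Fin.↑ˡ 3)
            ≈⟨ at j ⟩
          p j ∎
          where
          open ≈-Reasoning
          term : Label × Form → Carrier
          term e = weightOf e * coordinates (proj₂ (proj₁ e)) j
          at : ∀ j → lookup position (j Fin.↑ˡ 3) ≈ p j
          at 0F = refl
          at 1F = refl
          at 2F = refl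

      -- The cell whose interpolant is largest at the given point contains it.
      mixed-cover : Nonempty S → ∃[ τ ] τ ∈ mixedCells × Full S τ ×
        ∃[ ws ] ((∀ i → List.map proj₁ (ws i) ≡ fibre i τ)
               × (∀ i {e} → e ∈ ws i → 0# ≤ proj₂ e)
               × (∀ i → ∑ (ws i) proj₂ ≈ μ i)
               × (∀ j → ∑ (ws 0F) (λ (a , w) → w * coordinates a j)
                        + (∑ (ws 1F) (λ (a , w) → w * coordinates a j)
                            + ∑ (ws 2F) (λ (a , w) → w * coordinates a j)) ≈ p j))
      mixed-cover nonempty =
        let some , walls = All.lookup walled (nonempty⇒∈ S nonempty)
            τ , τ∈S , max = maximiser (λ τ → ⟪ interpolant τ , position ⟫) (cellsOver S) some
            τ∈ , full = ∈-filter⁻ (full? S) {xs = mixedCells} τ∈S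
        in τ , τ∈ , full , fibreWeights τ∈ , fibreWeights-fibre τ∈
           , fibreWeights-nonneg τ∈ (λ {e} e∈ →
               walled-nonneg {τ} {e} max (All.lookup (All.lookup walls τ∈S) e∈))
           , fibreWeights-total τ∈ , fibreWeights-moment τ∈

-- Products

module NorthWest {ℓ} (ℝ : CompleteOrderedField ℓ) where
  open CompleteOrderedField ℝ hiding (zero)
  open Reals ℝ

  module _ {A B : Set} where

    -- A coupling of two weighted lists that is carried by a staircase. The marginals are stated
    -- against test functions because they serve to compute moments.
    record Transport (as : List (A × Carrier)) (bs : List (B × Carrier)) : Set ℓ where
      field
        plan      : List ((A × B) × Carrier)
        staircase : List.map proj₁ plan ∈ staircases (List.map proj₁ as) (List.map proj₁ bs)
        nonneg    : ∀ {e} → e ∈ plan → 0# ≤ proj₂ e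
        marginalˡ : ∀ (g : A → Carrier) → ∑ plan (λ ((a , b) , w) → w * g a)
            ≈ ∑ as (λ (a , w) → w * g a)
        marginalʳ : ∀ (h : B → Carrier) → ∑ plan (λ ((a , b) , w) → w * h b)
            ≈ ∑ bs (λ (b , w) → w * h b)

    open Transport

    advanceˡ : ∀ {a α a′ as b β bs} → 0# ≤ α →
      Transport (a′ ∷ as) ((b , β - α) ∷ bs) → Transport ((a , α) ∷ a′ ∷ as) ((b , β) ∷ bs)
    advanceˡ {a} {α} {b = b} {β} 0≤α t = record
      { plan      = ((a , b) , α) ∷ plan t
      ; staircase = ∈-map⁺ ((a , b) ∷_) (∈-++⁺ˡ (staircase t))
      ; nonneg    = λ { (here ≡.refl) → 0≤α ; (there e∈) → nonneg t e∈ }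
      ; marginalˡ = λ g → +-congˡ (marginalˡ t g)
      ; marginalʳ = λ h → trans (+-congˡ (marginalʳ t h)) (trans (sym (+-assoc _ _ _))
                      (+-congʳ (trans (sym (distribʳ (h b) α (β - α)))
                          (*-congʳ (trans (+-comm α _) (x-y+y≈x β α))))))
      }

    advanceʳ : ∀ {a α a′ as b β bs} → 0# ≤ β →
      Transport ((a , α - β) ∷ a′ ∷ as) bs → Transport ((a , α) ∷ a′ ∷ as) ((b , β) ∷ bs)
    advanceʳ {a} {α} {a′} {as} {b} {β} {bs} 0≤β t = record
      { plan      = ((a , b) , β) ∷ plan t
      ; staircase = ∈-map⁺ ((a , b) ∷_) (∈-++⁺ʳ
          (staircases (List.map proj₁ (a′ ∷ as)) (b ∷ List.map proj₁ bs)) (staircase t))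
      ; nonneg    = λ { (here ≡.refl) → 0≤β ; (there e∈) → nonneg t e∈ }
      ; marginalˡ = λ g → trans (+-congˡ (marginalˡ t g)) (trans (sym (+-assoc _ _ _))
                      (+-congʳ (trans (sym (distribʳ (g a) β (α - β)))
                          (*-congʳ (trans (+-comm β _) (x-y+y≈x α β))))))
      ; marginalʳ = λ h → +-congˡ (marginalʳ t h)
      }

    remainder : ∀ {x y z w} → x + z ≈ y + w → z ≈ (y - x) + w
    remainder {x} {y} {z} {w} eq = +-cancelʳ-≈ x (trans (+-comm z x) (trans eq (sym
      (trans (+-assoc (y - x) w x) (trans (+-congˡ (+-comm w x))
          (trans (sym (+-assoc (y - x) x w)) (+-congʳ (x-y+y≈x y x))))))))

    -- At the current corner the smaller of α and β is moved, which exhausts a row or a column. The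
    -- alternative `as ≡ []` admits an empty `bs` when there is a single row; its staircase is
    -- empty.
    northWest : ∀ a α as bs → 0# ≤ α → (∀ {e} → e ∈ as → 0# ≤ proj₂ e) →
        (∀ {e} → e ∈ bs → 0# ≤ proj₂ e) →
      0 ℕ.< length bs ⊎ as ≡ [] → ∑ ((a , α) ∷ as) proj₂ ≈ ∑ bs proj₂ → Transport ((a , α) ∷ as) bs
    northWest a α [] bs _ _ 0≤bs _ total = record
      { plan      = List.map (λ (b , β) → (a , b) , β) bs
      ; staircase = here (≡.trans (≡.sym (List.map-∘ bs)) (List.map-∘ bs))
      ; nonneg    = λ e∈ → let f , f∈ , eq = ∈-map⁻ _ e∈ in ≡.subst (λ e → 0# ≤ proj₂ e) (≡.sym eq) (0≤bs f∈)
      ; marginalˡ = λ g → trans (∑-map _ bs _) (trans (∑-*ʳ bs (g a) proj₂)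
                      (trans (*-congʳ (trans (sym total) (+-identityʳ α))) (sym (+-identityʳ _))))
      ; marginalʳ = λ h → ∑-map _ bs _
      }
    northWest a α ((a′ , α′) ∷ as) [] _ _ _ (inj₁ ()) _
    northWest a α ((a′ , α′) ∷ as) [] _ _ _ (inj₂ ()) _
    -- In the last column it is always the row that has to advance, for no staircase continues with
    -- two rows and no column; the equal totals give α ≤ β.
    northWest a α ((a′ , α′) ∷ as) ((b , β) ∷ []) 0≤α 0≤as 0≤bs _ total =
      advanceˡ 0≤α (northWest a′ α′ as ((b , β - α) ∷ []) (0≤as (here ≡.refl)) (0≤as ∘ there)
        (λ { (here ≡.refl) → x≤y⇒0≤y-x α≤β }) (inj₁ (ℕ.s≤s ℕ.z≤n)) (remainder total))
      where
      α≤β : α ≤ β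
      α≤β = ≤-respˡ (+-identityʳ α) (≤-trans (+-monoʳ-≤ α (∑-nonneg ((a′ , α′) ∷ as) 0≤as))
          (inj₂ (trans total (+-identityʳ β))))
    northWest a α ((a′ , α′) ∷ as) ((b , β) ∷ b′ ∷ bs) 0≤α 0≤as 0≤bs _ total =
      [ (λ α≤β → advanceˡ 0≤α (northWest a′ α′ as ((b , β - α) ∷ b′ ∷ bs) (0≤as (here ≡.refl))
          (0≤as ∘ there)
        (λ { (here ≡.refl) → x≤y⇒0≤y-x α≤β ; (there e∈) → 0≤bs (there e∈) }) (inj₁ (ℕ.s≤s ℕ.z≤n))
            (remainder total)))
      , (λ β≤α → advanceʳ (0≤bs (here ≡.refl))
          (northWest a (α - β) ((a′ , α′) ∷ as) (b′ ∷ bs) (x≤y⇒0≤y-x β≤α) 0≤as (0≤bs ∘ there)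
        (inj₁ (ℕ.s≤s ℕ.z≤n)) (sym (remainder (sym total))))) ]′ (≤-total α β)

  -- Two noncrossing matrices with the same row and column sums agree. At the first
  -- difference, the larger matrix forces the other one to have a crossing.
  module _ {A B : Set} (rankA : A → ℕ) (rankB : B → ℕ)
           (injectiveA : ∀ a a′ → rankA a ≡ rankA a′ → a ≡ a′)
               (injectiveB : ∀ b b′ → rankB b ≡ rankB b′ → b ≡ b′)
           (as : List A) (bs : List B) where

    NonCrossing : (A → B → Carrier) → Set ℓ
    NonCrossing X = ∀ {a b a′ b′} → 0# < X a b → 0# < X a′ b′ → rankA a ℕ.< rankA a′ →
        ¬ rankB b′ ℕ.< rankB b

    -- In row a, Y makes up for its deficit at some b′, which must come after b; in column b it does
    -- so at some a′ after a. The positive entries of Y at (a, b′) and (a′, b) cross.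
    excess-impossible : ∀ (X Y : A → B → Carrier) → (∀ a b → 0# ≤ X a b) → NonCrossing Y →
      (∀ a → ∑ bs (X a) ≈ ∑ bs (Y a)) → (∀ b → ∑ as (λ a → X a b) ≈ ∑ as (λ a → Y a b)) →
      ∀ a b → a ∈ as → b ∈ bs →
      (∀ b′ → rankB b′ ℕ.< rankB b → X a b′ ≈ Y a b′) →
          (∀ a′ → rankA a′ ℕ.< rankA a → X a′ b ≈ Y a′ b) → ¬ Y a b < X a b
    excess-impossible X Y 0≤X noncrossing rows columns a b a∈ b∈ left below Y<X
      with b′ , b′∈ , X<Y ← ∑-compensate bs (rows a) b∈ Y<X
         | a′ , a′∈ , X<Y′ ← ∑-compensate as (columns b) a∈ Y<X =
      noncrossing (≤-<-trans (0≤X a b′) X<Y) (≤-<-trans (0≤X a′ b) X<Y′) a<a′ b<b′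
      where
      b<b′ : rankB b ℕ.< rankB b′
      b<b′ with ℕ.<-cmp (rankB b) (rankB b′)
      ... | tri< b<b′ _ _ = b<b′
      ... | tri≈ _ eq _ with ≡.refl ← injectiveB b b′ eq = contradiction Y<X (<-asym X<Y)
      ... | tri> _ _ b′<b = contradiction X<Y (<-irrefl (left b′ b′<b))
      a<a′ : rankA a ℕ.< rankA a′
      a<a′ with ℕ.<-cmp (rankA a) (rankA a′)
      ... | tri< a<a′ _ _ = a<a′
      ... | tri≈ _ eq _ with ≡.refl ← injectiveA a a′ eq = contradiction Y<X (<-asym X<Y′)
      ... | tri> _ _ a′<a = contradiction X<Y′ (<-irrefl (below a′ a′<a))

    noncrossing-unique : ∀ (X Y : A → B → Carrier) → (∀ a b → 0# ≤ X a b) → (∀ a b → 0# ≤ Y a b) →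
      NonCrossing X → NonCrossing Y →
      (∀ a → ∑ bs (X a) ≈ ∑ bs (Y a)) → (∀ b → ∑ as (λ a → X a b) ≈ ∑ as (λ a → Y a b)) →
      (∀ a → a ∈ as) → (∀ b → b ∈ bs) → ∀ a b → X a b ≈ Y a b
    noncrossing-unique X Y 0≤X 0≤Y ncX ncY rows columns a∈ b∈ a b =
        go (suc (rankA a ℕ.+ rankB b)) a b ℕ.≤-refl
      where
      -- Entries earlier in the row or in the column have a smaller sum of ranks, so they agree by
      -- induction.
      go : ∀ N a b → rankA a ℕ.+ rankB b ℕ.< N → X a b ≈ Y a b
      go (suc N) a b (ℕ.s≤s a+b≤N) with compare (X a b) (Y a b)
      ... | tri≈ _ eq _ = eq
      ... | tri> _ _ Y<X = contradiction Y<X (excess-impossible X Y 0≤X ncY rows columns a b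
          (a∈ a) (b∈ b)
        (λ b′ b′<b → go N a b′ (ℕ.<-≤-trans (ℕ.+-monoʳ-< (rankA a) b′<b) a+b≤N))
        (λ a′ a′<a → go N a′ b (ℕ.<-≤-trans (ℕ.+-monoˡ-< (rankB b) a′<a) a+b≤N)))
      ... | tri< X<Y _ _ = contradiction X<Y (excess-impossible Y X 0≤Y ncX (λ a → sym (rows a))
          (λ b → sym (columns b)) a b (a∈ a) (b∈ b)
        (λ b′ b′<b → sym (go N a b′ (ℕ.<-≤-trans (ℕ.+-monoʳ-< (rankA a) b′<b) a+b≤N)))
        (λ a′ a′<a → sym (go N a′ b (ℕ.<-≤-trans (ℕ.+-monoˡ-< (rankB b) a′<a) a+b≤N))))

-- The facets of the product

length-cartesianProductWith : ∀ {a b c} {A : Set a} {B : Set b} {C : Set c} (f : A → B → C) xs ys →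
  length (List.cartesianProductWith f xs ys) ≡ length xs ℕ.* length ys
length-cartesianProductWith f []       ys = ≡.refl
length-cartesianProductWith f (x ∷ xs) ys = ≡.trans (List.length-++ (List.map (f x) ys))
  (≡.cong₂ ℕ._+_ (List.length-map (f x) ys) (length-cartesianProductWith f xs ys))

length-concatMap : ∀ {a b} {A : Set a} {B : Set b} (f : A → List B) xs →
  length (List.concatMap f xs) ≡ sumℕ (List.map (length ∘ f) xs)
length-concatMap f []       = ≡.refl
length-concatMap f (x ∷ xs) = ≡.trans (List.length-++ (f x))
    (≡.cong (length (f x) ℕ.+_) (length-concatMap f xs))

∈-fibre⁻ : ∀ {i τ a} → a ∈ fibre i τ → (i , a) ∈ labels τ
∈-fibre⁻ {i} {τ} a∈ with e , e∈ , ≡.refl ← ∈-map⁻ (proj₂ ∘ proj₁) a∈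
  with e∈τ , ≡.refl ← ∈-filter⁻ (λ e → proj₁ (proj₁ e) Fin.≟ i) {xs = τ} e∈ = ∈-map⁺ proj₁ e∈τ

module Joins {n : ℕ} (c : Vec Bool n → Fin 3) where
  open Colouring (_≟ᵛ_ {n})

  Pair : Set
  Pair = Vec Bool 3 × Vec Bool n

  join : Pair → Vec Bool (3 ℕ.+ n)
  join (a , v) = a Vec.++ v

  join-injective : ∀ {p q} → join p ≡ join q → p ≡ q
  join-injective {a , v} {b , w} eq = ≡.cong₂ _,_ (Vec.++-injectiveˡ a b eq)
      (Vec.++-injectiveʳ a b eq)

  class : Fin 3 → List (Vec Bool n) → List (Vec Bool n)
  class i F = colourClass c i (arrange F)

  paths : List (Vec Bool n) → Cell → Fin 3 → List (List Pair)
  paths F τ i = staircases (fibre i τ) (class i F)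

  unions : List (Vec Bool n) → Cell → List (List Pair)
  unions F τ = List.cartesianProductWith _++_ (paths F τ 0F)
      (List.cartesianProductWith _++_ (paths F τ 1F) (paths F τ 2F))

  -- All cells are listed here, full or not: a fibre with several vertices has no staircase with an
  -- empty colour class, so a cell that is not full contributes nothing.
  productFacets : List (List (Vec Bool n)) → List (List (Vec Bool (3 ℕ.+ n)))
  productFacets facets = List.concatMap (λ F →
      List.concatMap (λ τ → List.map (List.map join) (unions F τ)) mixedCells) facets

  length-productFacets : ∀ facets →
    length (productFacets facets) ≡ sumℕ (List.map
        (λ F → totalCount cellShapes (classCounts c (arrange F))) facets)
  length-productFacets facets = ≡.trans (length-concatMap _ facets)
    (≡.cong sumℕ (List.map-cong (λ F → ≡.trans (length-concatMap _ mixedCells)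
      (≡.cong sumℕ (≡.trans (List.map-cong (λ τ → count F τ) mixedCells)
          (List.map-∘ mixedCells)))) facets))
    where
    count : ∀ F τ → length (List.map (List.map join) (unions F τ))
        ≡ shapeCount (shape τ) (classCounts c (arrange F))
    count F τ = ≡.trans (List.length-map (List.map join) (unions F τ))
      (≡.trans (length-cartesianProductWith _++_ (paths F τ 0F) _)
          (≡.cong₂ ℕ._*_ (length-staircases (fibre 0F τ) (class 0F F))
        (≡.trans (length-cartesianProductWith _++_ (paths F τ 1F) _)
          (≡.cong₂ ℕ._*_ (length-staircases (fibre 1F τ) (class 1F F))
              (length-staircases (fibre 2F τ) (class 2F F))))))

  record Join (facets : List (List (Vec Bool n))) (G : List (Vec Bool (3 ℕ.+ n))) : Set where
    field
      {F}  : List (Vec Bool n)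
      {τ}  : Cell
      F∈   : F ∈ facets
      τ∈   : τ ∈ mixedCells
      path : Fin 3 → List Pair
      path∈ : ∀ i → path i ∈ paths F τ i
      G≡   : G ≡ List.map join (path 0F ++ (path 1F ++ path 2F))

  ∈-productFacets⁻ : ∀ {facets G} → G ∈ productFacets facets → Join facets G
  ∈-productFacets⁻ {facets} {G} G∈
    with F , F∈ , G∈F ← find (∈-concatMap⁻ _ {xs = facets} G∈)
    with τ , τ∈ , G∈τ ← find (∈-concatMap⁻ _ {xs = mixedCells} G∈F)
    with U , U∈ , G≡ ← ∈-map⁻ (List.map join) G∈τ
    with P , Q , P∈ , Q∈ , ≡.refl ← ∈-cartesianProductWith⁻ _++_ (paths F τ 0F) _ U∈
    with P₁ , P₂ , P₁∈ , P₂∈ , ≡.refl ← ∈-cartesianProductWith⁻ _++_ (paths F τ 1F)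
        (paths F τ 2F) Q∈ = record
      { F∈ = F∈ ; τ∈ = τ∈ ; path = λ { 0F → P ; 1F → P₁ ; 2F → P₂ } ; path∈ =
          λ { 0F → P∈ ; 1F → P₁∈ ; 2F → P₂∈ } ; G≡ = G≡ }

  ∈-productFacets⁺ : ∀ {facets F τ} → F ∈ facets → τ ∈ mixedCells → (path : Fin 3 → List Pair) →
      (∀ i → path i ∈ paths F τ i) →
    List.map join (path 0F ++ (path 1F ++ path 2F)) ∈ productFacets facets
  ∈-productFacets⁺ {facets} {F} {τ} F∈ τ∈ path path∈ =
      ∈-concatMap⁺ _ (lose F∈ (∈-concatMap⁺ _ (lose τ∈ (∈-map⁺ (List.map join)
    (∈-cartesianProductWith⁺ _++_ {a = path 0F} (path∈ 0F)
      (∈-cartesianProductWith⁺ _++_ {xs = paths F τ 1F} {a = path 1F} {b = path 2F} (path∈ 1F)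
          (path∈ 2F)))))))

  module _ {facets G} (J : Join facets G) where
    open Join J

    union : List Pair
    union = path 0F ++ (path 1F ++ path 2F)

    wf : WellFormed τ
    wf = All.lookup cellsWellFormed τ∈

    ∈-path : ∀ i {a v} → (a , v) ∈ path i → (i , a) ∈ labels τ × v ∈ F × c v ≡ i
    ∈-path i av∈ with a∈ , v∈ ← All.lookup (staircase-⊆ (fibre i τ) (class i F) (path∈ i)) av∈
      with v∈arrange , cv≡i ← ∈-filter⁻ (λ v → c v Fin.≟ i) {xs = arrange F} v∈ =
      ∈-fibre⁻ a∈ , proj₂ (∈-filter⁻ (_∈? F) {xs = cubeVertices n} v∈arrange) , cv≡i

    -- The colour of v tells from which of the three staircases a pair comes.
    ∈-union : ∀ {a v} → (a , v) ∈ union → (a , v) ∈ path (c v)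
    ∈-union av∈ with ∈-++⁻ (path 0F) av∈
    ... | inj₁ ∈₀ = ≡.subst (λ i → _ ∈ path i) (≡.sym (proj₂ (proj₂ (∈-path 0F ∈₀)))) ∈₀
    ... | inj₂ ∈₁₂ with ∈-++⁻ (path 1F) ∈₁₂
    ...   | inj₁ ∈₁ = ≡.subst (λ i → _ ∈ path i) (≡.sym (proj₂ (proj₂ (∈-path 1F ∈₁)))) ∈₁
    ...   | inj₂ ∈₂ = ≡.subst (λ i → _ ∈ path i) (≡.sym (proj₂ (proj₂ (∈-path 2F ∈₂)))) ∈₂

    ∈-facet : ∀ a v → join (a , v) ∈ G → (a , v) ∈ path (c v)
    ∈-facet a v av∈ with (b , w) , bw∈ , eq ← ∈-map⁻ join (≡.subst (join (a , v) ∈_) G≡ av∈)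
      with ≡.refl ← join-injective {a , v} {b , w} eq = ∈-union bw∈

    path-Below : ∀ i → AllPairs (Below rank rank) (path i)
    path-Below i = staircase-Below rank rank (fibre i τ) (class i F) (path∈ i)
        (All.lookup (WellFormed.sorted wf) (∈-allFin i))
      (AllPairs.filter⁺ (λ v → c v Fin.≟ i) (arrange-sorted F))

    union-unique : Unique union
    union-unique = Unique.++⁺ (unique 0F) (Unique.++⁺ (unique 1F) (unique 2F)
        (λ (∈₁ , ∈₂) → different (colour 1F ∈₁) (colour 2F ∈₂) λ ()))
        (λ (∈₀ , ∈₁₂) → [ (λ ∈₁ → different (colour 0F ∈₀) (colour 1F ∈₁) λ ()) ,
            (λ ∈₂ → different (colour 0F ∈₀) (colour 2F ∈₂) λ ()) ]′ (∈-++⁻ (path 1F) ∈₁₂))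
      where
      unique : ∀ i → Unique (path i)
      unique i = Below⇒Unique rank rank (path-Below i)
      colour : ∀ i {p} → p ∈ path i → c (proj₂ p) ≡ i
      colour i p∈ = proj₂ (proj₂ (∈-path i p∈))
      different : ∀ {k i j : Fin 3} → k ≡ i → k ≡ j → i ≢ j → ∀ {A : Set} → A
      different k≡i k≡j i≢j = contradiction (≡.trans (≡.sym k≡i) k≡j) i≢j

    facet-unique : Unique G
    facet-unique = ≡.subst Unique (≡.sym G≡) (Unique.map⁺
        (λ {p} {q} → join-injective {p} {q}) union-unique)

    class-lengths : length (class 0F F) ℕ.+ (length (class 1F F) ℕ.+ length (class 2F F))
        ≡ length (arrange F)
    class-lengths = go (arrange F)
      where
      go : ∀ vs → length (colourClass c 0F vs)
          ℕ.+ (length (colourClass c 1F vs) ℕ.+ length (colourClass c 2F vs)) ≡ length vs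
      go [] = ≡.refl
      go (v ∷ vs) with c v
      ... | 0F = ≡.cong suc (go vs)
      ... | 1F = ≡.trans (ℕ.+-suc _ _) (≡.cong suc (go vs))
      ... | 2F = ≡.trans (≡.cong (length (colourClass c 0F vs) ℕ.+_) (ℕ.+-suc _ _))
          (≡.trans (ℕ.+-suc _ _) (≡.cong suc (go vs)))

    -- The staircase of colour i has rᵢ + kᵢ - 1 vertices, and the three together have 6 + (n + 1) -
    -- 3 = n + 4.
    facet-length : Unique F → length F ≡ suc n → length G ≡ suc (3 ℕ.+ n)
    facet-length uniqueF lengthF = ≡.trans (≡.cong length G≡) (≡.trans (List.length-map join union)
      (≡.trans (≡.trans (List.length-++ (path 0F))
          (≡.cong (length (path 0F) ℕ.+_) (List.length-++ (path 1F))))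
        (ℕ.+-cancelˡ-≡ 3 _ _ (≡.trans (add3 {a = r 0F} {r 1F} {r 2F} {k 0F} {k 1F} {k 2F} (len 0F)
            (len 1F) (len 2F)) (≡.trans (≡.cong₂ ℕ._+_ (WellFormed.six wf) ≡.refl)
          (≡.trans (≡.cong (6 ℕ.+_) (≡.trans class-lengths
              (≡.trans (↭-length (arrange-↭ uniqueF)) lengthF))) ≡.refl))))))
      where
      r k : Fin 3 → ℕ
      r i = length (fibre i τ)
      k i = length (class i F)
      len : ∀ i → suc (length (path i)) ≡ r i ℕ.+ k i
      len i = staircase-length (fibre i τ) (class i F) (path∈ i)
      add3 : ∀ {x y z a b c p q r} → suc x ≡ a ℕ.+ p → suc y ≡ b ℕ.+ q → suc z ≡ c ℕ.+ r →
             3 ℕ.+ (x ℕ.+ (y ℕ.+ z)) ≡ (a ℕ.+ (b ℕ.+ c)) ℕ.+ (p ℕ.+ (q ℕ.+ r))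
      add3 {x} {y} {z} {a} {b} {c} {p} {q} {r} e f g =
          ≡.trans (sucs x y z) (≡.trans (≡.cong₂ ℕ._+_ e (≡.cong₂ ℕ._+_ f g)) (regroup a b c p q r))
        where
        sucs : ∀ x y z → 3 ℕ.+ (x ℕ.+ (y ℕ.+ z)) ≡ suc x ℕ.+ (suc y ℕ.+ suc z)
        sucs = solve-∀
        regroup : ∀ a b c p q r → (a ℕ.+ p) ℕ.+ ((b ℕ.+ q) ℕ.+ (c ℕ.+ r)) ≡ (a ℕ.+ (b ℕ.+ c))
            ℕ.+ (p ℕ.+ (q ℕ.+ r))
        regroup = solve-∀

nonempty : ∀ {A : Set} → List A → Bool
nonempty []      = false
nonempty (_ ∷ _) = true

∈⇒nonempty : ∀ {A : Set} {x : A} {xs} → x ∈ xs → nonempty xs ≡ true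
∈⇒nonempty (here _)  = ≡.refl
∈⇒nonempty (there _) = ≡.refl

-- Opaque, so that sums over the corners are not expanded.
opaque
  corners : List (Vec Bool 3)
  corners = cubeVertices 3

  ∈-corners : ∀ a → a ∈ corners
  ∈-corners = ∈-cubeVertices

-- Uniqueness of weights on the product

module Products {ℓ} (ℝ : CompleteOrderedField ℓ) where
  open CompleteOrderedField ℝ hiding (zero)
  open Reals ℝ
  open Forms ℝ
  open MixedCells ℝ
  open NorthWest ℝ
  open Complexes ℝ
  open CubeTriangulations ℝ

  ∑-cartesianProduct : ∀ {B C : Set} (xs : List B) (ys : List C) f →
    ∑ (List.cartesianProduct xs ys) f ≈ ∑ xs (λ x → ∑ ys (λ y → f (x , y)))
  ∑-cartesianProduct []       ys f = refl
  ∑-cartesianProduct (x ∷ xs) ys f = trans (∑-++ (List.map (x ,_) ys) _ f)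
      (+-cong (∑-map (x ,_) ys f) (∑-cartesianProduct xs ys f))

  opaque
    unfolding allLabels corners

    ∑-allLabels : ∀ f → ∑ allLabels f ≈ ∑ (List.allFin 3) (λ i → ∑ corners (λ a → f (i , a)))
    ∑-allLabels f = ∑-cartesianProduct (List.allFin 3) (cubeVertices 3) f

    ∑-joined : ∀ {n} (f : Vertex (3 ℕ.+ n) → Carrier) →
      ∑ (cubeVertices (3 ℕ.+ n)) f ≈ ∑ corners (λ a → ∑ (cubeVertices n) (λ v → f (a Vec.++ v)))
    ∑-joined = ∑-cubeVertices-++ 3

  module _ {n} (c : Vertex n → Fin 3) where
    open Colouring (_≟ᵛ_ {n})
    open Joins c

    As = corners
    Vs = cubeVertices n

    -- The matrix of the weights over one colour. Columns of other colours are set to zero, so that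
    -- the three matrices have a common index set.
    coloured : (Vertex (3 ℕ.+ n) → Carrier) → Fin 3 → Vertex 3 → Vertex n → Carrier
    coloured X i a v = if does (c v Fin.≟ i) then X (a Vec.++ v) else 0#

    coloured-nonneg : ∀ {X} → (∀ u → 0# ≤ X u) → ∀ i a v → 0# ≤ coloured X i a v
    coloured-nonneg 0≤X i a v with does (c v Fin.≟ i)
    ... | true  = 0≤X (a Vec.++ v)
    ... | false = ≤-refl

    coloured-own : ∀ X a v → coloured X (c v) a v ≈ X (a Vec.++ v)
    coloured-own X a v = reflexive (≡.cong (if_then X (a Vec.++ v) else 0#)
        (dec-true (c v Fin.≟ c v) ≡.refl))

    -- The projections of X to Iⁿ and to I³ × Δ².
    marginal : (Vertex (3 ℕ.+ n) → Carrier) → Vertex n → Carrier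
    marginal X v = ∑ As (λ a → X (a Vec.++ v))

    mixedMarginal : (Vertex (3 ℕ.+ n) → Carrier) → Label → Carrier
    mixedMarginal X (i , a) = ∑ Vs (coloured X i a)

    ∑-marginal : ∀ X (h : Vertex n → Carrier) →
        ∑ Vs (λ v → marginal X v * h v) ≈ ∑ As (λ a → ∑ Vs (λ v → X (a Vec.++ v) * h v))
    ∑-marginal X h = trans (∑-cong Vs (λ v → sym (∑-*ʳ As (h v) _))) (∑-swap Vs As _)

    ∑-mixedMarginal : ∀ X (h : Label → Carrier) →
      ∑ allLabels (λ u → mixedMarginal X u * h u)
          ≈ ∑ As (λ a → ∑ Vs (λ v → X (a Vec.++ v) * h (c v , a)))
    ∑-mixedMarginal X h = begin
      ∑ allLabels (λ u → mixedMarginal X u * h u)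
        ≈⟨ ∑-allLabels _ ⟩
      ∑ is (λ i → ∑ As (λ a → mixedMarginal X (i , a) * h (i , a)))
        ≈⟨ ∑-swap is As (λ i a → mixedMarginal X (i , a) * h (i , a)) ⟩
      ∑ As (λ a → ∑ is (λ i → mixedMarginal X (i , a) * h (i , a)))
        ≈⟨ ∑-cong As (λ a → ∑-cong is (λ i → sym (∑-*ʳ Vs (h (i , a)) (coloured X i a)))) ⟩
      ∑ As (λ a → ∑ is (λ i → ∑ Vs (λ v → coloured X i a v * h (i , a))))
        ≈⟨ ∑-cong As (λ a → ∑-swap is Vs (λ i v → coloured X i a v * h (i , a))) ⟩
      ∑ As (λ a → ∑ Vs (λ v → ∑ is (λ i → coloured X i a v * h (i , a))))
        ≈⟨ ∑-cong As (λ a → ∑-cong Vs (λ v → trans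
            (∑-single (Unique.allFin⁺ 3) (∈-allFin (c v)) (off a v))
            (*-congʳ (coloured-own X a v)))) ⟩
      ∑ As (λ a → ∑ Vs (λ v → X (a Vec.++ v) * h (c v , a))) ∎
      where
      open ≈-Reasoning
      is = List.allFin 3
      off : ∀ a v i → i ≢ c v → coloured X i a v * h (i , a) ≈ 0#
      off a v i i≢ = trans (*-congʳ (reflexive
          (≡.cong (if_then X (a Vec.++ v) else 0#)
          (dec-false (c v Fin.≟ i) (i≢ ∘ ≡.sym))))) (zeroˡ _)

    coordinates-++ˡ : ∀ (a : Vertex 3) (v : Vertex n) j →
        coordinates (a Vec.++ v) (j Fin.↑ˡ n) ≡ coordinates a j
    coordinates-++ˡ a v j = ≡.cong (if_then 1# else 0#) (Vec.lookup-++ˡ a v j)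

    coordinates-++ʳ : ∀ (a : Vertex 3) (v : Vertex n) j →
        coordinates (a Vec.++ v) (3 Fin.↑ʳ j) ≡ coordinates v j
    coordinates-++ʳ a v j = ≡.cong (if_then 1# else 0#) (Vec.lookup-++ʳ a v j)

    module _ {facets G} (J : Join facets G) {X : Vertex (3 ℕ.+ n) → Carrier}
        (support : ∀ u → u ∉ G → X u ≈ 0#) where
      open Join J

      X-outside : ∀ {a v} → (a , v) ∉ path (c v) → X (a Vec.++ v) ≈ 0#
      X-outside {a} {v} av∉ = support _ (av∉ ∘ ∈-facet J a v)

      marginal-support : ∀ v → v ∉ F → marginal X v ≈ 0#
      marginal-support v v∉F = ∑-zero As (λ {a} _ →
          X-outside (λ av∈ → v∉F (proj₁ (proj₂ (∈-path J (c v) av∈)))))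

      mixedMarginal-support : ∀ u → u ∉ labels τ → mixedMarginal X u ≈ 0#
      mixedMarginal-support (i , a) u∉ = ∑-zero Vs (λ {v} _ → null v)
        where
        null : ∀ v → coloured X i a v ≈ 0#
        null v with c v Fin.≟ i
        ... | no _       = refl
        ... | yes ≡.refl = X-outside (λ av∈ → u∉ (proj₁ (∈-path J (c v) av∈)))

      positive⇒∈ : ∀ {i a v} → 0# < coloured X i a v → (a , v) ∈ path i
      positive⇒∈ {i} {a} {v} 0<X with c v Fin.≟ i
      ... | no _       = contradiction 0<X (<-irrefl refl)
      ... | yes ≡.refl with (a Vec.++ v) ∈? G
      ...   | yes av∈G = ∈-facet J a v av∈G
      ...   | no av∉G  = contradiction 0<X (<-irrefl (sym (support _ av∉G)))

      coloured-noncrossing : ∀ i → NonCrossing rank rank rank-injective rank-injective As Vs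
          (coloured X i)
      coloured-noncrossing i 0<X 0<X′ = Below⇒noncrossing rank rank (path-Below J i)
          (positive⇒∈ 0<X) (positive⇒∈ 0<X′)

    module _ {facets : List (List (Vertex n))} (C : IsComplex facets) where
      open IsComplex

      -- The marginal on Iⁿ is determined by the given complex. It fixes the weight of each colour
      -- and so, with the first three coordinates, all moments of the marginal on I³ × Δ²;
      -- regularity determines that marginal. Both together give the row and column sums of three
      -- noncrossing matrices.
      product-separated : ∀ {G G′} → Join facets G → Join facets G′ → ∀ X X′ →
        (∀ u → 0# ≤ X u) → (∀ u → 0# ≤ X′ u) →
        (∀ u → u ∉ G → X u ≈ 0#) → (∀ u → u ∉ G′ → X′ u ≈ 0#) →
        ∑ (cubeVertices (3 ℕ.+ n)) X ≈ ∑ (cubeVertices (3 ℕ.+ n)) X′ →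
        (∀ j → ∑ (cubeVertices (3 ℕ.+ n)) (λ u → X u * coordinates u j)
            ≈ ∑ (cubeVertices (3 ℕ.+ n)) (λ u → X′ u * coordinates u j)) →
        ∀ u → X u ≈ X′ u
      product-separated {G} {G′} J J′ X X′ 0≤X 0≤X′ support support′ total moment = equal
        where
        marginals : ∀ v → marginal X v ≈ marginal X′ v
        marginals = separated C (Join.F∈ J) (Join.F∈ J′) (marginal X) (marginal X′)
          (λ v → ∑-nonneg As (λ _ → 0≤X _)) (λ v → ∑-nonneg As (λ _ → 0≤X′ _))
          (marginal-support J support) (marginal-support J′ support′)
          (trans (total-marginal X) (trans total (sym (total-marginal X′))))
          (λ j → trans (moment-marginal X j) (trans (moment (3 Fin.↑ʳ j))
              (sym (moment-marginal X′ j))))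
          where
          total-marginal : ∀ X → ∑ Vs (marginal X) ≈ ∑ (cubeVertices (3 ℕ.+ n)) X
          total-marginal X = trans (∑-swap Vs As _) (sym (∑-joined X))
          moment-marginal : ∀ X j → ∑ Vs (λ v → marginal X v * coordinates v j)
              ≈ ∑ (cubeVertices (3 ℕ.+ n)) (λ u → X u * coordinates u (3 Fin.↑ʳ j))
          moment-marginal X j = trans (∑-marginal X (λ v → coordinates v j)) (trans
            (∑-cong As (λ a → ∑-cong Vs (λ v →
                *-congˡ {X (a Vec.++ v)} (reflexive (≡.sym (coordinates-++ʳ a v j))))))
            (sym (∑-joined (λ u → X u * coordinates u (3 Fin.↑ʳ j)))))

        cubeMoment : ∀ X k → ∑ allLabels (λ u →
            mixedMarginal X u * fromℤ (lookup (labelPoint u) (k Fin.↑ˡ 3)))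
                           ≈ ∑ (cubeVertices (3 ℕ.+ n)) (λ u → X u * coordinates u (k Fin.↑ˡ n))
        cubeMoment X k = trans (∑-mixedMarginal X
            (λ u → fromℤ (lookup (labelPoint u) (k Fin.↑ˡ 3)))) (trans
          (∑-cong As (λ a → ∑-cong Vs (λ v → *-congˡ {X (a Vec.++ v)}
              (trans (labelPoint-coordinate k (c v) a)
              (reflexive (≡.sym (coordinates-++ˡ a v k)))))))
          (sym (∑-joined (λ u → X u * coordinates u (k Fin.↑ˡ n)))))

        triangleMoment : ∀ X i → ∑ allLabels (λ u →
            mixedMarginal X u * fromℤ (lookup (labelPoint u) (3 Fin.↑ʳ i)))
                               ≈ ∑ Vs (λ v → marginal X v * fromℤ (lookup (basis (c v)) i))
        triangleMoment X i = trans (∑-mixedMarginal X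
            (λ u → fromℤ (lookup (labelPoint u) (3 Fin.↑ʳ i)))) (trans
          (∑-cong As (λ a → ∑-cong Vs (λ v → *-congˡ {X (a Vec.++ v)}
              (reflexive (≡.cong fromℤ (Vec.lookup-++ʳ (Vec.map bit a) (basis (c v)) i))))))
          (sym (∑-marginal X (λ v → fromℤ (lookup (basis (c v)) i)))))

        sameMoments : SameMoments (mixedMarginal X) (mixedMarginal X′)
        sameMoments 0F = trans (cubeMoment X 0F) (trans (moment 0F) (sym (cubeMoment X′ 0F)))
        sameMoments 1F = trans (cubeMoment X 1F) (trans (moment 1F) (sym (cubeMoment X′ 1F)))
        sameMoments 2F = trans (cubeMoment X 2F) (trans (moment 2F) (sym (cubeMoment X′ 2F)))
        sameMoments (suc (suc (suc i))) = trans (triangleMoment X i)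
            (trans (∑-cong Vs (λ v → *-congʳ (marginals v))) (sym (triangleMoment X′ i)))

        mixedMarginals : ∀ u → mixedMarginal X u ≈ mixedMarginal X′ u
        mixedMarginals = mixed-unique (Join.τ∈ J) (Join.τ∈ J′)
          (λ (i , a) → ∑-nonneg Vs (λ {v} _ → coloured-nonneg 0≤X i a v))
              (λ (i , a) → ∑-nonneg Vs (λ {v} _ → coloured-nonneg 0≤X′ i a v))
          (mixedMarginal-support J support) (mixedMarginal-support J′ support′) sameMoments

        columns : ∀ i v → ∑ As (λ a → coloured X i a v) ≈ ∑ As (λ a → coloured X′ i a v)
        columns i v with does (c v Fin.≟ i)
        ... | true  = marginals v
        ... | false = refl

        colouredEqual : ∀ i a v → coloured X i a v ≈ coloured X′ i a v
        colouredEqual i = noncrossing-unique rank rank rank-injective rank-injective As Vs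
            (coloured X i) (coloured X′ i)
          (coloured-nonneg 0≤X i) (coloured-nonneg 0≤X′ i)
          (coloured-noncrossing J support i) (coloured-noncrossing J′ support′ i)
          (λ a → mixedMarginals (i , a)) (columns i) ∈-corners ∈-cubeVertices

        equal : ∀ u → X u ≈ X′ u
        equal (a₀ ∷ a₁ ∷ a₂ ∷ v) = trans (sym (coloured-own X a v))
            (trans (colouredEqual (c v) a v) (coloured-own X′ a v))
          where a = a₀ ∷ a₁ ∷ a₂ ∷ []

-- Covering of the cube by the product

module ProductComplexes {ℓ} (ℝ : CompleteOrderedField ℓ) where
  open CompleteOrderedField ℝ hiding (zero)
  open Reals ℝ
  open MixedCells ℝ
  open NorthWest ℝ
  open Complexes ℝ
  open CubeTriangulations ℝ
  open Products ℝ

  transport : ∀ {A B : Set} (as : List (A × Carrier)) (bs : List (B × Carrier)) →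
    (∀ {e} → e ∈ as → 0# ≤ proj₂ e) → (∀ {e} → e ∈ bs → 0# ≤ proj₂ e) →
    0 ℕ.< length as → 0 ℕ.< length bs ⊎ length as ≡ 1 → ∑ as proj₂ ≈ ∑ bs proj₂ → Transport as bs
  transport []             bs 0≤as 0≤bs () _ _
  transport ((a , α) ∷ as) bs 0≤as 0≤bs _ enough total =
    northWest a α as bs (0≤as (here ≡.refl)) (0≤as ∘ there) 0≤bs
        ([ inj₁ , (λ eq → inj₂ (empty as eq)) ]′ enough) total
    where
    empty : ∀ {A : Set ℓ} (xs : List A) → suc (length xs) ≡ 1 → xs ≡ []
    empty [] _ = ≡.refl

  module _ {n : ℕ} (c : Vertex n → Fin 3) {facets : List (List (Vertex n))}
      (C : IsComplex facets) where
    open Colouring (_≟ᵛ_ {n})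
    open Joins c
    open IsComplex

    ∑-classes : ∀ vs f → ∑ (colourClass c 0F vs) f
        + (∑ (colourClass c 1F vs) f + ∑ (colourClass c 2F vs) f) ≈ ∑ vs f
    ∑-classes []       f = trans (+-identityˡ _) (+-identityˡ _)
    ∑-classes (v ∷ vs) f with c v
    ... | 0F = trans (+-assoc _ _ _) (+-congˡ (∑-classes vs f))
    ... | 1F = trans (+-congˡ (+-assoc _ _ _)) (trans (x+yz≈y+xz _ _ _) (+-congˡ (∑-classes vs f)))
    ... | 2F = trans (+-congˡ (x+yz≈y+xz _ _ _))
        (trans (x+yz≈y+xz _ _ _) (+-congˡ (∑-classes vs f)))

    module _ {x : Point (3 ℕ.+ n)} (x∈ : Cube (3 ℕ.+ n) x) {F} (F∈ : F ∈ facets)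
             {Λ} (bary : Barycentric F Λ (λ j → x (3 Fin.↑ʳ j))) where
      open Barycentric bary

      classSum : (Vertex n → Carrier) → Fin 3 → Carrier
      classSum f i = ∑ (class i F) f

      ∑-class : ∀ (h : Vertex n → Carrier) → classSum (λ v → Λ v * h v) 0F
          + (classSum (λ v → Λ v * h v) 1F + classSum (λ v → Λ v * h v) 2F)
                    ≈ ∑ (cubeVertices n) (λ v → Λ v * h v)
      ∑-class h = trans (∑-classes (arrange F) _) (trans (∑-↭ _ (arrange-↭ (unique C F∈)))
        (sym (∑-supported (unique C F∈) (λ v v∉ → trans (*-congʳ (support v v∉)) (zeroˡ _)))))

      -- The barycentric coordinates of the image of x in Δ².
      μ : Fin 3 → Carrier
      μ = classSum Λ

      μ-total : μ 0F + (μ 1F + μ 2F) ≈ 1#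
      μ-total = trans (+-cong (one 0F) (+-cong (one 1F) (one 2F))) (trans (∑-class (λ _ → 1#))
        (trans (∑-cong (cubeVertices n) (λ v → *-identityʳ _)) total))
        where
        one : ∀ i → μ i ≈ classSum (λ v → Λ v * 1#) i
        one i = ∑-cong (class i F) (λ v → sym (*-identityʳ _))

      present : Fin 3 → Bool
      present i = nonempty (class i F)

      palette : Palette
      palette = Vec.tabulate present

      palette-vanish : ∀ i → lookup palette i ≡ false → μ i ≈ 0#
      palette-vanish i eq = empty (class i F) (≡.trans (≡.sym (Vec.lookup∘tabulate present i)) eq)
        where
        empty : ∀ vs → nonempty vs ≡ false → ∑ vs Λ ≈ 0#
        empty [] _ = refl

      palette-nonempty : Nonempty palette
      palette-nonempty = let v , v∈ = element F (facetSize C F∈) in c v , ≡.trans (Vec.lookup∘tabulate present (c v))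
        (∈⇒nonempty (∈-filter⁺ (λ u → c u Fin.≟ c v)
            (∈-filter⁺ (_∈? F) (∈-cubeVertices v) v∈) ≡.refl))
        where
        element : ∀ {k} (vs : List (Vertex n)) → length vs ≡ suc k → ∃[ v ] v ∈ vs
        element (v ∷ _) _ = v , here ≡.refl

      classWeights : Fin 3 → List (Vertex n × Carrier)
      classWeights i = List.map (λ v → v , Λ v) (class i F)

      classWeights-class : ∀ i → List.map proj₁ (classWeights i) ≡ class i F
      classWeights-class i = ≡.trans (≡.sym (List.map-∘ (class i F))) (List.map-id (class i F))

      module _ {τ} (τ∈ : τ ∈ mixedCells) (full : Full palette τ)
          (ws : Fin 3 → List (Vertex 3 × Carrier))
               (fibres : ∀ i → List.map proj₁ (ws i) ≡ fibre i τ)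
                   (0≤ws : ∀ i {e} → e ∈ ws i → 0# ≤ proj₂ e)
               (totals : ∀ i → ∑ (ws i) proj₂ ≈ μ i)
               (moments : ∀ k → ∑ (ws 0F) (λ (a , w) → w * coordinates a k)
                 + (∑ (ws 1F) (λ (a , w) → w * coordinates a k)
                     + ∑ (ws 2F) (λ (a , w) → w * coordinates a k)) ≈ x (k Fin.↑ˡ n)) where

        -- A colour class may be empty; then `full` leaves a single vertex in the fibre, the one
        -- case in which `northWest` accepts an empty list.
        enough : ∀ i → 0 ℕ.< length (classWeights i) ⊎ length (ws i) ≡ 1
        enough i with All.lookup full (∈-allFin i)
        ... | inj₁ isPresent = inj₁ (≡.subst (0 ℕ.<_) (≡.sym (List.length-map _ (class i F)))
          (positive (class i F) (≡.trans (≡.sym (Vec.lookup∘tabulate present i)) isPresent)))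
          where
          positive : ∀ (vs : List (Vertex n)) → nonempty vs ≡ true → 0 ℕ.< length vs
          positive (_ ∷ _) _ = ℕ.s≤s ℕ.z≤n
        ... | inj₂ single = inj₂ (≡.trans (≡.sym (List.length-map proj₁ (ws i)))
            (≡.trans (≡.cong length (fibres i)) single))

        T : ∀ i → Transport (ws i) (classWeights i)
        T i = transport (ws i) (classWeights i) (0≤ws i)
          (λ e∈ → let v , _ , eq = ∈-map⁻ _ e∈ in ≡.subst (λ e → 0# ≤ proj₂ e) (≡.sym eq) (nonneg v))
          (≡.subst (0 ℕ.<_) (≡.trans (≡.cong length (≡.sym (fibres i)))
              (List.length-map proj₁ (ws i)))
            (All.lookup (WellFormed.occupied (All.lookup cellsWellFormed τ∈)) (∈-allFin i)))
          (enough i) (trans (totals i) (sym (∑-map _ (class i F) proj₂)))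

        plan : Fin 3 → List (Pair × Carrier)
        plan i = Transport.plan (T i)

        path : Fin 3 → List Pair
        path i = List.map proj₁ (plan i)

        path∈ : ∀ i → path i ∈ paths F τ i
        path∈ i = ≡.subst₂ (λ as bs → path i ∈ staircases as bs) (fibres i) (classWeights-class i)
            (Transport.staircase (T i))

        plans : List (Pair × Carrier)
        plans = plan 0F ++ (plan 1F ++ plan 2F)

        G : List (Vertex (3 ℕ.+ n))
        G = List.map join (path 0F ++ (path 1F ++ path 2F))

        joined : List (Vertex (3 ℕ.+ n) × Carrier)
        joined = List.map (λ (p , w) → join p , w) plans

        X : Vertex (3 ℕ.+ n) → Carrier
        X = mass joined

        plans-nonneg : ∀ {e} → e ∈ plans → 0# ≤ proj₂ e
        plans-nonneg e∈ with ∈-++⁻ (plan 0F) e∈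
        ... | inj₁ ∈₀ = Transport.nonneg (T 0F) ∈₀
        ... | inj₂ ∈₁₂ = [ Transport.nonneg (T 1F) ,
            Transport.nonneg (T 2F) ]′ (∈-++⁻ (plan 1F) ∈₁₂)

        joined-nonneg : ∀ {e} → e ∈ joined → 0# ≤ proj₂ e
        joined-nonneg e∈ = let e , f∈ , eq = ∈-map⁻ _ e∈ in ≡.subst (λ e → 0# ≤ proj₂ e) (≡.sym eq) (plans-nonneg f∈)

        plans-path : List.map proj₁ plans ≡ path 0F ++ (path 1F ++ path 2F)
        plans-path = ≡.trans (List.map-++ proj₁ (plan 0F) _)
            (≡.cong (path 0F ++_) (List.map-++ proj₁ (plan 1F) _))

        joined-G : ∀ {u w} → (u , w) ∈ joined → u ∈ G
        joined-G uw∈ with (p , w) , pw∈ , eq ← ∈-map⁻ _ uw∈ =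
          ≡.subst₂ (λ u ps → u ∈ List.map join ps) (≡.cong proj₁ (≡.sym eq)) plans-path
              (∈-map⁺ join (∈-map⁺ proj₁ pw∈))

        ∑-plans : ∀ (H : Vertex (3 ℕ.+ n) → Carrier) → ∑ (cubeVertices (3 ℕ.+ n)) (λ u → X u * H u)
          ≈ ∑ (plan 0F) (λ (p , w) → w * H (join p))
              + (∑ (plan 1F) (λ (p , w) → w * H (join p))
              + ∑ (plan 2F) (λ (p , w) → w * H (join p)))
        ∑-plans H = trans (∑-mass {ws = joined} H) (trans (∑-map _ plans (λ (u , w) → w * H u))
          (trans (∑-++ (plan 0F) _ _) (+-congˡ (∑-++ (plan 1F) _ _))))

        momentˡ : ∀ (H : Vertex (3 ℕ.+ n) → Carrier) (g : Vertex 3 → Carrier) →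
            (∀ a v → H (a Vec.++ v) ≈ g a) → ∑ (cubeVertices (3 ℕ.+ n)) (λ u → X u * H u)
          ≈ ∑ (ws 0F) (λ (a , w) → w * g a) + (∑ (ws 1F) (λ (a , w) → w * g a)
              + ∑ (ws 2F) (λ (a , w) → w * g a))
        momentˡ H g eq = trans (∑-plans H) (+-cong (part 0F) (+-cong (part 1F) (part 2F)))
          where
          part : ∀ i → ∑ (plan i) (λ (p , w) → w * H (join p)) ≈ ∑ (ws i) (λ (a , w) → w * g a)
          part i = trans (∑-cong (plan i) (λ ((a , v) , w) → *-congˡ (eq a v)))
              (Transport.marginalˡ (T i) g)

        momentʳ : ∀ (H : Vertex (3 ℕ.+ n) → Carrier) (h : Vertex n → Carrier) →
            (∀ a v → H (a Vec.++ v) ≈ h v) →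
          ∑ (cubeVertices (3 ℕ.+ n)) (λ u → X u * H u) ≈ ∑ (cubeVertices n) (λ v → Λ v * h v)
        momentʳ H h eq = trans (∑-plans H) (trans (+-cong (part 0F) (+-cong (part 1F) (part 2F)))
            (∑-class h))
          where
          part : ∀ i → ∑ (plan i) (λ (p , w) → w * H (join p)) ≈ classSum (λ v → Λ v * h v) i
          part i = trans (∑-cong (plan i) (λ ((a , v) , w) → *-congˡ (eq a v)))
            (trans (Transport.marginalʳ (T i) h) (∑-map _ (class i F) (λ (v , w) → w * h v)))

        coordinateˡ : ∀ k → ∑ (cubeVertices (3 ℕ.+ n)) (λ u → X u * coordinates u (k Fin.↑ˡ n))
            ≈ x (k Fin.↑ˡ n)
        coordinateˡ k = trans (momentˡ (λ u → coordinates u (k Fin.↑ˡ n)) (λ a → coordinates a k)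
            (λ a v → reflexive (coordinates-++ˡ c a v k))) (moments k)

        coordinateʳ : ∀ j → ∑ (cubeVertices (3 ℕ.+ n)) (λ u → X u * coordinates u (3 Fin.↑ʳ j))
            ≈ x (3 Fin.↑ʳ j)
        coordinateʳ j = trans (momentʳ (λ u → coordinates u (3 Fin.↑ʳ j)) (λ v → coordinates v j)
            (λ a v → reflexive (coordinates-++ʳ c a v j))) (moment j)

        joined-Barycentric : Barycentric G X x
        joined-Barycentric = record
          { nonneg  = mass-nonneg {ws = joined} joined-nonneg
          ; support = λ u u∉ → mass-support {ws = joined} (λ e∈ → contradiction (joined-G e∈) u∉)
          ; total   = trans (∑-cong (cubeVertices (3 ℕ.+ n)) (λ u → sym (*-identityʳ _)))
              (trans (momentʳ (λ _ → 1#) (λ _ → 1#) (λ _ _ → refl))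
                      (trans (∑-cong (cubeVertices n) (λ v → *-identityʳ _)) total))
          ; moment  = λ { 0F → coordinateˡ 0F ; 1F → coordinateˡ 1F ; 2F →
              coordinateˡ 2F ; (suc (suc (suc j))) → coordinateʳ j }
          }

        product-cover : ∃[ G ] G ∈ productFacets facets × ∃[ X ] Barycentric G X x
        product-cover = G , ∈-productFacets⁺ {facets} F∈ τ∈ path path∈ , X , joined-Barycentric

      -- The cell that contains the image of x in I³ × Δ² distributes μᵢ over its fibre i, and μᵢ is
      -- also the total of Λ on colour class i. Coupling the two along a staircase for each colour
      -- gives weights for x on a facet of the product.
      covered : ∃[ G ] G ∈ productFacets facets × ∃[ X ] Barycentric G X x
      covered =
        let τ , τ∈ , full , ws , fibres , 0≤ws , totals , moments =
              mixed-cover (λ k → x (k Fin.↑ˡ n)) μ (λ k → proj₁ (x∈ (k Fin.↑ˡ n)))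
                  (λ k → ≤-respʳ (sym μ-total) (proj₂ (x∈ (k Fin.↑ˡ n))))
                (λ i → ∑-nonneg (class i F) (λ {v} _ → nonneg v)) palette palette-vanish
                    palette-nonempty
        in product-cover τ∈ full ws fibres 0≤ws totals moments

    join-length : ∀ {G} → Join facets G → length G ≡ suc (3 ℕ.+ n)
    join-length J = facet-length J (unique C (Join.F∈ J)) (facetSize C (Join.F∈ J))

    productComplex : IsComplex (productFacets facets)
    productComplex = record
      { unique    = λ G∈ → facet-unique (∈-productFacets⁻ {facets} G∈)
      ; facetSize = λ G∈ → join-length (∈-productFacets⁻ {facets} G∈)
      ; cover     = λ x x∈ → let F , F∈ , Λ , bary = cover C (λ j → x (3 Fin.↑ʳ j)) (λ j → x∈ (3 Fin.↑ʳ j)) in covered x∈ F∈ bary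
      ; separated = λ G∈ G′∈ → product-separated c C (∈-productFacets⁻ {facets} G∈)
          (∈-productFacets⁻ {facets} G′∈)
      }

-- Asymptotics

filterᵇ-does : ∀ {A : Set} {P : A → Set} (P? : ∀ x → Dec (P x)) xs →
    filterᵇ (λ x → does (P? x)) xs ≡ List.filter P? xs
filterᵇ-does P? []       = ≡.refl
filterᵇ-does P? (x ∷ xs) with does (P? x)
... | true  = ≡.cong (x ∷_) (filterᵇ-does P? xs)
... | false = filterᵇ-does P? xs

-- The construction raises the dimension by three. Since the limit is assumed to exist, it may be
-- computed along the subsequence 3 (j + 1).
dimension : ℕ → ℕ
dimension zero    = 3
dimension (suc j) = 3 ℕ.+ dimension j

dimension≡ : ∀ j → dimension j ≡ 3 ℕ.* suc j
dimension≡ zero    = ≡.refl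
dimension≡ (suc j) = ≡.trans (≡.cong (3 ℕ.+_) (dimension≡ j)) (≡.sym (ℕ.*-suc 3 (suc j)))

-- With Dᵢ = 3 (i + 1), this is 8 times the product of ((Dᵢ + 6) / Dᵢ)³ over i < j, which telescopes
-- because (Dᵢ + 6) / Dᵢ = (i + 3) / (i + 1).
growthFactor : ℕ → ℕ
growthFactor j = (suc j ℕ.* suc (suc j)) ℕ.^ 3

growth : ∀ (f : ℕ → ℕ) → (∀ j → 81 ℕ.* f (suc j) ℕ.≤ 44
    ℕ.* (f j ℕ.* (suc (dimension j) ℕ.+ 5) ℕ.^ 3)) →
  ∀ j → f j ℕ.* 81 ℕ.^ j ℕ.≤ f 0 ℕ.* (44 ℕ.^ j ℕ.* (growthFactor j ℕ.* dimension j !))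
growth f step zero    = ℕ.*-monoʳ-≤ (f 0) (ℕ.s≤s ℕ.z≤n)
growth f step (suc j) = begin
  f (suc j) ℕ.* (81 ℕ.* 81 ℕ.^ j)
    ≡⟨ rearrange₁ (f (suc j)) (81 ℕ.^ j) ⟩
  81 ℕ.* f (suc j) ℕ.* 81 ℕ.^ j
    ≤⟨ ℕ.*-monoˡ-≤ (81 ℕ.^ j) (step j) ⟩
  44 ℕ.* (f j ℕ.* (suc D ℕ.+ 5) ℕ.^ 3) ℕ.* 81 ℕ.^ j
    ≡⟨ rearrange₂ (f j) ((suc D ℕ.+ 5) ℕ.^ 3) (81 ℕ.^ j) ⟩
  44 ℕ.* (suc D ℕ.+ 5) ℕ.^ 3 ℕ.* (f j ℕ.* 81 ℕ.^ j)
    ≤⟨ ℕ.*-monoʳ-≤ (44 ℕ.* (suc D ℕ.+ 5) ℕ.^ 3) (growth f step j) ⟩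
  44 ℕ.* (suc D ℕ.+ 5) ℕ.^ 3 ℕ.* (f 0 ℕ.* (44 ℕ.^ j ℕ.* (growthFactor j ℕ.* D !)))
    ≡⟨ ≡.cong (λ d → 44 ℕ.* (suc d ℕ.+ 5) ℕ.^ 3
        ℕ.* (f 0 ℕ.* (44 ℕ.^ j ℕ.* (growthFactor j ℕ.* D !)))) (dimension≡ j) ⟩
  44 ℕ.* (suc (3 ℕ.* suc j) ℕ.+ 5) ℕ.^ 3 ℕ.* (f 0 ℕ.* (44 ℕ.^ j ℕ.* (growthFactor j ℕ.* D !)))
    -- The telescoping: `growthFactor j` times (3 (j + 3))³ is `growthFactor (suc j)` times (3 (j +
    -- 1))³. The last cube is D³, at most (D + 1) (D + 2) (D + 3).
    ≡⟨ rearrange₃ j (f 0) (44 ℕ.^ j) (D !) ⟩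
  f 0 ℕ.* (44 ℕ.* 44 ℕ.^ j ℕ.* (growthFactor (suc j)
      ℕ.* (3 ℕ.* suc j ℕ.* (3 ℕ.* suc j ℕ.* (3 ℕ.* suc j ℕ.* D !)))))
    ≡⟨ ≡.cong (λ d → f 0 ℕ.* (44 ℕ.* 44 ℕ.^ j
        ℕ.* (growthFactor (suc j) ℕ.* (d ℕ.* (d ℕ.* (d ℕ.* D !)))))) (≡.sym (dimension≡ j)) ⟩
  f 0 ℕ.* (44 ℕ.* 44 ℕ.^ j ℕ.* (growthFactor (suc j) ℕ.* (D ℕ.* (D ℕ.* (D ℕ.* D !)))))
    ≤⟨ ℕ.*-monoʳ-≤ (f 0) (ℕ.*-monoʳ-≤ (44 ℕ.* 44 ℕ.^ j) (ℕ.*-monoʳ-≤ (growthFactor (suc j))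
         (ℕ.*-mono-≤ (ℕ.m≤n+m D 3) (ℕ.*-mono-≤ (ℕ.m≤n+m D 2) (ℕ.*-monoˡ-≤ (D !) (ℕ.m≤n+m D 1)))))) ⟩
  f 0 ℕ.* (44 ℕ.* 44 ℕ.^ j ℕ.* (growthFactor (suc j) ℕ.* dimension (suc j) !)) ∎
  where
  open ℕ.≤-Reasoning
  D = dimension j
  rearrange₁ : ∀ x y → x ℕ.* (81 ℕ.* y) ≡ 81 ℕ.* x ℕ.* y
  rearrange₁ = solve-∀
  rearrange₂ : ∀ x y z → 44 ℕ.* (x ℕ.* y) ℕ.* z ≡ 44 ℕ.* y ℕ.* (x ℕ.* z)
  rearrange₂ = solve-∀
  rearrange₃ : ∀ j x y z →
    44 ℕ.* ((suc (3 ℕ.* suc j) ℕ.+ 5) ℕ.* ((suc (3 ℕ.* suc j) ℕ.+ 5)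
        ℕ.* ((suc (3 ℕ.* suc j) ℕ.+ 5) ℕ.* 1)))
      ℕ.* (x ℕ.* (y ℕ.* (suc j ℕ.* suc (suc j)
          ℕ.* (suc j ℕ.* suc (suc j) ℕ.* (suc j ℕ.* suc (suc j) ℕ.* 1)) ℕ.* z)))
    ≡ x ℕ.* (44 ℕ.* y ℕ.* (suc (suc j) ℕ.* suc (suc (suc j))
        ℕ.* (suc (suc j) ℕ.* suc (suc (suc j)) ℕ.* (suc (suc j) ℕ.* suc (suc (suc j)) ℕ.* 1))
        ℕ.* (3 ℕ.* suc j ℕ.* (3 ℕ.* suc j ℕ.* (3 ℕ.* suc j ℕ.* z)))))
  rearrange₃ = solve-∀

module Asymptotics {ℓ} (ℝ : CompleteOrderedField ℓ) where
  open CompleteOrderedField ℝ hiding (zero)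
  open Complexes ℝ
  open TriangulationsAndComplexes ℝ using (vertexList)
  open Conversions ℝ
  open ProductComplexes ℝ
  open CubeTriangulations ℝ

  -- The ratio 88 / 162 from the colouring is 44 / 81, the cube of the claimed bound.
  efficientProduct : ∀ {n} (T : Triangulation n) →
    ∃[ T′ ] 81 ℕ.* size {3 ℕ.+ n} T′ ℕ.≤ 44 ℕ.* (size T ℕ.* (suc n ℕ.+ 5) ℕ.^ 3)
  efficientProduct {n} T = T′ , ℕ.*-cancelˡ-≤ 2 (begin
    2 ℕ.* (81 ℕ.* size T′)
      ≡⟨ ≡.sym (ℕ.*-assoc 2 81 (size T′)) ⟩
    162 ℕ.* size T′
      ≤⟨ ℕ.*-monoʳ-≤ 162 (proj₂ triangulation) ⟩
    162 ℕ.* length (productFacets facets)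
      ≡⟨ ≡.cong (162 ℕ.*_) (≡.trans (length-productFacets facets)
          (≡.cong sumℕ (≡.trans (List.map-cong
          (λ F → ≡.cong (totalCount cellShapes ∘ classCounts c)
          (≡.sym (filterᵇ-does (_∈? F) (cubeVertices n)))) facets) (List.map-∘ facets)))) ⟩
    162 ℕ.* sumℕ (List.map (λ S → totalCount cellShapes
        (classCounts c (filterᵇ S (cubeVertices n)))) Ss)
      ≤⟨ proj₂ colouring ⟩
    length Ss ℕ.* (88 ℕ.* (suc n ℕ.+ 5) ℕ.^ 3)
      ≡⟨ ≡.cong (ℕ._* (88 ℕ.* (suc n ℕ.+ 5) ℕ.^ 3))
          (≡.trans (List.length-map _ facets) (List.length-map vertexList (simplices T))) ⟩
    size T ℕ.* (88 ℕ.* (suc n ℕ.+ 5) ℕ.^ 3)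
      ≡⟨ rearrange (size T) ((suc n ℕ.+ 5) ℕ.^ 3) ⟩
    2 ℕ.* (44 ℕ.* (size T ℕ.* (suc n ℕ.+ 5) ℕ.^ 3)) ∎)
    where
    open ℕ.≤-Reasoning
    open Colouring (_≟ᵛ_ {n})
    facets = List.map vertexList (simplices T)
    C : IsComplex facets
    C = fromTriangulation T
    Ss : List (Vertex n → Bool)
    Ss = List.map (λ F v → does (v ∈? F)) facets
    colouring = balancedColouring cellsPotential (cubeVertices n) (cubeVertices-unique n) (suc n) Ss
      (All.map⁺ (All.tabulate (λ {F} F∈ → ≡.trans
          (≡.cong length (filterᵇ-does (_∈? F) (cubeVertices n)))
          (≡.trans (↭-length (arrange-↭ (IsComplex.unique C F∈))) (IsComplex.facetSize C F∈)))))
    c = proj₁ colouring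
    open Joins c
    triangulation = toTriangulation (productComplex c C)
    T′ = proj₁ triangulation
    rearrange : ∀ x y → x ℕ.* (88 ℕ.* y) ≡ 2 ℕ.* (44 ℕ.* (x ℕ.* y))
    rearrange = solve-∀

-- Along j = 7 (k + 1) the loss is at most a polynomial of degree 6; the multiples of 7 come from
-- `exponential-outgrows`.
growthFactor-bound : ∀ k → growthFactor (7 ℕ.* suc k) ℕ.≤ 9 ℕ.^ 6 ℕ.* suc k ℕ.^ 6
growthFactor-bound k = ℕ.≤-trans (ℕ.^-monoˡ-≤ 3 (ℕ.*-mono-≤ le₁ le₂))
    (ℕ.≤-reflexive (identity 9 (suc k)))
  where
  le₁ : suc (7 ℕ.* suc k) ℕ.≤ 9 ℕ.* suc k
  le₁ = ℕ.≤-trans (ℕ.m≤m+n _ (2 ℕ.* k ℕ.+ 1)) (ℕ.≤-reflexive (eq k))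
    where
    eq : ∀ k → suc (7 ℕ.* suc k) ℕ.+ (2 ℕ.* k ℕ.+ 1) ≡ 9 ℕ.* suc k
    eq = solve-∀
  le₂ : suc (suc (7 ℕ.* suc k)) ℕ.≤ 9 ℕ.* suc k
  le₂ = ℕ.≤-trans (ℕ.m≤m+n _ (2 ℕ.* k)) (ℕ.≤-reflexive (eq k))
    where
    eq : ∀ k → suc (suc (7 ℕ.* suc k)) ℕ.+ 2 ℕ.* k ≡ 9 ℕ.* suc k
    eq = solve-∀
  identity : ∀ a m → a ℕ.* m ℕ.* (a ℕ.* m) ℕ.* (a ℕ.* m ℕ.* (a ℕ.* m)
      ℕ.* (a ℕ.* m ℕ.* (a ℕ.* m) ℕ.* 1))
    ≡ a ℕ.* (a ℕ.* (a ℕ.* (a ℕ.* (a ℕ.* (a ℕ.* 1)))))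
        ℕ.* (m ℕ.* (m ℕ.* (m ℕ.* (m ℕ.* (m ℕ.* (m ℕ.* 1))))))
  identity = solve-∀

-- Powers, unboundedness and the exponential estimate

module Limits {ℓ} (ℝ : CompleteOrderedField ℓ) where
  open CompleteOrderedField ℝ hiding (zero)
  open Reals ℝ
  open Forms ℝ
  open SemiringExp semiring using (^-assocʳ; ^-congˡ; ^-congʳ)
  open CommutativeSemiringExp commutativeSemiring using (^-distrib-*)
  open CommutativeSemigroupProperties *-commutativeSemigroup using ()
    renaming (x∙yz≈y∙xz to x*yz≈y*xz)

  fromℕ-^ : ∀ m n → fromℕ (m ℕ.^ n) ≈ fromℕ m ^ n
  fromℕ-^ m zero    = +-identityʳ 1#
  fromℕ-^ m (suc n) = trans (fromℕ-* m (m ℕ.^ n)) (*-congˡ (fromℕ-^ m n))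

  fromℕ-mono-≤ : ∀ {m n} → m ℕ.≤ n → fromℕ m ≤ fromℕ n
  fromℕ-mono-≤ {n = n} ℕ.z≤n     = fromℕ-nonneg n
  fromℕ-mono-≤ (ℕ.s≤s m≤n) = +-monoʳ-≤ 1# (fromℕ-mono-≤ m≤n)

  fromℕ-pos : ∀ n → .{{ℕ.NonZero n}} → 0# < fromℕ n
  fromℕ-pos (suc n) = fromℕ-positive n

  ^-positive : ∀ {x} n → 0# < x → 0# < x ^ n
  ^-positive zero    0<x = 0<1
  ^-positive (suc n) 0<x = *-positive 0<x (^-positive n 0<x)

  ^-nonneg : ∀ {x} n → 0# ≤ x → 0# ≤ x ^ n
  ^-nonneg zero    0≤x = 0≤1
  ^-nonneg (suc n) 0≤x = *-nonneg 0≤x (^-nonneg n 0≤x)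

  ^-monoˡ-≤ : ∀ {x y} n → 0# ≤ x → x ≤ y → x ^ n ≤ y ^ n
  ^-monoˡ-≤ zero    0≤x x≤y = ≤-refl
  ^-monoˡ-≤ (suc n) 0≤x x≤y = *-mono-≤ 0≤x (^-nonneg n 0≤x) x≤y (^-monoˡ-≤ n 0≤x x≤y)

  module _ {δ} (0≤δ : 0# ≤ δ) where

    1≤1+δ : 1# ≤ 1# + δ
    1≤1+δ = ≤-respˡ (+-identityʳ 1#) (+-monoʳ-≤ 1# 0≤δ)

    1≤[1+δ]^n : ∀ n → 1# ≤ (1# + δ) ^ n
    1≤[1+δ]^n zero    = ≤-refl
    1≤[1+δ]^n (suc n) = ≤-respˡ (*-identityˡ 1#) (*-mono-≤ 0≤1 0≤1 1≤1+δ (1≤[1+δ]^n n))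

    ^-monoʳ-≤ : ∀ {m n} → m ℕ.≤ n → (1# + δ) ^ m ≤ (1# + δ) ^ n
    ^-monoʳ-≤ {n = n} ℕ.z≤n = 1≤[1+δ]^n n
    ^-monoʳ-≤ (ℕ.s≤s m≤n)   = *-monoˡ-≤ (≤-trans 0≤1 1≤1+δ) (^-monoʳ-≤ m≤n)

    bernoulli : ∀ n → fromℕ n * δ ≤ (1# + δ) ^ n
    bernoulli zero    = ≤-respˡ (sym (zeroˡ δ)) 0≤1
    bernoulli (suc n) = begin
      fromℕ (suc n) * δ               ≈⟨ distribʳ δ 1# (fromℕ n) ⟩
      1# * δ + fromℕ n * δ            ≤⟨ +-mono-≤ 1*δ≤δ*P (bernoulli n) ⟩
      δ * P + P                       ≈⟨ +-comm (δ * P) P ⟩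
      P + δ * P                       ≈⟨ +-congʳ (sym (*-identityˡ P)) ⟩
      1# * P + δ * P                  ≈⟨ sym (distribʳ P 1# δ) ⟩
      (1# + δ) ^ suc n                ∎
      where
      open ≤-Reasoning
      P = (1# + δ) ^ n
      1*δ≤δ*P : 1# * δ ≤ δ * P
      1*δ≤δ*P = ≤-respˡ (*-comm δ 1#) (*-monoˡ-≤ 0≤δ (1≤[1+δ]^n n))

  -- The Archimedean property from completeness: if the natural numbers had a supremum s, then s - 1
  -- would be an upper bound as well.
  fromℕ-unbounded : ∀ x → ¬ (∀ n → fromℕ n ≤ x)
  fromℕ-unbounded x bound with supremum (λ y → ∃[ n ] y ≈ fromℕ n) (0# , 0 , refl)
      (x , λ { y (n , eq) → ≤-respˡ (sym eq) (bound n) })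
  ... | s , upper , least = <⇒≱ s-1<s (least (s - 1#) λ { y (n , eq) → ≤-respˡ (sym eq) (below n) })
    where
    s-1<s : s - 1# < s
    s-1<s = <-respʳ-≈ (x-y+y≈x s 1#) (<-respˡ-≈ (+-identityʳ _) (+-monoʳ-< (s - 1#) 0<1))
    below : ∀ n → fromℕ n ≤ s - 1#
    below n = 0≤y-x⇒x≤y (≤-respʳ shift (x≤y⇒0≤y-x (upper (fromℕ (suc n)) (suc n , refl))))
      where
      shift : s - (1# + fromℕ n) ≈ (s - 1#) - fromℕ n
      shift = trans (+-congˡ (sym (-‿+-comm 1# (fromℕ n)))) (sym (+-assoc s (- 1#) (- fromℕ n)))

  -- The seventh power of `bernoulli` gives A δ⁷ (k + 1)⁷ ≤ B C (k + 1)⁶. The left side is one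
  -- degree higher, so the natural numbers would be bounded.
  exponential-outgrows : ∀ {A δ} → 0# < A → 0# < δ → ∀ B C N →
    ¬ (∀ k → N ℕ.≤ k → A * (1# + δ) ^ (7 ℕ.* suc k) ≤ fromℕ (B ℕ.* (C ℕ.* suc k ℕ.^ 6)))
  exponential-outgrows {A} {δ} 0<A 0<δ B C N bound =
      fromℕ-unbounded (a ⁻¹ * fromℕ (B ℕ.* C)) λ k → *-cancelˡ-≤ 0<a (begin
    a * fromℕ k
      ≤⟨ *-monoˡ-≤ (inj₁ 0<a) (fromℕ-mono-≤ (ℕ.≤-trans (ℕ.m≤m+n k N) (ℕ.n≤1+n (k ℕ.+ N)))) ⟩
    a * fromℕ (suc (k ℕ.+ N))
      ≤⟨ linear (k ℕ.+ N) (ℕ.m≤n+m N k) ⟩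
    fromℕ (B ℕ.* C)
      ≈⟨ sym (trans (sym (*-assoc a (a ⁻¹) _)) (trans (*-congʳ (*-inverse 0<a)) (*-identityˡ _))) ⟩
    a * (a ⁻¹ * fromℕ (B ℕ.* C)) ∎)
    where
    open ≤-Reasoning
    a = A * δ ^ 7
    0<a : 0# < a
    0<a = *-positive 0<A (^-positive 7 0<δ)
    linear : ∀ k → N ℕ.≤ k → a * fromℕ (suc k) ≤ fromℕ (B ℕ.* C)
    linear k N≤k = *-cancelˡ-≤ (^-positive 6 (fromℕ-positive k)) (begin
      m ^ 6 * (A * δ ^ 7 * m)
        ≈⟨ trans (sym (*-assoc _ _ _)) (trans (*-comm _ m)
            (trans (sym (*-assoc m (m ^ 6) _)) (x*yz≈y*xz (m ^ 7) A (δ ^ 7)))) ⟩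
      A * (m ^ 7 * δ ^ 7)
        ≈⟨ *-congˡ (sym (^-distrib-* m δ 7)) ⟩
      A * (m * δ) ^ 7
        ≤⟨ *-monoˡ-≤ (inj₁ 0<A) (^-monoˡ-≤ 7 (*-nonneg (fromℕ-nonneg (suc k)) (inj₁ 0<δ))
            (bernoulli (inj₁ 0<δ) (suc k))) ⟩
      A * ((1# + δ) ^ suc k) ^ 7
        ≈⟨ *-congˡ (trans (^-assocʳ (1# + δ) (suc k) 7) (^-congʳ (1# + δ) (ℕ.*-comm (suc k) 7))) ⟩
      A * (1# + δ) ^ (7 ℕ.* suc k)
        ≤⟨ bound k N≤k ⟩
      fromℕ (B ℕ.* (C ℕ.* suc k ℕ.^ 6))
        ≈⟨ reflexive (≡.cong fromℕ (≡.trans (≡.sym (ℕ.*-assoc B C (suc k ℕ.^ 6)))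
            (ℕ.*-comm (B ℕ.* C) (suc k ℕ.^ 6)))) ⟩
      fromℕ (suc k ℕ.^ 6 ℕ.* (B ℕ.* C))
        ≈⟨ trans (fromℕ-* (suc k ℕ.^ 6) (B ℕ.* C)) (*-congʳ (fromℕ-^ (suc k) 6)) ⟩
      m ^ 6 * fromℕ (B ℕ.* C) ∎)
      where
      m = fromℕ (suc k)

  module _ (c θ : Carrier) (0<c : 0# < c) (c³≈θ : c ^ 3 ≈ θ)
      (81θ≈44 : fromℕ 81 * θ ≈ fromℕ 44) where

    0<θ : 0# < θ
    0<θ = <-respʳ-≈ c³≈θ (^-positive 3 0<c)

    c^dimension : ∀ j → c ^ dimension j ≈ θ * θ ^ j
    c^dimension j = trans (^-congʳ c (dimension≡ j))
        (trans (sym (^-assocʳ c 3 (suc j))) (^-congˡ (suc j) c³≈θ))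

    -- Let D be the dimension. As c^D = θ^(j + 1), the assumption on ρ makes s at least D! θ^(j + 1)
    -- (1 + δ)^D, while 44^j = 81^j θ^j turns the upper bound for s into B θ^j D! times
    -- `growthFactor j`. After cancelling, an exponential stands against a polynomial.
    efficiency-bound : ∀ {ρ δ} j s B → 0# ≤ δ →
        ρ ^ dimension j ≈ fromℕ s / fromℕ (dimension j !) → c * (1# + δ) ≤ ρ →
      s ℕ.* 81 ℕ.^ j ℕ.≤ B ℕ.* (44 ℕ.^ j ℕ.* (growthFactor j ℕ.* dimension j !)) →
      θ * (1# + δ) ^ dimension j ≤ fromℕ (B ℕ.* growthFactor j)
    efficiency-bound {ρ} {δ} j s B 0≤δ ρ^D≈ r≤ρ s≤ = *-cancelˡ-≤ (*-positive 0<F 0<K) (begin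
      F * K * (θ * q ^ D)
        ≈⟨ *-congʳ (*-congˡ K≈) ⟩
      F * (E * θ ^ j) * (θ * q ^ D)
        ≈⟨ regroup F E (θ ^ j) θ (q ^ D) ⟩
      E * (F * (θ * θ ^ j * q ^ D))
        ≈⟨ *-congˡ (*-congˡ (trans (*-congʳ (sym (c^dimension j))) (sym (^-distrib-* c q D)))) ⟩
      E * (F * (c * q) ^ D)
        ≤⟨ *-monoˡ-≤ (^-nonneg j (fromℕ-nonneg 81))
            (*-monoˡ-≤ (inj₁ 0<F) (^-monoˡ-≤ D (*-nonneg (inj₁ 0<c) 0≤q) r≤ρ)) ⟩
      E * (F * ρ ^ D)
        ≈⟨ *-congˡ (trans (*-congˡ ρ^D≈) (trans (x*yz≈y*xz F _ _)
            (trans (*-congˡ (*-inverse 0<F)) (*-identityʳ _)))) ⟩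
      E * fromℕ s
        ≈⟨ trans (*-comm E _) (trans (*-congˡ (sym (fromℕ-^ 81 j))) (sym (fromℕ-* s (81 ℕ.^ j)))) ⟩
      fromℕ (s ℕ.* 81 ℕ.^ j)
        ≤⟨ fromℕ-mono-≤ s≤ ⟩
      fromℕ (B ℕ.* (44 ℕ.^ j ℕ.* (growthFactor j ℕ.* D !)))
        ≈⟨ trans (fromℕ-* B _) (*-congˡ (trans (fromℕ-* (44 ℕ.^ j) _)
            (*-cong (fromℕ-^ 44 j) (fromℕ-* (growthFactor j) (D !))))) ⟩
      fromℕ B * (K * (fromℕ (growthFactor j) * F))
        ≈⟨ regroup′ (fromℕ B) K (fromℕ (growthFactor j)) F ⟩
      F * K * (fromℕ B * fromℕ (growthFactor j))
        ≈⟨ *-congˡ (sym (fromℕ-* B (growthFactor j))) ⟩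
      F * K * fromℕ (B ℕ.* growthFactor j) ∎)
      where
      open ≤-Reasoning
      D = dimension j
      F = fromℕ (D !)
      K = fromℕ 44 ^ j
      E = fromℕ 81 ^ j
      q = 1# + δ
      0≤q : 0# ≤ q
      0≤q = ≤-trans 0≤1 (1≤1+δ 0≤δ)
      0<F : 0# < F
      0<F = fromℕ-pos (D !) {{(dimension j) ℕ.!≢0}}
      0<K : 0# < K
      0<K = ^-positive j (fromℕ-positive 43)
      K≈ : K ≈ E * θ ^ j
      K≈ = trans (^-congˡ j (sym 81θ≈44)) (^-distrib-* (fromℕ 81) θ j)
      regroup : ∀ F E t u v → F * (E * t) * (u * v) ≈ E * (F * (u * t * v))
      regroup F E t u v = trans (*-congʳ (x*yz≈y*xz F E t))
          (trans (*-assoc E _ _) (*-congˡ (trans (*-assoc F t _)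
        (*-congˡ (trans (sym (*-assoc t u v)) (*-congʳ (*-comm t u)))))))
      regroup′ : ∀ b k g f → b * (k * (g * f)) ≈ f * k * (b * g)
      regroup′ b k g f = trans (x*yz≈y*xz b k (g * f)) (trans (*-congˡ (sym (*-assoc b g f)))
        (trans (*-congˡ (*-comm _ f)) (trans (sym (*-assoc k f _)) (*-congʳ (*-comm k f)))))

-- The bound for the limit

module Conclusion {ℓ} (ℝ : CompleteOrderedField ℓ) where
  open CompleteOrderedField ℝ hiding (zero)
  open Reals ℝ
  open Forms ℝ
  open CubeTriangulations ℝ
  open Asymptotics ℝ using (efficientProduct)
  open Limits ℝ
  open CommutativeSemigroupProperties *-commutativeSemigroup using ()
    renaming (interchange to *-interchange; x∙yz≈y∙xz to x*yz≈y*xz)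

  81*44/3/27≈44 : fromℕ 81 * ((fromℕ 44 / fromℕ 3) / fromℕ 27) ≈ fromℕ 44
  81*44/3/27≈44 = begin
    fromℕ 81 * ((fromℕ 44 / fromℕ 3) / fromℕ 27)
      ≈⟨ *-cong (fromℕ-* 3 27) refl ⟩
    fromℕ 3 * fromℕ 27 * ((fromℕ 44 / fromℕ 3) / fromℕ 27)
      ≈⟨ *-interchange (fromℕ 3) (fromℕ 27) (fromℕ 44 / fromℕ 3) (fromℕ 27 ⁻¹) ⟩
    fromℕ 3 * (fromℕ 44 / fromℕ 3) * (fromℕ 27 / fromℕ 27)
      ≈⟨ *-cong (x*yz≈y*xz (fromℕ 3) (fromℕ 44) (fromℕ 3 ⁻¹)) (*-inverse (fromℕ-positive 26)) ⟩
    fromℕ 44 * (fromℕ 3 / fromℕ 3) * 1#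
      ≈⟨ trans (*-identityʳ _) (trans (*-congˡ (*-inverse (fromℕ-positive 2))) (*-identityʳ _)) ⟩
    fromℕ 44 ∎
    where open ≈-Reasoning

  j≤dimension : ∀ j → j ℕ.≤ dimension j
  j≤dimension j = ℕ.≤-trans (ℕ.n≤1+n j) (ℕ.≤-trans (ℕ.m≤n*m (suc j) 3)
      (ℕ.≤-reflexive (≡.sym (dimension≡ j))))

  1≤dimension : ∀ j → 1 ℕ.≤ dimension j
  1≤dimension zero    = ℕ.s≤s ℕ.z≤n
  1≤dimension (suc j) = ℕ.s≤s ℕ.z≤n

  -- If c < l, the efficiencies eventually exceed c (1 + δ) for a fixed δ > 0, and the smallest
  -- sizes would outgrow by an exponential factor what the product construction allows.
  limit≤ : (ρ : ℕ → Carrier) → (∀ d → 1 ℕ.≤ d → IsSmallestEfficiency d (ρ d)) →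
    ∀ l → IsLimit ρ l → ∀ c → IsRoot 3 ((fromℕ 44 / fromℕ 3) / fromℕ 27) c → l ≤ c
  limit≤ ρ smallest l limit c (0≤c , c³≈θ) with compare l c
  ... | tri< l<c _ _ = inj₁ l<c
  ... | tri≈ _ l≈c _ = inj₂ l≈c
  ... | tri> _ _ c<l = contradiction bound (exponential-outgrows
      (0<θ c θ 0<c c³≈θ 81*44/3/27≈44) 0<δ (φ 0) (9 ℕ.^ 6) N)
    where
    θ = (fromℕ 44 / fromℕ 3) / fromℕ 27
    θ>0 : 0# < θ
    θ>0 = *-positive (*-positive (fromℕ-positive 43) (⁻¹-positive (fromℕ-positive 2)))
        (⁻¹-positive (fromℕ-positive 26))
    -- `IsRoot` gives only 0 ≤ c, but c = 0 would make θ = 0; positivity is needed to divide by c.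
    0<c : 0# < c
    0<c = [ id , (λ 0≈c → contradiction θ>0 (<-irrefl
        (trans (sym (zeroˡ (c * (c * 1#)))) (trans (*-congʳ 0≈c) c³≈θ)))) ]′ 0≤c

    0<2 : 0# < 1# + 1#
    0<2 = <-trans 0<1 (<-respˡ-≈ (+-identityʳ 1#) (+-monoʳ-< 1# 0<1))
    -- Half of the distance, so that l - ε = c (1 + δ) still exceeds c.
    ε = (1# + 1#) ⁻¹ * (l - c)
    0<ε : 0# < ε
    0<ε = *-positive (⁻¹-positive 0<2) (x<y⇒0<y-x c<l)
    2ε≈l-c : ε + ε ≈ l - c
    2ε≈l-c = trans (sym (trans (distribʳ ε 1# 1#) (+-cong (*-identityˡ ε) (*-identityˡ ε))))
      (trans (sym (*-assoc _ _ _)) (trans (*-congʳ (*-inverse 0<2)) (*-identityˡ _)))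
    δ = c ⁻¹ * ε
    0<δ : 0# < δ
    0<δ = *-positive (⁻¹-positive 0<c) 0<ε
    c[1+δ]≈l-ε : c * (1# + δ) ≈ l - ε
    c[1+δ]≈l-ε = begin
      c * (1# + δ)        ≈⟨ distribˡ c 1# δ ⟩
      c * 1# + c * δ      ≈⟨ +-cong (*-identityʳ c)
          (trans (sym (*-assoc c (c ⁻¹) ε)) (trans (*-congʳ (*-inverse 0<c)) (*-identityˡ ε))) ⟩
      c + ε               ≈⟨ sym (trans (+-congˡ (x-x≈0 ε)) (+-identityʳ _)) ⟩
      c + ε + (ε - ε)     ≈⟨ trans (sym (+-assoc _ _ _)) (+-congʳ (+-assoc c ε ε)) ⟩
      c + (ε + ε) - ε     ≈⟨ +-congʳ (trans (+-congˡ 2ε≈l-c) (trans (+-comm c _) (x-y+y≈x l c))) ⟩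
      l - ε               ∎
      where open ≈-Reasoning

    N = proj₁ (limit ε 0<ε)

    φ : ℕ → ℕ
    φ j = proj₁ (smallest (dimension j) (1≤dimension j))

    φ-step : ∀ j → 81 ℕ.* φ (suc j) ℕ.≤ 44 ℕ.* (φ j ℕ.* (suc (dimension j) ℕ.+ 5) ℕ.^ 3)
    φ-step j with smallest (dimension j) (1≤dimension j) | smallest (dimension (suc j))
        (1≤dimension (suc j))
    -- T has the smallest size in its dimension, and the smallest size three dimensions higher is at
    -- most that of the product built from T.
    ... | _ , ((T , ≡.refl) , _) , _ | _ , (_ , minimal) , _ =
      let T′ , efficient = efficientProduct T in ℕ.≤-trans (ℕ.*-monoʳ-≤ 81 (minimal T′)) efficient

    bound : ∀ k → N ℕ.≤ k → θ * (1# + δ) ^ (7 ℕ.* suc k) ≤ fromℕ (φ 0 ℕ.* (9 ℕ.^ 6 ℕ.* suc k ℕ.^ 6))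
    bound k N≤k = ≤-trans (*-monoˡ-≤ (inj₁ θ>0) (^-monoʳ-≤ (inj₁ 0<δ) (j≤dimension j)))
      (≤-trans (efficiency-bound c θ 0<c c³≈θ 81*44/3/27≈44 j (φ j) (φ 0) (inj₁ 0<δ)
        (proj₂ (proj₂ (proj₂ (smallest (dimension j) (1≤dimension j)))))
        (≤-respˡ (sym c[1+δ]≈l-ε) (inj₁ (proj₁
            (proj₂ (limit ε 0<ε) (dimension j)
            (ℕ.≤-trans (ℕ.≤-trans N≤k (ℕ.≤-trans (ℕ.n≤1+n k) (ℕ.m≤n*m (suc k) 7)))
            (j≤dimension j))))))
        (growth φ φ-step j))
      (fromℕ-mono-≤ (ℕ.*-monoʳ-≤ (φ 0) (growthFactor-bound k))))
      where j = 7 ℕ.* suc k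

mainTheorem1 : ∀ {ℓ} (ℝ : CompleteOrderedField ℓ) →
    let open CompleteOrderedField ℝ
        open CubeTriangulations ℝ
    in
    (ρ : ℕ → Carrier) → (∀ d → 1 ℕ.≤ d → IsSmallestEfficiency d (ρ d)) →
    ∀ l → IsLimit ρ l →
    ∀ c → IsRoot 3 ((fromℕ 44 / fromℕ 3) / fromℕ 27) c →
    l ≤ c
mainTheorem1 ℝ = Conclusion.limit≤ ℝ
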